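{- Let $n \equiv 2 \pmod 4$ be a positive integer. Write $n^2 + 16 = y^2 d$ with $y$ a positive integer and $d$ squarefree, and assume that $$\epsilon = \frac{n + y\sqrt{d}}{4}$$ is the fundamental unit of $k_n = \mathbb{Q}(\sqrt{d})$. Define $u_j = \frac{\epsilon^j - \overline{\epsilon}^j}{\epsilon - \overline{\epsilon}}$ and $v_j = \epsilon^j + \overline{\epsilon}^j$ for $j \geq 0$, where $\overline{\epsilon}$ is the Galois conjugate of $\epsilon$. Let $r_0$ be the smallest odd positive index $r$ for which $d \mid u_r$, and suppose there is a prime $p \equiv 1 \pmod 4$ dividing $v_{r_0}$ such that $d\,u_{r_0}$ is a quadratic nonresidue modulo $p$. Then there is no positive integer $m \neq n$ with $K_m = K_n$.
   Context: For a positive integer $n \neq 3$, $K_n = \mathbb{Q}(\rho)$ where $\rho$ is a root of $f_n(x) = x^4 - n x^3 - 6x^2 + n x + 1$ (a cyclic quartic field, with unique quadratic subfield $k_n = \mathbb{Q}(\sqrt{n^2+16})$); for $m = 3$ one does not define $K_m$, so $m$ ranges over positive integers $\neq 3$. With $t = \mathrm{Trace}(\epsilon)$, the numbers $u_j, v_j$ are integers satisfying $u_0 = 0$, $u_1 = 1$, $u_{j+2} = t u_{j+1} + u_j$ and $v_0 = 2$, $v_1 = t$, $v_{j+2} = t v_{j+1} + v_j$. -}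

module Defs where

open import Data.Nat as ℕ using (ℕ; zero; suc)
open import Data.Nat.Divisibility using (_∣_)
open import Data.Integer as ℤ using (ℤ; +_)
open import Data.Rational as ℚ using (ℚ; 0ℚ; 1ℚ; _/_)
open import Data.Product using (Σ; ∃; _×_; _,_)
open import Data.Sum using (_⊎_)
open import Relation.Binary.PropositionalEquality using (_≡_)
open import Function.Definitions using (Injective; Surjective)

SquareFree : ℕ → Set
SquareFree d = (d ℕ.≥ 1) × (∀ q → q ℕ.* q ∣ d → q ≡ 1)

-- The real quadratic field Q(√d), d squarefree.  Every element of its
-- ring of integers has the form (a + b√d)/2 with a b : ℤ; such an element
-- is a unit iff its norm (a² - d b²)/4 is ±1, i.e. a² - d b² = ±4.
-- We encode (a + b√d)/2 by the pair (a , b).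

IsUnitPair : ℕ → ℤ → ℤ → Set
IsUnitPair d a b =
  (a ℤ.* a ℤ.- (+ d) ℤ.* b ℤ.* b ≡ + 4) ⊎ (a ℤ.* a ℤ.- (+ d) ℤ.* b ℤ.* b ≡ ℤ.- (+ 4))

-- Powers of ε = (n + y√d)/4 :  ε^k = (A k + B k √d) / 4^k.
powA powB : ℕ → ℕ → ℕ → ℕ → ℤ
powA n y d zero = + 1
powA n y d (suc k) = (+ n) ℤ.* powA n y d k ℤ.+ (+ d) ℤ.* (+ y) ℤ.* powB n y d k
powB n y d zero = + 0
powB n y d (suc k) = (+ y) ℤ.* powA n y d k ℤ.+ (+ n) ℤ.* powB n y d k

-- ε = (n + y√d)/4 (> 1) is THE fundamental unit of Q(√d): the unit group
-- of the ring of integers is {± ε^k : k ∈ ℤ}.  A unit (a + b√d)/2 equals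
-- s·ε^k (k ≥ 0, s = ±1) iff 4^k a = 2 s A_k and 4^k b = 2 s B_k, and
-- equals s·ε^(-k) = s(-1)^k ε̄^k iff 4^k a = 2 s' A_k, 4^k b = - 2 s' B_k
-- with s' = ±1.
IsFundamentalUnit : (n y d : ℕ) → Set
IsFundamentalUnit n y d =
  ∀ (a b : ℤ) → IsUnitPair d a b →
    ∃ λ (k : ℕ) → ∃ λ (s : ℤ) → (s ≡ + 1 ⊎ s ≡ ℤ.- (+ 1)) ×
      ((+ (4 ℕ.^ k)) ℤ.* a ≡ + 2 ℤ.* s ℤ.* powA n y d k) ×
      (((+ (4 ℕ.^ k)) ℤ.* b ≡ + 2 ℤ.* s ℤ.* powB n y d k) ⊎
       ((+ (4 ℕ.^ k)) ℤ.* b ≡ ℤ.- (+ 2 ℤ.* s ℤ.* powB n y d k)))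

lucasU : ℕ → ℕ → ℕ
lucasU t zero = 0
lucasU t (suc zero) = 1
lucasU t (suc (suc j)) = t ℕ.* lucasU t (suc j) ℕ.+ lucasU t j

lucasV : ℕ → ℕ → ℕ
lucasV t zero = 2
lucasV t (suc zero) = t
lucasV t (suc (suc j)) = t ℕ.* lucasV t (suc j) ℕ.+ lucasV t j

-- The field K_n = Q(ρ), ρ a root of f_n = x⁴ - n x³ - 6x² + n x + 1,
-- realised as Q[x]/(f_n): elements c0 + c1 ρ + c2 ρ² + c3 ρ³.

record K (n : ℕ) : Set where
  constructor ⟨_,_,_,_⟩
  field
    c0 c1 c2 c3 : ℚ

private
  qn : ℕ → ℚ
  qn n = (+ n) / 1

  q6 : ℚ
  q6 = (+ 6) / 1

-- One reduction step using x⁴ = n x³ + 6 x² - n x - 1 on the top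
-- coefficient (of x^(j+4)), giving the new coefficients of x^(j+3) .. x^j.
step : ℕ → (top a3 a2 a1 a0 : ℚ) → ℚ × ℚ × ℚ × ℚ
step n top a3 a2 a1 a0 =
  (a3 ℚ.+ qn n ℚ.* top) , (a2 ℚ.+ q6 ℚ.* top) , (a1 ℚ.- qn n ℚ.* top) , (a0 ℚ.- top)

reduce : (n : ℕ) → (e0 e1 e2 e3 e4 e5 e6 : ℚ) → K n
reduce n e0 e1 e2 e3 e4 e5 e6 with step n e6 e5 e4 e3 e2
... | (f5 , f4 , f3 , f2) with step n f5 f4 f3 f2 e1
... | (g4 , g3 , g2 , g1) with step n g4 g3 g2 g1 e0
... | (h3 , h2 , h1 , h0) = ⟨ h0 , h1 , h2 , h3 ⟩

_+K_ : ∀ {n} → K n → K n → K n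
⟨ a0 , a1 , a2 , a3 ⟩ +K ⟨ b0 , b1 , b2 , b3 ⟩ =
  ⟨ a0 ℚ.+ b0 , a1 ℚ.+ b1 , a2 ℚ.+ b2 , a3 ℚ.+ b3 ⟩

_*K_ : ∀ {n} → K n → K n → K n
_*K_ {n} ⟨ a0 , a1 , a2 , a3 ⟩ ⟨ b0 , b1 , b2 , b3 ⟩ =
  reduce n (a0 ℚ.* b0)
           (a0 ℚ.* b1 ℚ.+ a1 ℚ.* b0)
           (a0 ℚ.* b2 ℚ.+ a1 ℚ.* b1 ℚ.+ a2 ℚ.* b0)
           (a0 ℚ.* b3 ℚ.+ a1 ℚ.* b2 ℚ.+ a2 ℚ.* b1 ℚ.+ a3 ℚ.* b0)
           (a1 ℚ.* b3 ℚ.+ a2 ℚ.* b2 ℚ.+ a3 ℚ.* b1)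
           (a2 ℚ.* b3 ℚ.+ a3 ℚ.* b2)
           (a3 ℚ.* b3)

1K : ∀ {n} → K n
1K = ⟨ 1ℚ , 0ℚ , 0ℚ , 0ℚ ⟩

-- K_m = K_n (as cyclic, hence Galois, quartic fields): the fields are
-- isomorphic, i.e. there is a bijective unital ring homomorphism
-- K_m → K_n (automatically Q-linear).
record FieldIso (m n : ℕ) : Set where
  field
    φ      : K m → K n
    φ-+    : ∀ a b → φ (a +K b) ≡ φ a +K φ b
    φ-*    : ∀ a b → φ (a *K b) ≡ φ a *K φ b
    φ-1    : φ 1K ≡ 1K
    φ-inj  : Injective _≡_ _≡_ φ
    φ-surj : Surjective _≡_ _≡_ φ

SameField : ℕ → ℕ → Set
SameField m n = FieldIso m n

{-# OPTIONS --safe #-}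

module Submission where

-- Over k = ℚ(√d) the field K_n is k(√γ), where γ = w² + 4 and w = (n + y√d)/2 = 2ε, and a root ξ of
-- f_m gives W = ξ - 1/ξ with (2W - m)² = m² + 16 and (2ξ - W)² = W² + 4. If ξ lies in K_n, norms to ℚ
-- force 2W - m = b√d and make γ(W² + 4) a square in k. Here m is even (compare squares modulo 32), so
-- (m + |b|√d)/4 is a unit of norm -1, hence an odd power ε^k; thus m = 2v_k, b = ±u_k y, and removing
-- unit squares leaves u_k ∈ {□, d□}.
-- If u_k = □, Cohn's congruence u_k ≡ -1 modulo some v_e ≡ 3 (mod 4) forces k = 1, that is m = n.
-- If u_k = d□, then k is an odd multiple of r₀ and u_k ≡ u_{r₀} (mod v_{r₀}), so d u_{r₀} is a square
-- modulo p.

open import Defs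
open import Level using (Level; 0ℓ)
open import Algebra.Bundles using (AbelianGroup; CommutativeRing)
import Algebra.Construct.DirectProduct as DirectProduct
import Algebra.Morphism.Construct.Composition as Composition
import Algebra.Morphism.Construct.Identity as Identity
open import Algebra.Morphism.Structures using (IsRingHomomorphism)
import Algebra.Solver.Ring as RingSolver
open import Algebra.Solver.Ring.AlmostCommutativeRing using (fromCommutativeRing; _-Raw-AlmostCommutative⟶_)
open import Data.Empty using (⊥; ⊥-elim)
open import Data.Fin using (Fin; toℕ; fromℕ<)
open import Data.Fin.Properties using (all?; toℕ-fromℕ<)
open import Data.Integer as ℤ using (ℤ; +_; -[1+_])
open import Data.Integer.Divisibility hiding (divides) renaming (_∣_ to _∣ℤ_)
import Data.Integer.Properties as ℤ
import Data.Integer.Tactic.RingSolver as ℤSolver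
open import Data.Maybe using (Maybe; just; nothing)
open import Data.Nat as ℕ using (ℕ; zero; suc; _≤_; _<_; z≤n; s≤s; NonZero)
open import Data.Nat.Coprimality using (coprime-divisor)
import Data.Nat.Coprimality as Coprimality
open import Data.Nat.Divisibility using (_∣_; divides; ∣m+n∣m⇒∣n; m∣m*n; n∣m*n; ∣m∣n⇒∣m+n; ∣m⇒∣m*n; ∣n⇒∣m*n; ∣1⇒≡1; m%n≡0⇒n∣m)
open import Data.Nat.DivMod using (_%_; _/_; m≡m%n+[m/n]*n; m%n<n; [m+kn]%n≡m%n; %-distribˡ-*; %-distribˡ-+; m∣n⇒o%n%m≡o%m; m*n%n≡0)
open import Data.Nat.Induction using (<-rec)
open import Data.Nat.Primality using (Prime)
import Data.Nat.Properties as ℕ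
import Data.Nat.Tactic.RingSolver as ℕSolver
open import Data.Product using (_×_; _,_; proj₁; proj₂; ∃)
open import Data.Rational as ℚ using (ℚ; 0ℚ; 1ℚ; ½; mkℚ)
import Data.Rational.Properties as ℚ
open import Data.Rational.Unnormalised as ℚᵘ using (mkℚᵘ; *≡*)
import Data.Rational.Unnormalised.Properties as ℚᵘ
open import Data.Sum using (_⊎_; inj₁; inj₂)
open import Relation.Binary.Definitions using (tri<; tri≈; tri>)
open import Relation.Binary.PropositionalEquality as ≡ using (_≡_; _≢_)
open import Relation.Nullary using (¬_; yes; no; ¬?)
open import Relation.Nullary.Decidable using (from-yes; _→-dec_)

-- One fact drives every norm argument. If e² + 16 = d b² and w = (e + b√d)/2, then w times its
-- conjugate is -4, so w² + 4 = w · b√d, and the norm of this to ℚ is d(2b)². As d is not a rational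
-- square, the square of a nonzero rational is never d times a rational square; this excludes both
-- γB² = m² + 16 and a square root in k of W² + 4. The same factorisation produces u_k: for w = 2ε
-- and w′ = 2ε^k the product of the two values of γ is 4ε^(k+1) · d u_k y², and ε^(k+1) is a square
-- because k is odd. A square of k that lies in ℚ is a rational square or d times one, which leaves
-- u_k = d□ or u_k = □. The field K_n is given only by coordinates modulo f_n, where computing would
-- unfold rational arithmetic. The isomorphism therefore serves to carry one root of f_m, by
-- evaluation at a root of f_n, into rings of pairs ℚ ⊂ k ⊂ k(√γ); there (a + b√δ)² has
-- √δ-coordinate 2ab, which settles every question about square roots.

-- Integer coefficients in an arbitrary commutative ring.

module IntegerSolver {c ℓ : Level} (R : CommutativeRing c ℓ) where
  open CommutativeRing R
  open import Algebra.Properties.Semiring.Mult.TCOptimised semiring using (1+×; ×1-homo-*; ×-homo-+) renaming (_×_ to _⊠_)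
  open import Algebra.Properties.Ring ring using (-‿distribˡ-*; -‿distribʳ-*; -0#≈0#; -‿involutive; -‿+-comm)
  open import Relation.Binary.Reasoning.Setoid setoid

  -- The canonical map from ℤ. With solver coefficients in ℤ, where equality is decidable, numerals
  -- cancel in every ring of the tower, even where the ring's own equality is abstract.
  fromℤ : ℤ → Carrier
  fromℤ (+ n) = n ⊠ 1#
  fromℤ -[1+ n ] = - (suc n ⊠ 1#)

  cancel-1# : ∀ x y → x - y ≈ (1# + x) - (1# + y)
  cancel-1# x y = sym (begin
    (1# + x) + - (1# + y)     ≈⟨ +-cong (+-comm x 1#) (-‿+-comm 1# y) ⟨
    (x + 1#) + (- 1# + - y)   ≈⟨ +-assoc x 1# _ ⟩
    x + (1# + (- 1# + - y))   ≈⟨ +-congˡ (+-assoc 1# (- 1#) (- y)) ⟨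
    x + ((1# + - 1#) + - y)   ≈⟨ +-congˡ (+-congʳ (-‿inverseʳ 1#)) ⟩
    x + (0# + - y)            ≈⟨ +-congˡ (+-identityˡ (- y)) ⟩
    x - y                     ∎)

  fromℤ-⊖ : ∀ m n → fromℤ (m ℤ.⊖ n) ≈ m ⊠ 1# - n ⊠ 1#
  fromℤ-⊖ m zero = begin
    m ⊠ 1#        ≈⟨ +-identityʳ _ ⟨
    m ⊠ 1# + 0#   ≈⟨ +-congˡ -0#≈0# ⟨
    m ⊠ 1# - 0#   ∎
  fromℤ-⊖ zero (suc n) = sym (+-identityˡ _)
  fromℤ-⊖ (suc m) (suc n) = begin
    fromℤ (suc m ℤ.⊖ suc n)            ≡⟨ ≡.cong fromℤ (ℤ.[1+m]⊖[1+n]≡m⊖n m n) ⟩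
    fromℤ (m ℤ.⊖ n)                    ≈⟨ fromℤ-⊖ m n ⟩
    m ⊠ 1# - n ⊠ 1#                    ≈⟨ cancel-1# _ _ ⟩
    (1# + m ⊠ 1#) - (1# + n ⊠ 1#)      ≈⟨ +-cong (1+× m 1#) (-‿cong (1+× n 1#)) ⟨
    suc m ⊠ 1# - suc n ⊠ 1#            ∎

  fromℤ-+ : ∀ i j → fromℤ (i ℤ.+ j) ≈ fromℤ i + fromℤ j
  fromℤ-+ (+ m) (+ n) = ×-homo-+ 1# m n
  fromℤ-+ (+ m) -[1+ n ] = fromℤ-⊖ m (suc n)
  fromℤ-+ -[1+ m ] (+ n) = trans (fromℤ-⊖ n (suc m)) (+-comm _ _)
  fromℤ-+ -[1+ m ] -[1+ n ] = begin
    - (suc (suc (m ℕ.+ n)) ⊠ 1#)           ≡⟨ ≡.cong (λ k → - (suc k ⊠ 1#)) (≡.sym (ℕ.+-suc m n)) ⟩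
    - ((suc m ℕ.+ suc n) ⊠ 1#)             ≈⟨ -‿cong (×-homo-+ 1# (suc m) (suc n)) ⟩
    - (suc m ⊠ 1# + suc n ⊠ 1#)            ≈⟨ -‿+-comm _ _ ⟨
    - (suc m ⊠ 1#) + - (suc n ⊠ 1#)        ∎

  fromℤ-neg : ∀ i → fromℤ (ℤ.- i) ≈ - fromℤ i
  fromℤ-neg (+ zero) = sym -0#≈0#
  fromℤ-neg (+ suc n) = refl
  fromℤ-neg -[1+ n ] = sym (-‿involutive _)

  fromℤ-+* : ∀ m j → fromℤ (+ m ℤ.* j) ≈ m ⊠ 1# * fromℤ j
  fromℤ-+* m (+ n) = begin
    fromℤ (+ m ℤ.* + n)    ≡⟨ ≡.cong fromℤ (ℤ.pos-* m n) ⟨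
    (m ℕ.* n) ⊠ 1#         ≈⟨ ×1-homo-* m n ⟩
    m ⊠ 1# * n ⊠ 1#        ∎
  fromℤ-+* m -[1+ n ] = begin
    fromℤ (+ m ℤ.* -[1+ n ])         ≡⟨ ≡.cong fromℤ (ℤ.neg-distribʳ-* (+ m) (+ suc n)) ⟨
    fromℤ (ℤ.- (+ m ℤ.* + suc n))    ≈⟨ fromℤ-neg (+ m ℤ.* + suc n) ⟩
    - fromℤ (+ m ℤ.* + suc n)        ≈⟨ -‿cong (fromℤ-+* m (+ suc n)) ⟩
    - (m ⊠ 1# * suc n ⊠ 1#)          ≈⟨ -‿distribʳ-* _ _ ⟩
    m ⊠ 1# * - (suc n ⊠ 1#)          ∎

  fromℤ-* : ∀ i j → fromℤ (i ℤ.* j) ≈ fromℤ i * fromℤ j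
  fromℤ-* (+ m) j = fromℤ-+* m j
  fromℤ-* -[1+ m ] j = begin
    fromℤ (-[1+ m ] ℤ.* j)           ≡⟨ ≡.cong fromℤ (ℤ.neg-distribˡ-* (+ suc m) j) ⟨
    fromℤ (ℤ.- (+ suc m ℤ.* j))      ≈⟨ fromℤ-neg (+ suc m ℤ.* j) ⟩
    - fromℤ (+ suc m ℤ.* j)          ≈⟨ -‿cong (fromℤ-+* (suc m) j) ⟩
    - (suc m ⊠ 1# * fromℤ j)         ≈⟨ -‿distribˡ-* _ _ ⟩
    - (suc m ⊠ 1#) * fromℤ j         ∎

  morphism : ℤ.+-*-rawRing -Raw-AlmostCommutative⟶ fromCommutativeRing R
  morphism = record
    { ⟦_⟧ = fromℤ ; +-homo = fromℤ-+ ; *-homo = fromℤ-* ; -‿homo = fromℤ-neg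
    ; 0-homo = refl ; 1-homo = refl }

  coefficient≟ : ∀ i j → Maybe (fromℤ i ≈ fromℤ j)
  coefficient≟ i j with i ℤ.≟ j
  ... | yes ≡.refl = just refl
  ... | no _ = nothing

  open RingSolver ℤ.+-*-rawRing (fromCommutativeRing R) morphism coefficient≟ public
    using (con; _:+_; _:*_; _:-_; :-_; _:=_; solve)

-- Quadratic extensions as rings of pairs.

module Quadratic {c ℓ : Level} (R : CommutativeRing c ℓ) (δ : CommutativeRing.Carrier R) where
  open CommutativeRing R
  open IntegerSolver R
  open DirectProduct using (abelianGroup)

  -- The pair (a , b) stands for a + b√δ, so the ring is R[x]/(x² - δ); it exists for every `δ`,
  -- square or not.
  _*²_ : Carrier × Carrier → Carrier × Carrier → Carrier × Carrier
  (a , b) *² (a′ , b′) = a * a′ + δ * (b * b′) , a * b′ + b * a′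

  commutativeRing : CommutativeRing c ℓ
  commutativeRing = record
    { _*_ = _*²_
    ; 1# = 1# , 0#
    ; isCommutativeRing = record
      { isRing = record
        { +-isAbelianGroup = isAbelianGroup
        ; *-cong = λ { (p , q) (p′ , q′) →
            +-cong (*-cong p p′) (*-congˡ (*-cong q q′)) , +-cong (*-cong p q′) (*-cong q p′) }
        ; *-assoc = λ { (a , b) (a′ , b′) (a″ , b″) →
            solve 7 (λ δ a b a′ b′ a″ b″ →
              (a :* a′ :+ δ :* (b :* b′)) :* a″ :+ δ :* ((a :* b′ :+ b :* a′) :* b″)
              := a :* (a′ :* a″ :+ δ :* (b′ :* b″)) :+ δ :* (b :* (a′ :* b″ :+ b′ :* a″)))
              refl δ a b a′ b′ a″ b″ ,
            solve 7 (λ δ a b a′ b′ a″ b″ →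
              (a :* a′ :+ δ :* (b :* b′)) :* b″ :+ (a :* b′ :+ b :* a′) :* a″
              := a :* (a′ :* b″ :+ b′ :* a″) :+ b :* (a′ :* a″ :+ δ :* (b′ :* b″)))
              refl δ a b a′ b′ a″ b″ }
        ; *-identity =
            (λ { (a , b) →
              solve 3 (λ δ a b → con (+ 1) :* a :+ δ :* (con (+ 0) :* b) := a) refl δ a b ,
              solve 2 (λ a b → con (+ 1) :* b :+ con (+ 0) :* a := b) refl a b }) ,
            (λ { (a , b) →
              solve 3 (λ δ a b → a :* con (+ 1) :+ δ :* (b :* con (+ 0)) := a) refl δ a b ,
              solve 2 (λ a b → a :* con (+ 0) :+ b :* con (+ 1) := b) refl a b })
        ; distrib =
            (λ { (a , b) (a′ , b′) (a″ , b″) →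
              solve 7 (λ δ a b a′ b′ a″ b″ →
                a :* (a′ :+ a″) :+ δ :* (b :* (b′ :+ b″))
                := (a :* a′ :+ δ :* (b :* b′)) :+ (a :* a″ :+ δ :* (b :* b″)))
                refl δ a b a′ b′ a″ b″ ,
              solve 6 (λ a b a′ b′ a″ b″ →
                a :* (b′ :+ b″) :+ b :* (a′ :+ a″)
                := (a :* b′ :+ b :* a′) :+ (a :* b″ :+ b :* a″))
                refl a b a′ b′ a″ b″ }) ,
            (λ { (a , b) (a′ , b′) (a″ , b″) →
              solve 7 (λ δ a b a′ b′ a″ b″ →
                (a′ :+ a″) :* a :+ δ :* ((b′ :+ b″) :* b)
                := (a′ :* a :+ δ :* (b′ :* b)) :+ (a″ :* a :+ δ :* (b″ :* b)))
                refl δ a b a′ b′ a″ b″ ,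
              solve 6 (λ a b a′ b′ a″ b″ →
                (a′ :+ a″) :* b :+ (b′ :+ b″) :* a
                := (a′ :* b :+ b′ :* a) :+ (a″ :* b :+ b″ :* a))
                refl a b a′ b′ a″ b″ })
        }
      ; *-comm = λ { (a , b) (a′ , b′) →
          +-cong (*-comm a a′) (*-congˡ (*-comm b b′)) ,
          trans (+-cong (*-comm a b′) (*-comm b a′)) (+-comm _ _) }
      }
    }
    where
    open AbelianGroup (abelianGroup +-abelianGroup +-abelianGroup)
      using (isAbelianGroup)

-- Ring homomorphisms and the integers inside ℚ.

ℚ-ring : CommutativeRing 0ℓ 0ℓ
ℚ-ring = ℚ.+-*-commutativeRing

IsHom : ∀ {a b c d} (R : CommutativeRing a b) (S : CommutativeRing c d) →
  (CommutativeRing.Carrier R → CommutativeRing.Carrier S) → Set _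
IsHom R S = IsRingHomomorphism (CommutativeRing.rawRing R) (CommutativeRing.rawRing S)

module _ {a b c d : Level} (R : CommutativeRing a b) (S : CommutativeRing c d)
  (f : CommutativeRing.Carrier R → CommutativeRing.Carrier S) (hom : IsHom R S f) where
  private
    module R where
      open CommutativeRing R public
      open IntegerSolver R public
      open import Algebra.Properties.Semiring.Mult.TCOptimised semiring public using (1+×)
    module S where
      open CommutativeRing S public
      open IntegerSolver S public
      open import Algebra.Properties.Semiring.Mult.TCOptimised semiring public using (1+×)
  open IsRingHomomorphism hom
  open import Relation.Binary.Reasoning.Setoid S.setoid

  hom-fromℤ+ : ∀ n → f (R.fromℤ (+ n)) S.≈ S.fromℤ (+ n)
  hom-fromℤ+ zero = 0#-homo
  hom-fromℤ+ (suc n) = begin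
    f (R.fromℤ (+ suc n))           ≈⟨ ⟦⟧-cong (R.1+× n R.1#) ⟩
    f (R.1# R.+ R.fromℤ (+ n))      ≈⟨ +-homo _ _ ⟩
    f R.1# S.+ f (R.fromℤ (+ n))    ≈⟨ S.+-cong 1#-homo (hom-fromℤ+ n) ⟩
    S.1# S.+ S.fromℤ (+ n)          ≈⟨ S.1+× n S.1# ⟨
    S.fromℤ (+ suc n)               ∎

module ℚSolver = IntegerSolver ℚ-ring

ratℕ : ℕ → ℚ
ratℕ n = (+ n) ℚ./ 1

ratℕ-+ : ∀ m n → ratℕ (m ℕ.+ n) ≡ ratℕ m ℚ.+ ratℕ n
ratℕ-+ m n = ℚ.toℚᵘ-injective (begin
  ℚ.toℚᵘ (ratℕ (m ℕ.+ n))                    ≈⟨ ℚ.toℚᵘ-fromℚᵘ (ℚᵘ.mkℚᵘ (+ (m ℕ.+ n)) 0) ⟩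
  ℚᵘ.mkℚᵘ (+ (m ℕ.+ n)) 0                    ≈⟨ ℚᵘ.*≡* (≡.cong (ℤ._* + 1) (≡.sym (≡.cong₂ ℤ._+_ (ℤ.*-identityʳ (+ m)) (ℤ.*-identityʳ (+ n))))) ⟩
  ℚᵘ.mkℚᵘ (+ m) 0 ℚᵘ.+ ℚᵘ.mkℚᵘ (+ n) 0       ≈⟨ ℚᵘ.+-cong (ℚ.toℚᵘ-fromℚᵘ (ℚᵘ.mkℚᵘ (+ m) 0)) (ℚ.toℚᵘ-fromℚᵘ (ℚᵘ.mkℚᵘ (+ n) 0)) ⟨
  ℚ.toℚᵘ (ratℕ m) ℚᵘ.+ ℚ.toℚᵘ (ratℕ n)       ≈⟨ ℚ.toℚᵘ-homo-+ (ratℕ m) (ratℕ n) ⟨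
  ℚ.toℚᵘ (ratℕ m ℚ.+ ratℕ n)                 ∎)
  where open import Relation.Binary.Reasoning.Setoid ℚᵘ.≃-setoid

ratℕ≡fromℤ : ∀ n → ratℕ n ≡ ℚSolver.fromℤ (+ n)
ratℕ≡fromℤ zero = ≡.refl
ratℕ≡fromℤ (suc n) = ≡.trans (ratℕ-+ 1 n) (≡.trans (≡.cong (1ℚ ℚ.+_) (ratℕ≡fromℤ n)) (≡.sym (1+× n 1ℚ)))
  where open import Algebra.Properties.Semiring.Mult.TCOptimised (CommutativeRing.semiring ℚ-ring) using (1+×)

-- Roots of f_n and ring maps out of K_n.

module _ {c ℓ : Level} (R : CommutativeRing c ℓ) where
  open CommutativeRing R
  open IntegerSolver R

  IsRoot : ℕ → Carrier → Set ℓ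
  IsRoot n x = x * (x * (x * x)) + (fromℤ (+ n) * x + 1#) ≈ fromℤ (+ n) * (x * (x * x)) + fromℤ (+ 6) * (x * x)

module Evaluation {c ℓ : Level} (R : CommutativeRing c ℓ) (ι : ℚ → CommutativeRing.Carrier R)
  (hom : IsHom ℚ-ring R ι) (n : ℕ) (x : CommutativeRing.Carrier R) (root : IsRoot R n x) where
  open CommutativeRing R
  open IntegerSolver R
  open IsRingHomomorphism hom
  open import Relation.Binary.Reasoning.Setoid setoid

  ι-ratℕ : ∀ n → ι (ratℕ n) ≈ fromℤ (+ n)
  ι-ratℕ n = trans (⟦⟧-cong (ratℕ≡fromℤ n)) (hom-fromℤ+ ℚ-ring R ι hom n)

  cubic : Carrier → Carrier → Carrier → Carrier → Carrier
  cubic a0 a1 a2 a3 = a0 + x * (a1 + x * (a2 + x * a3))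

  cubic-cong : ∀ {a0 a1 a2 a3 b0 b1 b2 b3} → a0 ≈ b0 → a1 ≈ b1 → a2 ≈ b2 → a3 ≈ b3 →
    cubic a0 a1 a2 a3 ≈ cubic b0 b1 b2 b3
  cubic-cong p q r s = +-cong p (*-congˡ (+-cong q (*-congˡ (+-cong r (*-congˡ s)))))

  ev : K n → Carrier
  ev ⟨ a0 , a1 , a2 , a3 ⟩ = cubic (ι a0) (ι a1) (ι a2) (ι a3)

  -- The root equation replaces the x⁴ term; the coordinates on the right repeat those of `step`, so
  -- that `ev-reduce` is three applications, one for each of the degrees 6, 5 and 4.
  ev-step : ∀ top a3 a2 a1 a0 →
    ι a0 + x * cubic (ι a1) (ι a2) (ι a3) (ι top) ≈
    ev ⟨ a0 ℚ.- top , a1 ℚ.- ratℕ n ℚ.* top , a2 ℚ.+ ratℕ 6 ℚ.* top , a3 ℚ.+ ratℕ n ℚ.* top ⟩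
  ev-step top a3 a2 a1 a0 = begin
    A0 + x * cubic A1 A2 A3 T
      ≈⟨ solve 7 (λ N x A0 A1 A2 A3 T →
          A0 :+ x :* (A1 :+ x :* (A2 :+ x :* (A3 :+ x :* T)))
          := (A0 :+ x :* (A1 :+ x :* (A2 :+ x :* A3))) :- T :* (N :* x :+ con (+ 1))
             :+ T :* (x :* (x :* (x :* x)) :+ (N :* x :+ con (+ 1)))) refl N x A0 A1 A2 A3 T ⟩
    cubic A0 A1 A2 A3 - T * (N * x + 1#) + T * (x * (x * (x * x)) + (N * x + 1#))
      ≈⟨ +-congˡ (*-congˡ root) ⟩
    cubic A0 A1 A2 A3 - T * (N * x + 1#) + T * (N * (x * (x * x)) + fromℤ (+ 6) * (x * x))
      ≈⟨ solve 7 (λ N x A0 A1 A2 A3 T →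
          (A0 :+ x :* (A1 :+ x :* (A2 :+ x :* A3))) :- T :* (N :* x :+ con (+ 1))
             :+ T :* (N :* (x :* (x :* x)) :+ con (+ 6) :* (x :* x))
          := (A0 :+ :- T) :+ x :* ((A1 :+ :- (N :* T)) :+ x :* ((A2 :+ con (+ 6) :* T) :+ x :* (A3 :+ N :* T)))) refl N x A0 A1 A2 A3 T ⟩
    cubic (A0 + - T) (A1 + - (N * T)) (A2 + fromℤ (+ 6) * T) (A3 + N * T)
      ≈⟨ cubic-cong
          (trans (+-homo _ _) (+-congˡ (-‿homo _)))
          (trans (+-homo _ _) (+-congˡ (trans (-‿homo _) (-‿cong (ι-nat* n top)))))
          (trans (+-homo _ _) (+-congˡ (ι-nat* 6 top)))
          (trans (+-homo _ _) (+-congˡ (ι-nat* n top))) ⟨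
    ev ⟨ a0 ℚ.- top , a1 ℚ.- ratℕ n ℚ.* top , a2 ℚ.+ ratℕ 6 ℚ.* top , a3 ℚ.+ ratℕ n ℚ.* top ⟩ ∎
    where
    N = fromℤ (+ n)
    T = ι top
    A0 = ι a0
    A1 = ι a1
    A2 = ι a2
    A3 = ι a3
    ι-nat* : ∀ j t → ι (ratℕ j ℚ.* t) ≈ fromℤ (+ j) * ι t
    ι-nat* j t = trans (*-homo _ _) (*-congʳ (ι-ratℕ j))

  ev-reduce : ∀ e0 e1 e2 e3 e4 e5 e6 →
    ι e0 + x * (ι e1 + x * (ι e2 + x * cubic (ι e3) (ι e4) (ι e5) (ι e6))) ≈
    ev (reduce n e0 e1 e2 e3 e4 e5 e6)
  ev-reduce e0 e1 e2 e3 e4 e5 e6 =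
    trans (+-congˡ (*-congˡ (+-congˡ (*-congˡ (ev-step e6 e5 e4 e3 e2)))))
      (trans (+-congˡ (*-congˡ (ev-step _ _ _ _ e1))) (ev-step _ _ _ _ e0))

  ev-+ : ∀ a b → ev (a +K b) ≈ ev a + ev b
  ev-+ ⟨ a0 , a1 , a2 , a3 ⟩ ⟨ b0 , b1 , b2 , b3 ⟩ =
    trans (cubic-cong (+-homo _ _) (+-homo _ _) (+-homo _ _) (+-homo _ _))
      (solve 9 (λ x a0 a1 a2 a3 b0 b1 b2 b3 →
        (a0 :+ b0) :+ x :* ((a1 :+ b1) :+ x :* ((a2 :+ b2) :+ x :* (a3 :+ b3)))
        := (a0 :+ x :* (a1 :+ x :* (a2 :+ x :* a3))) :+ (b0 :+ x :* (b1 :+ x :* (b2 :+ x :* b3))))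
        refl x (ι a0) (ι a1) (ι a2) (ι a3) (ι b0) (ι b1) (ι b2) (ι b3))

  ev-* : ∀ a b → ev (a *K b) ≈ ev a * ev b
  ev-* ⟨ a0 , a1 , a2 , a3 ⟩ ⟨ b0 , b1 , b2 , b3 ⟩ =
    trans (sym (ev-reduce _ _ _ _ _ _ _))
      (trans
        (+-cong m0 (*-congˡ (+-cong m1 (*-congˡ (+-cong m2 (*-congˡ (cubic-cong m3 m4 m5 m6)))))))
        (solve 9 (λ x a0 a1 a2 a3 b0 b1 b2 b3 →
          a0 :* b0 :+ x :* ((a0 :* b1 :+ a1 :* b0) :+ x :* ((a0 :* b2 :+ a1 :* b1 :+ a2 :* b0)
            :+ x :* ((a0 :* b3 :+ a1 :* b2 :+ a2 :* b1 :+ a3 :* b0)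
            :+ x :* ((a1 :* b3 :+ a2 :* b2 :+ a3 :* b1)
            :+ x :* ((a2 :* b3 :+ a3 :* b2) :+ x :* (a3 :* b3))))))
          := (a0 :+ x :* (a1 :+ x :* (a2 :+ x :* a3))) :* (b0 :+ x :* (b1 :+ x :* (b2 :+ x :* b3))))
          refl x (ι a0) (ι a1) (ι a2) (ι a3) (ι b0) (ι b1) (ι b2) (ι b3)))
    where
    infixl 6 _⊕_
    _⊕_ : ∀ {p q r s} → ι p ≈ r → ι q ≈ s → ι (p ℚ.+ q) ≈ r + s
    p ⊕ q = trans (+-homo _ _) (+-cong p q)
    m0 = *-homo a0 b0
    m1 = *-homo a0 b1 ⊕ *-homo a1 b0
    m2 = *-homo a0 b2 ⊕ *-homo a1 b1 ⊕ *-homo a2 b0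
    m3 = *-homo a0 b3 ⊕ *-homo a1 b2 ⊕ *-homo a2 b1 ⊕ *-homo a3 b0
    m4 = *-homo a1 b3 ⊕ *-homo a2 b2 ⊕ *-homo a3 b1
    m5 = *-homo a2 b3 ⊕ *-homo a3 b2
    m6 = *-homo a3 b3

  ev-1 : ev 1K ≈ 1#
  ev-1 = trans (cubic-cong 1#-homo 0#-homo 0#-homo 0#-homo)
    (solve 1 (λ x → con (+ 1) :+ x :* (con (+ 0) :+ x :* (con (+ 0) :+ x :* con (+ 0))) := con (+ 1)) refl x)

-- reduce and _*K_ with n generalised to a rational variable: with (+ n) / 1 in its place the products
-- would unfold to numerators and denominators during conversion checking.
reduceℚ : ∀ {m} (N e0 e1 e2 e3 e4 e5 e6 : ℚ) → K m
reduceℚ N e0 e1 e2 e3 e4 e5 e6 =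
  let f5 = e5 ℚ.+ N ℚ.* e6 ; f4 = e4 ℚ.+ ratℕ 6 ℚ.* e6 ; f3 = e3 ℚ.- N ℚ.* e6 ; f2 = e2 ℚ.- e6
      g4 = f4 ℚ.+ N ℚ.* f5 ; g3 = f3 ℚ.+ ratℕ 6 ℚ.* f5 ; g2 = f2 ℚ.- N ℚ.* f5 ; g1 = e1 ℚ.- f5
  in ⟨ e0 ℚ.- g4 , g1 ℚ.- N ℚ.* g4 , g2 ℚ.+ ratℕ 6 ℚ.* g4 , g3 ℚ.+ N ℚ.* g4 ⟩

mulℚ : ∀ {m} → ℚ → K m → K m → K m
mulℚ N ⟨ a0 , a1 , a2 , a3 ⟩ ⟨ b0 , b1 , b2 , b3 ⟩ =
  reduceℚ N (a0 ℚ.* b0)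
    (a0 ℚ.* b1 ℚ.+ a1 ℚ.* b0)
    (a0 ℚ.* b2 ℚ.+ a1 ℚ.* b1 ℚ.+ a2 ℚ.* b0)
    (a0 ℚ.* b3 ℚ.+ a1 ℚ.* b2 ℚ.+ a2 ℚ.* b1 ℚ.+ a3 ℚ.* b0)
    (a1 ℚ.* b3 ℚ.+ a2 ℚ.* b2 ℚ.+ a3 ℚ.* b1)
    (a2 ℚ.* b3 ℚ.+ a3 ℚ.* b2)
    (a3 ℚ.* b3)

reduceℚ-quartic : ∀ {m} N e0 e1 e2 e3 e4 → reduceℚ {m} N e0 e1 e2 e3 e4 0ℚ 0ℚ ≡
  ⟨ e0 ℚ.- e4 , e1 ℚ.- N ℚ.* e4 , e2 ℚ.+ ratℕ 6 ℚ.* e4 , e3 ℚ.+ N ℚ.* e4 ⟩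
reduceℚ-quartic N e0 e1 e2 e3 e4
  rewrite ℚ.*-zeroʳ N | ℚ.*-zeroʳ N | ℚ.+-identityʳ e4 | ℚ.+-identityʳ e4 | ℚ.+-identityʳ e3 | ℚ.+-identityʳ e3
        | ℚ.+-identityʳ e2 | ℚ.+-identityʳ e2 | ℚ.+-identityʳ e1 = ≡.refl

generator : ∀ {m} → K m
generator = ⟨ 0ℚ , 1ℚ , 0ℚ , 0ℚ ⟩

scalar : ∀ {m} → ℚ → K m
scalar c = ⟨ c , 0ℚ , 0ℚ , 0ℚ ⟩

generator-mulℚ : ∀ {m} N a0 a1 a2 a3 → mulℚ {m} N generator ⟨ a0 , a1 , a2 , a3 ⟩ ≡
  ⟨ 0ℚ ℚ.- a3 , a0 ℚ.- N ℚ.* a3 , a1 ℚ.+ ratℕ 6 ℚ.* a3 , a2 ℚ.+ N ℚ.* a3 ⟩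
generator-mulℚ N a0 a1 a2 a3
  rewrite ℚ.*-zeroˡ a0 | ℚ.*-zeroˡ a1 | ℚ.*-zeroˡ a2 | ℚ.*-zeroˡ a3
        | ℚ.*-identityˡ a0 | ℚ.*-identityˡ a1 | ℚ.*-identityˡ a2 | ℚ.*-identityˡ a3
        | ℚ.+-identityˡ a0 | ℚ.+-identityˡ a1 | ℚ.+-identityˡ a2
        | ℚ.+-identityʳ a1 | ℚ.+-identityʳ a2 | ℚ.+-identityʳ a2 | ℚ.+-identityʳ a3 | ℚ.+-identityʳ a3
  = reduceℚ-quartic N 0ℚ a0 a1 a2 a3

scalar-mulℚ : ∀ {m} N c a0 a1 a2 a3 → mulℚ {m} N (scalar c) ⟨ a0 , a1 , a2 , a3 ⟩ ≡
  ⟨ c ℚ.* a0 , c ℚ.* a1 , c ℚ.* a2 , c ℚ.* a3 ⟩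
scalar-mulℚ N c a0 a1 a2 a3
  rewrite ℚ.*-zeroˡ a0 | ℚ.*-zeroˡ a1 | ℚ.*-zeroˡ a2 | ℚ.*-zeroˡ a3
        | ℚ.+-identityʳ (c ℚ.* a1) | ℚ.+-identityʳ (c ℚ.* a2) | ℚ.+-identityʳ (c ℚ.* a2)
        | ℚ.+-identityʳ (c ℚ.* a3) | ℚ.+-identityʳ (c ℚ.* a3) | ℚ.+-identityʳ (c ℚ.* a3)
  = ≡.trans (reduceℚ-quartic N (c ℚ.* a0) (c ℚ.* a1) (c ℚ.* a2) (c ℚ.* a3) 0ℚ) lemma
  where
  lemma : ⟨ c ℚ.* a0 ℚ.- 0ℚ , c ℚ.* a1 ℚ.- N ℚ.* 0ℚ , c ℚ.* a2 ℚ.+ ratℕ 6 ℚ.* 0ℚ , c ℚ.* a3 ℚ.+ N ℚ.* 0ℚ ⟩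
    ≡ ⟨ c ℚ.* a0 , c ℚ.* a1 , c ℚ.* a2 , c ℚ.* a3 ⟩
  lemma rewrite ℚ.*-zeroʳ N | ℚ.+-identityʳ (c ℚ.* a0) | ℚ.+-identityʳ (c ℚ.* a1)
              | ℚ.+-identityʳ (c ℚ.* a2) | ℚ.+-identityʳ (c ℚ.* a3) = ≡.refl

generator²-mulℚ : ∀ {m} N → mulℚ {m} N generator generator ≡ ⟨ 0ℚ , 0ℚ , 1ℚ , 0ℚ ⟩
generator²-mulℚ N = ≡.trans (generator-mulℚ N 0ℚ 1ℚ 0ℚ 0ℚ) (≡.cong (λ z → ⟨ 0ℚ , 0ℚ ℚ.- z , 1ℚ , 0ℚ ℚ.+ z ⟩) (ℚ.*-zeroʳ N))

generator³-mulℚ : ∀ {m} N → mulℚ {m} N generator ⟨ 0ℚ , 0ℚ , 1ℚ , 0ℚ ⟩ ≡ ⟨ 0ℚ , 0ℚ , 0ℚ , 1ℚ ⟩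
generator³-mulℚ N = ≡.trans (generator-mulℚ N 0ℚ 0ℚ 1ℚ 0ℚ) (≡.cong (λ z → ⟨ 0ℚ , 0ℚ ℚ.- z , 0ℚ , 1ℚ ℚ.+ z ⟩) (ℚ.*-zeroʳ N))

generator-root-mulℚ : ∀ {m} N → let _*_ = mulℚ {m} N ; ρ = generator in
  (ρ * (ρ * (ρ * ρ))) +K ((scalar N * ρ) +K 1K) ≡ (scalar N * (ρ * (ρ * ρ))) +K (scalar (ratℕ 6) * (ρ * ρ))
generator-root-mulℚ {m} N =
  ≡.trans (≡.cong₂ _+K_ ρ⁴ (≡.cong (_+K 1K) (scalar-mulℚ N N 0ℚ 1ℚ 0ℚ 0ℚ)))
    (≡.trans (components N)
      (≡.sym (≡.cong₂ _+K_ (≡.trans (≡.cong (scalar N *_) ρ³) (scalar-mulℚ N N 0ℚ 0ℚ 0ℚ 1ℚ))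
        (≡.trans (≡.cong (scalar (ratℕ 6) *_) (generator²-mulℚ N)) (scalar-mulℚ N (ratℕ 6) 0ℚ 0ℚ 1ℚ 0ℚ)))))
  where
  _*_ : K m → K m → K m
  _*_ = mulℚ N
  ρ : K m
  ρ = generator
  ρ³ : ρ * (ρ * ρ) ≡ ⟨ 0ℚ , 0ℚ , 0ℚ , 1ℚ ⟩
  ρ³ = ≡.trans (≡.cong (ρ *_) (generator²-mulℚ N)) (generator³-mulℚ N)
  ρ⁴ : ρ * (ρ * (ρ * ρ)) ≡ ⟨ 0ℚ ℚ.- 1ℚ , 0ℚ ℚ.- N ℚ.* 1ℚ , 0ℚ ℚ.+ ratℕ 6 ℚ.* 1ℚ , 0ℚ ℚ.+ N ℚ.* 1ℚ ⟩
  ρ⁴ = ≡.trans (≡.cong (ρ *_) ρ³) (generator-mulℚ N 0ℚ 0ℚ 0ℚ 1ℚ)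
  components : ∀ N →
    ⟨ 0ℚ ℚ.- 1ℚ , 0ℚ ℚ.- N ℚ.* 1ℚ , 0ℚ ℚ.+ ratℕ 6 ℚ.* 1ℚ , 0ℚ ℚ.+ N ℚ.* 1ℚ ⟩
      +K (⟨ N ℚ.* 0ℚ , N ℚ.* 1ℚ , N ℚ.* 0ℚ , N ℚ.* 0ℚ ⟩ +K 1K)
    ≡ ⟨ N ℚ.* 0ℚ , N ℚ.* 0ℚ , N ℚ.* 0ℚ , N ℚ.* 1ℚ ⟩
      +K ⟨ ratℕ 6 ℚ.* 0ℚ , ratℕ 6 ℚ.* 0ℚ , ratℕ 6 ℚ.* 1ℚ , ratℕ 6 ℚ.* 0ℚ ⟩
  components N
    rewrite ℚ.*-zeroʳ N | ℚ.*-identityʳ N | ℚ.+-identityˡ (ℚ.- N) | ℚ.+-identityʳ N | ℚ.+-identityˡ N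
          | ℚ.+-inverseˡ N | ℚ.+-identityʳ N = ≡.refl

module _ {c ℓ : Level} (R : CommutativeRing c ℓ) (m : ℕ) (χ : K m → CommutativeRing.Carrier R) where
  open CommutativeRing R
  open IntegerSolver R
  open import Relation.Binary.Reasoning.Setoid setoid
  open import Algebra.Properties.Semiring.Mult.TCOptimised semiring using (1+×)
  open import Algebra.Properties.Ring ring using (x+x≈x⇒x≈0)

  -- Additivity and `χ 1K ≈ 1#` fix `χ` on the integers, and the coefficients of f_m are integers;
  -- the equation satisfied by `generator` can therefore be pushed through `χ`.
  generator-root : (∀ {a b} → a ≡ b → χ a ≈ χ b) → (∀ a b → χ (a +K b) ≈ χ a + χ b) →
    (∀ a b → χ (a *K b) ≈ χ a * χ b) → χ 1K ≈ 1# → IsRoot R m (χ generator)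
  generator-root χ-cong χ-+ χ-* χ-1 = begin
    X * (X * (X * X)) + (fromℤ (+ m) * X + 1#)
      ≈⟨ +-cong (χ⁴ ρ ρ ρ ρ) (+-cong (χ-scalar* m ρ) χ-1) ⟨
    χ (ρ *K (ρ *K (ρ *K ρ))) + (χ (scalar (ratℕ m) *K ρ) + χ 1K)
      ≈⟨ trans (χ-+ _ _) (+-congˡ (χ-+ _ _)) ⟨
    χ ((ρ *K (ρ *K (ρ *K ρ))) +K ((scalar (ratℕ m) *K ρ) +K 1K))
      ≈⟨ χ-cong (generator-root-mulℚ (ratℕ m)) ⟩
    χ ((scalar (ratℕ m) *K (ρ *K (ρ *K ρ))) +K (scalar (ratℕ 6) *K (ρ *K ρ)))
      ≈⟨ χ-+ _ _ ⟩
    χ (scalar (ratℕ m) *K (ρ *K (ρ *K ρ))) + χ (scalar (ratℕ 6) *K (ρ *K ρ))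
      ≈⟨ +-cong (trans (χ-scalar* m _) (*-congˡ (trans (χ-* _ _) (*-congˡ (χ-* _ _)))))
          (trans (χ-scalar* 6 _) (*-congˡ (χ-* _ _))) ⟩
    fromℤ (+ m) * (X * (X * X)) + fromℤ (+ 6) * (X * X) ∎
    where
    ρ = generator
    X = χ generator
    χ-scalar : ∀ j → χ (scalar (ratℕ j)) ≈ fromℤ (+ j)
    χ-scalar zero = x+x≈x⇒x≈0 _ (sym (χ-+ (scalar 0ℚ) (scalar 0ℚ)))
    χ-scalar (suc j) = begin
      χ (scalar (ratℕ (suc j)))       ≈⟨ χ-cong (≡.cong scalar (ratℕ-+ 1 j)) ⟩
      χ (1K +K scalar (ratℕ j))       ≈⟨ χ-+ _ _ ⟩
      χ 1K + χ (scalar (ratℕ j))      ≈⟨ +-cong χ-1 (χ-scalar j) ⟩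
      1# + fromℤ (+ j)                ≈⟨ 1+× j 1# ⟨
      fromℤ (+ suc j)                 ∎
    χ-scalar* : ∀ j a → χ (scalar (ratℕ j) *K a) ≈ fromℤ (+ j) * χ a
    χ-scalar* j a = trans (χ-* _ _) (*-congʳ (χ-scalar j))
    χ⁴ : ∀ a b c d → χ (a *K (b *K (c *K d))) ≈ χ a * (χ b * (χ c * χ d))
    χ⁴ a b c d = trans (χ-* _ _) (*-congˡ (trans (χ-* _ _) (*-congˡ (χ-* _ _))))

module _ {c ℓ : Level} (R : CommutativeRing c ℓ) where
  private module R = CommutativeRing R

  -- Composing the isomorphism with evaluation at the root x of f_n gives a ring map from K_m; the
  -- image of the generator is the wanted root of f_m.
  iso-root : ∀ ι → IsHom ℚ-ring R ι → ∀ {n x} → IsRoot R n x → ∀ {m} → FieldIso m n → ∃ λ ξ → IsRoot R m ξ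
  iso-root ι hom {n} {x} root {m} iso = ev (φ generator) , generator-root R m (λ a → ev (φ a))
      (λ { ≡.refl → R.refl })
      (λ a b → R.trans (R.reflexive (≡.cong ev (φ-+ a b))) (ev-+ (φ a) (φ b)))
      (λ a b → R.trans (R.reflexive (≡.cong ev (φ-* a b))) (ev-* (φ a) (φ b)))
      (R.trans (R.reflexive (≡.cong ev φ-1)) ev-1)
    where
    open FieldIso iso
    open Evaluation R ι hom n x root

-- Polynomial identities around a root of f_n.

module RingLemmas {c ℓ : Level} (R : CommutativeRing c ℓ) where
  open CommutativeRing R
  open IntegerSolver R
  open import Relation.Binary.Reasoning.Setoid setoid

  -- An ideal-membership certificate: once a cofactor `c` of p - q is exhibited, what remains is a
  -- polynomial identity for the solver. The unexplained polynomials multiplying differences in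
  -- later `solve` calls are such cofactors.
  modulo₁ : ∀ {a b c p q} → p ≈ q → a ≈ b + c * (p - q) → a ≈ b
  modulo₁ {a} {b} {c} {p} {q} p≈q a≈ = begin
    a                ≈⟨ a≈ ⟩
    b + c * (p - q)  ≈⟨ +-congˡ (*-congˡ (+-congʳ p≈q)) ⟩
    b + c * (q - q)  ≈⟨ solve 3 (λ b c q → b :+ c :* (q :- q) := b) refl b c q ⟩
    b                ∎

  modulo₂ : ∀ {a b c p q c′ p′ q′} → p ≈ q → p′ ≈ q′ → a ≈ b + c * (p - q) + c′ * (p′ - q′) → a ≈ b
  modulo₂ p≈q p′≈q′ a≈ = modulo₁ p≈q (modulo₁ p′≈q′ a≈)

  square-of-product : ∀ x y → (x * y) * (x * y) ≈ x * (x * (y * y))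
  square-of-product x y = solve 2 (λ x y → (x :* y) :* (x :* y) := x :* (x :* (y :* y))) refl x y

  IsHalf : Carrier → Set ℓ
  IsHalf h = h + h ≈ 1#

  -- Says that δ is no square in the fraction field, without mentioning division.
  IsNonsquare : Carrier → Set _
  IsNonsquare δ = ∀ {a b} → a * a ≈ δ * (b * b) → b ≈ 0#

  record IsLucasPair (T : Carrier) (U V : ℕ → Carrier) : Set ℓ where
    field
      U₀ : U 0 ≈ 0#
      U₁ : U 1 ≈ 1#
      V₀ : V 0 ≈ 1# + 1#
      V₁ : V 1 ≈ T
      U-rec : ∀ j → U (suc (suc j)) ≈ T * U (suc j) + U j
      V-rec : ∀ j → V (suc (suc j)) ≈ T * V (suc j) + V j

  IsIntegral : Set _
  IsIntegral = ∀ {x y} → x * y ≈ 0# → x ≈ 0# ⊎ y ≈ 0#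

  module Half (h : Carrier) (h+h≈1 : IsHalf h) where

    double-cancel : ∀ {x} → x + x ≈ 0# → x ≈ 0#
    double-cancel {x} x+x≈0 = modulo₂ h+h≈1 x+x≈0
      (solve 2 (λ h x → x := con (+ 0) :+ (:- x) :* (h :+ h :- con (+ 1)) :+ h :* (x :+ x :- con (+ 0))) refl h x)

    half-sum : ∀ m x → x ≈ h * (m + (x + x - m))
    half-sum m x = modulo₁ h+h≈1
      (solve 3 (λ h m x → x := h :* (m :+ (x :+ x :- m)) :+ (:- x) :* (h :+ h :- con (+ 1))) refl h m x)

    quadratic-root : ∀ {w θ} → θ * θ ≈ w * w + fromℤ (+ 4) →
      let x = h * (w + θ) in x * x ≈ w * x + 1#
    quadratic-root {w} {θ} θθ≈ = modulo₂ θθ≈ h+h≈1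
      (solve 3 (λ h w θ → let x = h :* (w :+ θ) in
        x :* x := w :* x :+ con (+ 1) :+ (h :* h) :* (θ :* θ :- (w :* w :+ con (+ 4)))
          :+ (h :* (w :* w) :+ h :* (w :* θ) :+ con (+ 2) :* h :+ con (+ 1)) :* (h :+ h :- con (+ 1)))
        refl h w θ)

  -- Since w(n - w) = -4, f_n is the product of x² - wx - 1 and x² - (n - w)x - 1, and x is a root
  -- of the first factor.
  quartic-root : ∀ n {w x} → w * w ≈ fromℤ (+ n) * w + fromℤ (+ 4) → x * x ≈ w * x + 1# → IsRoot R n x
  quartic-root n {w} {x} ww≈ xx≈ = modulo₂ ww≈ xx≈
    (solve 3 (λ N w x → x :* (x :* (x :* x)) :+ (N :* x :+ con (+ 1))
      := N :* (x :* (x :* x)) :+ con (+ 6) :* (x :* x)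
        :+ (x :* x) :* (w :* w :- (N :* w :+ con (+ 4)))
        :+ (x :* x :+ (w :- N) :* x :- con (+ 1)) :* (x :* x :- (w :* x :+ con (+ 1))))
      refl (fromℤ (+ n)) w x)

  module QuarticRoot (m : ℕ) {ξ : Carrier} (root : IsRoot R m ξ) where
    M = fromℤ (+ m)

    -- ξ - 1/ξ, since ξ is invertible by its quartic equation.
    W : Carrier
    W = ξ * (ξ * ξ) - M * (ξ * ξ) - fromℤ (+ 5) * ξ + M

    W-quadratic : W * W ≈ M * W + fromℤ (+ 4)
    W-quadratic = modulo₁ root
      (solve 2 (λ M ξ → let W = ξ :* (ξ :* ξ) :- M :* (ξ :* ξ) :- con (+ 5) :* ξ :+ M in
        W :* W := M :* W :+ con (+ 4) :+ (ξ :* ξ :- M :* ξ :- con (+ 4))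
          :* (ξ :* (ξ :* (ξ :* ξ)) :+ (M :* ξ :+ con (+ 1)) :- (M :* (ξ :* (ξ :* ξ)) :+ con (+ 6) :* (ξ :* ξ))))
        refl M ξ)

    discriminant : (W + W - M) * (W + W - M) ≈ M * M + fromℤ (+ 16)
    discriminant = modulo₁ W-quadratic
      (solve 2 (λ M W → (W :+ W :- M) :* (W :+ W :- M)
        := M :* M :+ con (+ 16) :+ con (+ 4) :* (W :* W :- (M :* W :+ con (+ 4)))) refl M W)

    -- ξ is a root of x² - Wx - 1, and 2ξ - W is a square root of the discriminant of that
    -- polynomial.
    square : (ξ + ξ - W) * (ξ + ξ - W) ≈ W * W + fromℤ (+ 4)
    square = modulo₁ root
      (solve 2 (λ M ξ → let W = ξ :* (ξ :* ξ) :- M :* (ξ :* ξ) :- con (+ 5) :* ξ :+ M in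
        (ξ :+ ξ :- W) :* (ξ :+ ξ :- W) := W :* W :+ con (+ 4) :+ con -[1+ 3 ]
          :* (ξ :* (ξ :* (ξ :* ξ)) :+ (M :* ξ :+ con (+ 1)) :- (M :* (ξ :* (ξ :* ξ)) :+ con (+ 6) :* (ξ :* ξ))))
        refl M ξ)

  quadratic-decomposition : ∀ m {ξ} → IsRoot R m ξ → ∃ λ W →
    (W + W - fromℤ (+ m)) * (W + W - fromℤ (+ m)) ≈ fromℤ (+ m) * fromℤ (+ m) + fromℤ (+ 16) ×
    (ξ + ξ - W) * (ξ + ξ - W) ≈ W * W + fromℤ (+ 4)
  quadratic-decomposition m root = QuarticRoot.W m root , QuarticRoot.discriminant m root , QuarticRoot.square m root

-- Square roots and norms in a quadratic extension.

SquareRootDichotomy : ∀ {a b c d} (R : CommutativeRing a b) (S : CommutativeRing c d) →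
  (CommutativeRing.Carrier R → CommutativeRing.Carrier S) → CommutativeRing.Carrier R → Set _
SquareRootDichotomy R S f δ = ∀ {x r} → x S.* x S.≈ f r →
  (∃ λ a → x S.≈ f a × a R.* a R.≈ r) ⊎ (∃ λ b → δ R.* (b R.* b) R.≈ r)
  where
  module R = CommutativeRing R
  module S = CommutativeRing S

module QuadraticLemmas {c ℓ : Level} (R : CommutativeRing c ℓ) (δ : CommutativeRing.Carrier R) where
  open CommutativeRing R
  open IntegerSolver R
  open RingLemmas R
  private
    R² = Quadratic.commutativeRing R δ
    module R² = CommutativeRing R²

  embed : Carrier → R².Carrier
  embed a = a , 0#

  embed-hom : IsHom R R² embed
  embed-hom = record
    { isSemiringHomomorphism = record
      { isNearSemiringHomomorphism = record
        { +-isMonoidHomomorphism = record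
          { isMagmaHomomorphism = record
            { isRelHomomorphism = record { cong = λ p → p , refl }
            ; homo = λ _ _ → refl , sym (+-identityˡ 0#) }
          ; ε-homo = refl , refl }
        ; *-homo = λ a b →
            solve 3 (λ δ a b → a :* b := a :* b :+ δ :* (con (+ 0) :* con (+ 0))) refl δ a b ,
            solve 2 (λ a b → con (+ 0) := a :* con (+ 0) :+ con (+ 0) :* b) refl a b }
      ; 1#-homo = refl , refl }
    ; -‿homo = λ _ → refl , solve 0 (con (+ 0) := :- con (+ 0)) refl }

  √δ*√δ : (0# , 1#) R².* (0# , 1#) R².≈ embed δ
  √δ*√δ = solve 1 (λ δ → con (+ 0) :* con (+ 0) :+ δ :* (con (+ 1) :* con (+ 1)) := δ) refl δ ,
          solve 0 (con (+ 0) :* con (+ 1) :+ con (+ 1) :* con (+ 0) := con (+ 0)) refl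

  norm : R².Carrier → Carrier
  norm (a , b) = a * a - δ * (b * b)

  norm-cong : ∀ {x y} → x R².≈ y → norm x ≈ norm y
  norm-cong (p , q) = +-cong (*-cong p p) (-‿cong (*-congˡ (*-cong q q)))

  norm-* : ∀ x y → norm (x R².* y) ≈ norm x * norm y
  norm-* (a , b) (a′ , b′) = solve 5 (λ δ a b a′ b′ →
    (a :* a′ :+ δ :* (b :* b′)) :* (a :* a′ :+ δ :* (b :* b′)) :- δ :* ((a :* b′ :+ b :* a′) :* (a :* b′ :+ b :* a′))
    := (a :* a :- δ :* (b :* b)) :* (a′ :* a′ :- δ :* (b′ :* b′))) refl δ a b a′ b′

  module Domain (integral : IsIntegral) (nonsquare : IsNonsquare δ) where

    -- Norm zero means a² = δb²; then b vanishes because δ is a nonsquare, and a by integrality.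
    norm≈0 : ∀ {x} → norm x ≈ 0# → x R².≈ R².0#
    norm≈0 {a , b} p = a≈0 , b≈0
      where
      aa≈ : a * a ≈ δ * (b * b)
      aa≈ = modulo₁ p (solve 3 (λ δ a b → a :* a := δ :* (b :* b)
        :+ con (+ 1) :* (a :* a :- δ :* (b :* b) :- con (+ 0))) refl δ a b)
      b≈0 = nonsquare aa≈
      a≈0 : a ≈ 0#
      a≈0 with integral (trans aa≈ (trans (*-congˡ (trans (*-congˡ b≈0) (zeroʳ b))) (zeroʳ δ)))
      ... | inj₁ q = q
      ... | inj₂ q = q

    integral² : RingLemmas.IsIntegral R²
    integral² {x} {y} p with integral (trans (sym (norm-* x y)) (trans (norm-cong p)
      (solve 1 (λ δ → con (+ 0) :* con (+ 0) :- δ :* (con (+ 0) :* con (+ 0)) := con (+ 0)) refl δ)))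
    ... | inj₁ q = inj₁ (norm≈0 q)
    ... | inj₂ q = inj₂ (norm≈0 q)

  module SquareRoot (integral : IsIntegral) (h : Carrier) (h+h≈1 : IsHalf h) where
    open Half h h+h≈1

    -- The √δ-coordinate of (a + b√δ)² is 2ab; when it vanishes, so does a or b, since 2 is
    -- invertible and the base is integral.
    square-in-base : ∀ {a b r} → (a , b) R².* (a , b) R².≈ embed r →
      (b ≈ 0# × a * a ≈ r) ⊎ (a ≈ 0# × δ * (b * b) ≈ r)
    square-in-base {a} {b} {r} (p , q) with integral (double-cancel (trans (+-congˡ (*-comm a b)) q))
    ... | inj₁ a≈0 = inj₂ (a≈0 , trans
            (sym (trans (+-congʳ (trans (*-congʳ a≈0) (zeroˡ a))) (+-identityˡ _))) p)
    ... | inj₂ b≈0 = inj₁ (b≈0 , trans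
            (sym (trans (+-congˡ (trans (*-congˡ (trans (*-congˡ b≈0) (zeroʳ b))) (zeroʳ δ))) (+-identityʳ _))) p)

    square-root-cases : SquareRootDichotomy R R² embed δ
    square-root-cases {a , b} {r} p with square-in-base {a} {b} {r} p
    ... | inj₁ (b≈0 , aa≈r) = inj₁ (a , (refl , b≈0) , aa≈r)
    ... | inj₂ (_ , δbb≈r) = inj₂ (b , δbb≈r)

-- Powers of a unit of norm -1.

module Powers {c ℓ : Level} (R : CommutativeRing c ℓ) where
  open CommutativeRing R
  open IntegerSolver R
  open RingLemmas R
  open import Algebra.Properties.Semiring.Exp semiring using (_^_)

  -- Two initial values and the recurrence determine the sequence. The power is doubled because 2ε^j
  -- is the element with coordinates v_j and u_j Y/2.
  recurrence-power : ∀ {T ε} (S : ℕ → Carrier) → ε * ε ≈ T * ε + 1# → S 0 ≈ 1# + 1# → S 1 ≈ ε + ε →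
    (∀ j → S (suc (suc j)) ≈ T * S (suc j) + S j) → ∀ j → S j ≈ ε ^ j + ε ^ j
  recurrence-power S εε≈ S₀ S₁ rec zero = S₀
  recurrence-power {T} {ε} S εε≈ S₀ S₁ rec (suc zero) = trans S₁ (sym (+-cong (*-identityʳ ε) (*-identityʳ ε)))
  recurrence-power {T} {ε} S εε≈ S₀ S₁ rec (suc (suc j)) = trans (rec j)
    (trans (+-cong (*-congˡ (recurrence-power S εε≈ S₀ S₁ rec (suc j))) (recurrence-power S εε≈ S₀ S₁ rec j))
      (modulo₁ εε≈ (solve 3 (λ T ε p → T :* (ε :* p :+ ε :* p) :+ (p :+ p)
        := ε :* (ε :* p) :+ ε :* (ε :* p) :+ (:- (p :+ p)) :* (ε :* ε :- (T :* ε :+ con (+ 1)))) refl T ε (ε ^ j))))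

  power-double : ∀ x j → x ^ (j ℕ.+ j) ≈ x ^ j * x ^ j
  power-double x zero = sym (*-identityˡ 1#)
  power-double x (suc j) rewrite ℕ.+-suc j j = trans (*-congˡ (*-congˡ (power-double x j)))
    (solve 2 (λ x p → x :* (x :* (p :* p)) := x :* p :* (x :* p)) refl x (x ^ j))

  -- Each factor xy = -1 contributes a sign, so x^j y^j is ±1; squaring removes the sign and with it
  -- a case split on the parity of j.
  power-inverse : ∀ {x y} → x * y ≈ - 1# → ∀ j → (x ^ j * y ^ j) * (x ^ j * y ^ j) ≈ 1#
  power-inverse xy≈ zero = solve 0 (con (+ 1) :* con (+ 1) :* (con (+ 1) :* con (+ 1)) := con (+ 1)) refl
  power-inverse {x} {y} xy≈ (suc j) = modulo₂ xy≈ (power-inverse xy≈ j)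
    (solve 4 (λ x y p q → x :* p :* (y :* q) :* (x :* p :* (y :* q))
      := con (+ 1) :+ ((x :* y :- con (+ 1)) :* (p :* q :* (p :* q))) :* (x :* y :- :- con (+ 1))
         :+ con (+ 1) :* (p :* q :* (p :* q) :- con (+ 1))) refl x y (x ^ j) (y ^ j))

  module UnitSquare {ε ε′ : Carrier} (εε′≈-1 : ε * ε′ ≈ - 1#) {z γ₁ γ₂ w₁ w₂ s₁ s₂ : Carrier}
    (γ₁≈ : γ₁ ≈ w₁ * s₁) (γ₂≈ : γ₂ ≈ w₂ * s₂) (w₁≈ : w₁ ≈ ε + ε) (zz≈ : z * z ≈ γ₁ * γ₂) (j : ℕ) where
    private
      p = ε ^ j
      q = ε′ ^ j

      zz≈ww : z * z ≈ (w₁ * w₂) * (s₁ * s₂)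
      zz≈ww = trans zz≈ (trans (*-cong γ₁≈ γ₂≈)
        (solve 4 (λ w x w′ x′ → (w :* x) :* (w′ :* x′) := (w :* w′) :* (x :* x′)) refl w₁ s₁ w₂ s₂))

      odd-power : ∀ x → x ^ suc (j ℕ.+ j) + x ^ suc (j ℕ.+ j) ≈ x * (x ^ j * x ^ j) + x * (x ^ j * x ^ j)
      odd-power x = +-cong (*-congˡ (power-double x j)) (*-congˡ (power-double x j))

      divide-square : ∀ {E E′ r} → (E * E′) * (E * E′) ≈ 1# → z * z ≈ (E * E) * r → (z * E′) * (z * E′) ≈ r
      divide-square {E} {E′} {r} unit zz≈ = modulo₂ zz≈ unit (solve 4 (λ z E E′ r →
        (z :* E′) :* (z :* E′) := r :+ (E′ :* E′) :* (z :* z :- (E :* E) :* r)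
          :+ r :* ((E :* E′) :* (E :* E′) :- con (+ 1))) refl z E E′ r)

    -- Here w₁w₂ = 4ε^(2j+2) is 4 times the square of ε^(j+1), which multiplying z by ε′^(j+1)
    -- cancels.
    same-unit : w₂ ≈ ε ^ suc (j ℕ.+ j) + ε ^ suc (j ℕ.+ j) → ∃ λ y → y * y ≈ fromℤ (+ 4) * (s₁ * s₂)
    same-unit w₂≈ = z * (ε′ * q) , divide-square (power-inverse εε′≈-1 (suc j))
      (trans zz≈ww (trans (*-congʳ (*-cong w₁≈ (trans w₂≈ (odd-power ε))))
        (solve 3 (λ x p s → (x :+ x) :* (x :* (p :* p) :+ x :* (p :* p)) :* s
          := ((x :* p) :* (x :* p)) :* (con (+ 4) :* s)) refl ε p (s₁ * s₂))))

    -- Now w₁w₂ = 4εε′ · ε′^(2j) = -4ε′^(2j): the norm of ε supplies the minus sign, and ε^j cancels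
    -- the remaining square.
    conjugate-unit : w₂ ≈ ε′ ^ suc (j ℕ.+ j) + ε′ ^ suc (j ℕ.+ j) → ∃ λ y → y * y ≈ fromℤ (+ 4) * (- (s₁ * s₂))
    conjugate-unit w₂≈ = z * p , divide-square {q} (power-inverse (trans (*-comm ε′ ε) εε′≈-1) j)
      (trans zz≈ww (trans (*-congʳ (*-cong w₁≈ (trans w₂≈ (odd-power ε′))))
        (modulo₁ εε′≈-1 (solve 4 (λ x y q s → (x :+ x) :* (y :* (q :* q) :+ y :* (q :* q)) :* s
          := (q :* q) :* (con (+ 4) :* (:- s)) :+ (con (+ 4) :* (q :* q) :* s) :* (x :* y :- :- con (+ 1)))
          refl ε ε′ q (s₁ * s₂)))))

module Rescale {c ℓ : Level} (R : CommutativeRing c ℓ) where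
  open CommutativeRing R
  open IntegerSolver R

  module _ {h i y δ⁻¹ δ u a : Carrier} (h+h≈1 : h + h ≈ 1#) (iy≈1 : i * y ≈ 1#) (δ⁻¹δ≈1 : δ⁻¹ * δ ≈ 1#) where

    cancel-units : ∀ x → ((h + h) * (h + h)) * ((i * y) * (i * y)) * (δ⁻¹ * δ) * x ≈ x
    cancel-units x = trans (*-congʳ (*-cong (*-cong (*-cong h+h≈1 h+h≈1) (*-cong iy≈1 iy≈1)) δ⁻¹δ≈1))
      (solve 1 (λ x → con (+ 1) :* con (+ 1) :* (con (+ 1) :* con (+ 1)) :* con (+ 1) :* x := x) refl x)

    -- `h`, `i` and `δ⁻¹` are the inverses of 2, y and δ, so a is divided by 2yδ; in
    -- `rescale-multiple` it is divided by 2y.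
    rescale-square : a * a ≈ fromℤ (+ 4) * (δ * (u * (y * y))) →
      δ * ((a * (h * (i * δ⁻¹))) * (a * (h * (i * δ⁻¹)))) ≈ u
    rescale-square aa≈ = trans
      (solve 5 (λ a h i d δ → δ :* ((a :* (h :* (i :* d))) :* (a :* (h :* (i :* d))))
        := (a :* a) :* (h :* h :* (i :* i) :* (d :* d) :* δ)) refl a h i δ⁻¹ δ)
      (trans (*-congʳ aa≈) (trans
        (solve 6 (λ h i y d δ u → con (+ 4) :* (δ :* (u :* (y :* y))) :* (h :* h :* (i :* i) :* (d :* d) :* δ)
          := ((h :+ h) :* (h :+ h)) :* ((i :* y) :* (i :* y)) :* (d :* δ) :* ((d :* δ) :* u)) refl h i y δ⁻¹ δ u)
        (trans (cancel-units ((δ⁻¹ * δ) * u)) (trans (*-congʳ δ⁻¹δ≈1) (*-identityˡ u)))))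

    rescale-multiple : δ * (a * a) ≈ fromℤ (+ 4) * (δ * (u * (y * y))) →
      (a * (h * i)) * (a * (h * i)) ≈ u
    rescale-multiple δaa≈ = trans (sym (trans (*-congʳ δ⁻¹δ≈1) (*-identityˡ _))) (trans
      (solve 5 (λ a h i d δ → (d :* δ) :* ((a :* (h :* i)) :* (a :* (h :* i)))
        := (δ :* (a :* a)) :* (h :* h :* (i :* i) :* d)) refl a h i δ⁻¹ δ)
      (trans (*-congʳ δaa≈) (trans
        (solve 6 (λ h i y d δ u → con (+ 4) :* (δ :* (u :* (y :* y))) :* (h :* h :* (i :* i) :* d)
          := ((h :+ h) :* (h :+ h)) :* ((i :* y) :* (i :* y)) :* (d :* δ) :* u) refl h i y δ⁻¹ δ u)
        (cancel-units u))))

-- The tower F ⊂ k ⊂ k(√γ) and the square class of γ.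

module Tower {c ℓ : Level} (F : CommutativeRing c ℓ) (integral : RingLemmas.IsIntegral F)
  (h : CommutativeRing.Carrier F) (h+h≈1 : RingLemmas.IsHalf F h)
  (δ : CommutativeRing.Carrier F) (nonsquare : RingLemmas.IsNonsquare F δ) where
  open CommutativeRing F
  open IntegerSolver F
  open RingLemmas F
  open Half h h+h≈1
  module Qk = QuadraticLemmas F δ
  open Qk using (embed; embed-hom; norm; norm-cong; norm-*)
  k = Quadratic.commutativeRing F δ
  module k where
    open CommutativeRing k public
    open IntegerSolver k public using (fromℤ)

  k-integral : RingLemmas.IsIntegral k
  k-integral = Qk.Domain.integral² integral nonsquare

  hk : k.Carrier
  hk = embed h

  hk+hk≈1 : hk k.+ hk k.≈ k.1#
  hk+hk≈1 = h+h≈1 , +-identityʳ 0#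

  fromℤ-k : ∀ n → k.fromℤ (+ n) k.≈ embed (fromℤ (+ n))
  fromℤ-k n = k.sym (hom-fromℤ+ F k embed embed-hom n)

  -- For e² + 16 = δ b² this is w² + 4, where w = (e + b√δ)/2.
  γ : Carrier → Carrier → k.Carrier
  γ e b = h * (δ * (b * b)) , h * (e * b)

  module _ {e b : Carrier} (e²+16 : e * e + fromℤ (+ 16) ≈ δ * (b * b)) where
    private
      w : k.Carrier
      w = h * e , h * b

    w-quadratic : w k.* w k.≈ embed e k.* w k.+ k.fromℤ (+ 4)
    w-quadratic = k.trans
      ( modulo₂ e²+16 h+h≈1 (solve 4 (λ h δ e b →
          h :* e :* (h :* e) :+ δ :* (h :* b :* (h :* b))
          := e :* (h :* e) :+ δ :* (con (+ 0) :* (h :* b)) :+ con (+ 4)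
             :+ (:- (h :* h)) :* (e :* e :+ con (+ 16) :- δ :* (b :* b))
             :+ (h :* (e :* e) :+ con (+ 8) :* h :+ con (+ 4)) :* (h :+ h :- con (+ 1))) refl h δ e b)
      , modulo₁ h+h≈1 (solve 3 (λ h e b →
          h :* e :* (h :* b) :+ h :* b :* (h :* e)
          := e :* (h :* b) :+ con (+ 0) :* (h :* e) :+ con (+ 0) :+ (h :* (e :* b)) :* (h :+ h :- con (+ 1))) refl h e b))
      (k.+-congˡ (k.sym (fromℤ-k 4)))

    γ≈w²+4 : γ e b k.≈ w k.* w k.+ k.fromℤ (+ 4)
    γ≈w²+4 = k.trans
      ( modulo₂ e²+16 h+h≈1 (solve 4 (λ h δ e b →
          h :* (δ :* (b :* b))
          := h :* e :* (h :* e) :+ δ :* (h :* b :* (h :* b)) :+ con (+ 4)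
             :+ (:- (h :* h)) :* (e :* e :+ con (+ 16) :- δ :* (b :* b))
             :+ (con (+ 8) :* h :+ con (+ 4) :- h :* (δ :* (b :* b))) :* (h :+ h :- con (+ 1))) refl h δ e b)
      , modulo₁ h+h≈1 (solve 3 (λ h e b →
          h :* (e :* b)
          := h :* e :* (h :* b) :+ h :* b :* (h :* e) :+ con (+ 0)
             :+ (:- (h :* (e :* b))) :* (h :+ h :- con (+ 1))) refl h e b))
      (k.+-congˡ (k.sym (fromℤ-k 4)))

    -- γ = w · b√δ, where w has norm -4 and b√δ has norm -δb². What matters later is that the result
    -- is δ times a square.
    norm-γ : norm (γ e b) ≈ δ * ((b + b) * (b + b))
    norm-γ = modulo₂ e²+16 h+h≈1 (solve 4 (λ h δ e b →
      h :* (δ :* (b :* b)) :* (h :* (δ :* (b :* b))) :- δ :* (h :* (e :* b) :* (h :* (e :* b)))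
      := δ :* ((b :+ b) :* (b :+ b))
        :+ (:- (h :* (h :* (δ :* (b :* b))))) :* (e :* e :+ con (+ 16) :- δ :* (b :* b))
        :+ (δ :* (b :* b) :* con (+ 4) :* (h :+ h :+ con (+ 1))) :* (h :+ h :- con (+ 1))) refl h δ e b)

  norm-embed : ∀ r → norm (embed r) ≈ r * r
  norm-embed r = solve 2 (λ δ r → r :* r :- δ :* (con (+ 0) :* con (+ 0)) := r :* r) refl δ r

  square≈0 : ∀ {r} → r * r ≈ 0# → r ≈ 0#
  square≈0 p with integral p
  ... | inj₁ q = q
  ... | inj₂ q = q

  -- The quadratic extension k(√γ) enters only through these properties. Keeping it
  -- abstract also stops its elements from being unfolded into coordinates.
  module Extension (n : ℕ) {Y : Carrier} (n²+16 : fromℤ (+ n) * fromℤ (+ n) + fromℤ (+ 16) ≈ δ * (Y * Y))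
    (L : CommutativeRing c ℓ) (embedL : k.Carrier → CommutativeRing.Carrier L) (embedL-hom : IsHom k L embedL)
    (square-root-cases : SquareRootDichotomy k L embedL (γ (fromℤ (+ n)) Y)) where
    private
      N = fromℤ (+ n)
      module L where
        open CommutativeRing L public
        open IntegerSolver L public using (fromℤ)
      module EL = IsRingHomomorphism embedL-hom
      module E = IsRingHomomorphism embed-hom

    fromℤ-L : ∀ n → L.fromℤ (+ n) L.≈ embedL (k.fromℤ (+ n))
    fromℤ-L n = L.sym (hom-fromℤ+ k L embedL embedL-hom n)

    hL+hL≈1 : embedL hk L.+ embedL hk L.≈ L.1#
    hL+hL≈1 = L.trans (L.sym (EL.+-homo hk hk)) (L.trans (EL.⟦⟧-cong hk+hk≈1) EL.1#-homo)

    generatorL-root : ∀ {θ} → θ L.* θ L.≈ embedL (γ N Y) →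
      IsRoot L n (embedL hk L.* (embedL (h * N , h * Y) L.+ θ))
    generatorL-root {θ} θ²≈ = RingLemmas.quartic-root L n ww≈ (RingLemmas.Half.quadratic-root L (embedL hk) hL+hL≈1 θθ≈)
      where
      w : k.Carrier
      w = h * N , h * Y
      W : L.Carrier
      W = embedL w
      ww≈ : W L.* W L.≈ L.fromℤ (+ n) L.* W L.+ L.fromℤ (+ 4)
      ww≈ = L.trans (L.sym (EL.*-homo w w)) (L.trans (EL.⟦⟧-cong (w-quadratic n²+16))
        (L.trans (EL.+-homo (embed N k.* w) (k.fromℤ (+ 4))) (L.+-cong
          (L.trans (EL.*-homo (embed N) w) (L.*-congʳ (L.trans (EL.⟦⟧-cong (k.sym (fromℤ-k n))) (L.sym (fromℤ-L n)))))
          (L.sym (fromℤ-L 4)))))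
      θθ≈ : θ L.* θ L.≈ W L.* W L.+ L.fromℤ (+ 4)
      θθ≈ = L.trans θ²≈ (L.trans (EL.⟦⟧-cong (γ≈w²+4 n²+16)) (L.trans (EL.+-homo (w k.* w) (k.fromℤ (+ 4)))
        (L.+-cong (EL.*-homo w w) (L.sym (fromℤ-L 4)))))

    module _ (m : ℕ) (m²+16≉0 : ¬ (fromℤ (+ m) * fromℤ (+ m) + fromℤ (+ 16) ≈ 0#))
      (m²+16-nonsquare : ∀ a → ¬ (a * a ≈ fromℤ (+ m) * fromℤ (+ m) + fromℤ (+ 16))) where
      private
        M = fromℤ (+ m)
        r = M * M + fromℤ (+ 16)
        module Sk = Qk.SquareRoot integral h h+h≈1

      r-k : k.fromℤ (+ m) k.* k.fromℤ (+ m) k.+ k.fromℤ (+ 16) k.≈ embed r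
      r-k = k.trans (k.+-cong (k.*-cong (fromℤ-k m) (fromℤ-k m)) (fromℤ-k 16))
        (k.sym (k.trans (E.+-homo (M * M) (fromℤ (+ 16))) (k.+-congʳ {embed (fromℤ (+ 16))} (E.*-homo M M))))

      r-L : L.fromℤ (+ m) L.* L.fromℤ (+ m) L.+ L.fromℤ (+ 16) L.≈ embedL (embed r)
      r-L = L.trans (L.+-cong (L.*-cong (fromℤ-L m) (fromℤ-L m)) (fromℤ-L 16))
        (L.trans (L.sym (L.trans (EL.+-homo (mk k.* mk) (k.fromℤ (+ 16))) (L.+-congʳ (EL.*-homo mk mk)))) (EL.⟦⟧-cong r-k))
        where mk = k.fromℤ (+ m)

      norm-γB² : ∀ B → norm (γ N Y k.* (B k.* B)) ≈ δ * (((Y + Y) * norm B) * ((Y + Y) * norm B))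
      norm-γB² B = trans (norm-* (γ N Y) (B k.* B)) (trans (*-cong (norm-γ n²+16) (norm-* B B))
        (solve 3 (λ δ y b → δ :* (y :* y) :* (b :* b) := δ :* ((y :* b) :* (y :* b))) refl δ (Y + Y) (norm B)))

      -- Taking norms to F gives r² = δ · □, which a nonsquare δ allows only for r = 0. This keeps a
      -- square root of m² + 16 from being a multiple of √γ, so that it lies in k.
      γB²≉r : ∀ B → ¬ (γ N Y k.* (B k.* B) k.≈ embed r)
      γB²≉r B γBB≈ = m²+16≉0 (square≈0 (trans rr≈ (trans (*-congˡ (trans (*-congʳ (nonsquare rr≈)) (zeroˡ _))) (zeroʳ δ))))
        where
        rr≈ : r * r ≈ δ * (((Y + Y) * norm B) * ((Y + Y) * norm B))
        rr≈ = trans (sym (norm-embed r)) (trans (norm-cong (k.sym γBB≈)) (norm-γB² B))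

      k-square-root : ∀ {A} → A k.* A k.≈ embed r → ∃ λ b → r ≈ δ * (b * b) × A k.≈ (0# , b)
      k-square-root {a , b} AA≈ with Sk.square-in-base {a} {b} {r} AA≈
      ... | inj₁ (_ , aa≈) = ⊥-elim (m²+16-nonsquare a aa≈)
      ... | inj₂ (a≈0 , δbb≈) = b , sym δbb≈ , a≈0 , refl

      L-square-root : ∀ {Δ} → Δ L.* Δ L.≈ embedL (embed r) → ∃ λ b → r ≈ δ * (b * b) × Δ L.≈ embedL (0# , b)
      L-square-root ΔΔ≈ with square-root-cases ΔΔ≈
      ... | inj₂ (B , γBB≈) = ⊥-elim (γB²≉r B γBB≈)
      ... | inj₁ (A , Δ≈ , AA≈) with k-square-root {A} AA≈
      ... | b , r≈ , A≈ = b , r≈ , L.trans Δ≈ (EL.⟦⟧-cong A≈)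

      -- A square root of γ(m,b) inside k would make the norm δ(2b)² a square of F, forcing b = 0
      -- and m² + 16 = 0. So the root is B√γ, and γ · γ(m,b) = (γB)².
      γ-square : ∀ {b} → r ≈ δ * (b * b) → ∀ {E} → E L.* E L.≈ embedL (γ M b) →
        ∃ λ z → z k.* z k.≈ γ N Y k.* γ M b
      γ-square {b} r≈ EE≈ with square-root-cases EE≈
      ... | inj₂ (B , γBB≈) = γ N Y k.* B ,
              k.trans {(γ N Y k.* B) k.* (γ N Y k.* B)} {γ N Y k.* (γ N Y k.* (B k.* B))}
                (RingLemmas.square-of-product k (γ N Y) B)
                (k.*-congˡ {γ N Y} {γ N Y k.* (B k.* B)} {γ M b} γBB≈)
      ... | inj₁ (A , _ , AA≈) = ⊥-elim (m²+16≉0 (trans r≈ (trans (*-congˡ (trans (*-congʳ b≈0) (zeroˡ b))) (zeroʳ δ))))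
        where
        b≈0 : b ≈ 0#
        b≈0 = double-cancel (nonsquare (trans (sym (norm-* A A)) (trans (norm-cong {A k.* A} {γ M b} AA≈) (norm-γ r≈))))

      W≈w : ∀ {W b} → W L.+ W L.- L.fromℤ (+ m) L.≈ embedL (0# , b) → W L.≈ embedL (h * M , h * b)
      W≈w {W} {b} Δ≈ = L.trans
        (RingLemmas.Half.half-sum L (embedL hk) hL+hL≈1 (L.fromℤ (+ m)) W)
        (L.trans (L.*-congˡ (L.+-cong (L.trans (fromℤ-L m) (EL.⟦⟧-cong (fromℤ-k m))) Δ≈))
          (L.trans (L.*-congˡ (L.sym (EL.+-homo (embed M) (0# , b))))
            (L.trans (L.sym (EL.*-homo hk (embed M k.+ (0# , b)))) (EL.⟦⟧-cong w≈))))
        where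
        w≈ : hk k.* (embed M k.+ (0# , b)) k.≈ (h * M , h * b)
        w≈ = solve 4 (λ h δ M b → h :* (M :+ con (+ 0)) :+ δ :* (con (+ 0) :* (con (+ 0) :+ b)) := h :* M) refl h δ M b
           , solve 3 (λ h M b → h :* (con (+ 0) :+ b) :+ con (+ 0) :* (M :+ con (+ 0)) := h :* b) refl h M b

      W²+4≈γ : ∀ {W b} → r ≈ δ * (b * b) → W L.≈ embedL (h * M , h * b) →
        W L.* W L.+ L.fromℤ (+ 4) L.≈ embedL (γ M b)
      W²+4≈γ {W} {b} r≈ W≈ = L.trans (L.+-cong (L.*-cong W≈ W≈) (fromℤ-L 4))
          (L.trans (L.sym (L.trans (EL.+-homo (w k.* w) (k.fromℤ (+ 4))) (L.+-congʳ (EL.*-homo w w))))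
            (EL.⟦⟧-cong (k.sym (γ≈w²+4 r≈))))
        where
        w : k.Carrier
        w = h * M , h * b

      square-class : ∀ {ξ} → IsRoot L m ξ → ∃ λ b → r ≈ δ * (b * b) × (∃ λ z → z k.* z k.≈ γ N Y k.* γ M b)
      square-class {ξ} root = from-decomposition (RingLemmas.quadratic-decomposition L m root)
        where
        from-root : ∀ W → (ξ L.+ ξ L.- W) L.* (ξ L.+ ξ L.- W) L.≈ W L.* W L.+ L.fromℤ (+ 4) →
          (∃ λ b → r ≈ δ * (b * b) × W L.+ W L.- L.fromℤ (+ m) L.≈ embedL (0# , b)) →
          ∃ λ b → r ≈ δ * (b * b) × (∃ λ z → z k.* z k.≈ γ N Y k.* γ M b)
        from-root W square (b , r≈ , Δ≈) = b , r≈ , γ-square r≈ (L.trans square (W²+4≈γ {W} r≈ (W≈w Δ≈)))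
        from-decomposition : (∃ λ W →
          (W L.+ W L.- L.fromℤ (+ m)) L.* (W L.+ W L.- L.fromℤ (+ m)) L.≈ L.fromℤ (+ m) L.* L.fromℤ (+ m) L.+ L.fromℤ (+ 16) ×
          (ξ L.+ ξ L.- W) L.* (ξ L.+ ξ L.- W) L.≈ W L.* W L.+ L.fromℤ (+ 4)) →
          ∃ λ b → r ≈ δ * (b * b) × (∃ λ z → z k.* z k.≈ γ N Y k.* γ M b)
        from-decomposition (W , discriminant , square) = from-root W square (L-square-root (L.trans discriminant r-L))

      iso-square-class : ∀ θ → θ L.* θ L.≈ embedL (γ N Y) → ∀ ι → IsHom ℚ-ring L ι → FieldIso m n →
        ∃ λ b → r ≈ δ * (b * b) × (∃ λ z → z k.* z k.≈ γ N Y k.* γ M b)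
      iso-square-class θ θ²≈ ι ι-hom iso = square-class (proj₂ (iso-root L ι ι-hom (generatorL-root {θ} θ²≈) iso))

  -- Lucas numbers as coordinates of powers of ε.

  module LucasPowers (T : Carrier) (U V : ℕ → Carrier) (lucas : IsLucasPair T U V) where
    open IsLucasPair lucas
    open Powers k
    open import Algebra.Properties.Semiring.Exp k.semiring using (_^_)
    module SRk = Qk.SquareRoot integral h h+h≈1
    module Ek = IsRingHomomorphism embed-hom

    -- The element (2T + Y√δ)/4; its conjugate is `ε (- Y)`.
    ε : Carrier → k.Carrier
    ε Y = h * T , h * (h * Y)

    module _ {Y : Carrier} (t²+4 : (T + T) * (T + T) + fromℤ (+ 16) ≈ δ * (Y * Y)) where

      ε-quadratic : ε Y k.* ε Y k.≈ embed T k.* ε Y k.+ k.1#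
      ε-quadratic =
          modulo₂ t²+4 h+h≈1 (solve 4 (λ h δ T Y →
            h :* T :* (h :* T) :+ δ :* (h :* (h :* Y) :* (h :* (h :* Y)))
            := T :* (h :* T) :+ δ :* (con (+ 0) :* (h :* (h :* Y))) :+ con (+ 1)
              :+ (:- (h :* h :* (h :* h))) :* ((T :+ T) :* (T :+ T) :+ con (+ 16) :- δ :* (Y :* Y))
              :+ (((h :+ h) :* (h :* h) :+ h :* h :+ h) :* (T :* T) :+ (con (+ 4) :* (h :* h) :+ con (+ 1)) :* (h :+ h :+ con (+ 1))) :* (h :+ h :- con (+ 1))) refl h δ T Y)
        , modulo₁ h+h≈1 (solve 3 (λ h T Y →
            h :* T :* (h :* (h :* Y)) :+ h :* (h :* Y) :* (h :* T)
            := T :* (h :* (h :* Y)) :+ con (+ 0) :* (h :* T) :+ con (+ 0)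
              :+ (T :* (h :* (h :* Y))) :* (h :+ h :- con (+ 1))) refl h T Y)

      ε-norm : ε Y k.* ε (- Y) k.≈ k.- k.1#
      ε-norm =
          modulo₂ t²+4 h+h≈1 (solve 4 (λ h δ T Y →
            h :* T :* (h :* T) :+ δ :* (h :* (h :* Y) :* (h :* (h :* :- Y)))
            := :- con (+ 1)
              :+ (h :* h :* (h :* h)) :* ((T :+ T) :* (T :+ T) :+ con (+ 16) :- δ :* (Y :* Y))
              :+ (:- ((con (+ 4) :* (h :* h) :+ con (+ 1)) :* (h :+ h :+ con (+ 1))) :- (h :+ h :+ con (+ 1)) :* (h :* (h :* (T :* T)))) :* (h :+ h :- con (+ 1))) refl h δ T Y)
        , solve 3 (λ h T Y →
            h :* T :* (h :* (h :* :- Y)) :+ h :* (h :* Y) :* (h :* T) := :- con (+ 0)) refl h T Y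

      -- v_j is the trace of ε^j, and ε minus its conjugate is (Y/2)√δ, so 2ε^j = v_j + u_j (Y/2)√δ.
      lucas-power : ∀ j → (V j , h * (U j * Y)) k.≈ ε Y ^ j k.+ ε Y ^ j
      lucas-power = recurrence-power (λ j → V j , h * (U j * Y)) ε-quadratic
        (V₀ , trans (*-congˡ (*-congʳ U₀)) (solve 2 (λ h Y → h :* (con (+ 0) :* Y) := con (+ 0) :+ con (+ 0)) refl h Y))
        ( trans V₁ (modulo₁ h+h≈1 (solve 2 (λ h T → T := h :* T :+ h :* T :+ (:- T) :* (h :+ h :- con (+ 1))) refl h T))
        , trans (*-congˡ (*-congʳ U₁)) (modulo₁ h+h≈1 (solve 2 (λ h Y → h :* (con (+ 1) :* Y)
            := h :* (h :* Y) :+ h :* (h :* Y) :+ (:- (h :* Y)) :* (h :+ h :- con (+ 1))) refl h Y)))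
        (λ j →
            trans (V-rec j) (+-congʳ (solve 5 (λ h δ T v u →
              T :* v := T :* v :+ δ :* (con (+ 0) :* (h :* u))) refl h δ T (V (suc j)) (U (suc j) * Y)))
          , trans (*-congˡ (*-congʳ (U-rec j))) (solve 6 (λ h T Y v u u₀ →
              h :* ((T :* u :+ u₀) :* Y) := T :* (h :* (u :* Y)) :+ con (+ 0) :* v :+ h :* (u₀ :* Y)) refl h T Y (V (suc j)) (U (suc j)) (U j)))

    module _ {Y : Carrier} (t²+4 : (T + T) * (T + T) + fromℤ (+ 16) ≈ δ * (Y * Y)) where
      private
        t²+4′ : (T + T) * (T + T) + fromℤ (+ 16) ≈ δ * (- Y * - Y)
        t²+4′ = trans t²+4 (solve 2 (λ δ Y → δ :* (Y :* Y) := δ :* (:- Y :* :- Y)) refl δ Y)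

      -- Separates the part w, which is twice a unit, from b√δ: the product of two elements of the
      -- latter kind lies in F.
      γ-factor : ∀ e b → γ e b k.≈ (h * e , h * b) k.* (0# , b)
      γ-factor e b =
          solve 4 (λ h δ e b → h :* (δ :* (b :* b)) := h :* e :* con (+ 0) :+ δ :* (h :* b :* b)) refl h δ e b
        , solve 3 (λ h e b → h :* (e :* b) := h :* e :* b :+ h :* b :* con (+ 0)) refl h e b

      halve-double : ∀ {x y} → x ≈ y + y → h * x ≈ y
      halve-double {x} {y} x≈ = trans (*-congˡ x≈) (modulo₁ h+h≈1
        (solve 2 (λ h y → h :* (y :+ y) := y :+ y :* (h :+ h :- con (+ 1))) refl h y))

      w≈ : ∀ {N} → N ≈ T + T → (h * N , h * Y) k.≈ ε Y k.+ ε Y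
      w≈ N≈ = trans (*-congˡ N≈) (distribˡ h T T) ,
        modulo₁ h+h≈1 (solve 2 (λ h Y → h :* Y := h :* (h :* Y) :+ h :* (h :* Y)
          :+ (:- (h :* Y)) :* (h :+ h :- con (+ 1))) refl h Y)

      √-product : ∀ b → k.fromℤ (+ 4) k.* ((0# , Y) k.* (0# , b)) k.≈ embed (fromℤ (+ 4) * (δ * (Y * b)))
      √-product b = k.trans (k.*-congʳ {(0# , Y) k.* (0# , b)} (fromℤ-k 4))
        ( solve 4 (λ c δ Y b → c :* (con (+ 0) :* con (+ 0) :+ δ :* (Y :* b))
              :+ δ :* (con (+ 0) :* (con (+ 0) :* b :+ Y :* con (+ 0))) := c :* (δ :* (Y :* b))) refl (fromℤ (+ 4)) δ Y b
        , solve 4 (λ c δ Y b → c :* (con (+ 0) :* b :+ Y :* con (+ 0))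
              :+ con (+ 0) :* (con (+ 0) :* con (+ 0) :+ δ :* (Y :* b)) := con (+ 0)) refl (fromℤ (+ 4)) δ Y b)

      in-base : ∀ {r} → (∃ λ y → y k.* y k.≈ embed r) → (∃ λ a → a * a ≈ r) ⊎ (∃ λ a → δ * (a * a) ≈ r)
      in-base {r} ((a , b) , yy≈) with SRk.square-in-base {a} {b} {r} yy≈
      ... | inj₁ (_ , aa≈) = inj₁ (a , aa≈)
      ... | inj₂ (_ , δbb≈) = inj₂ (b , δbb≈)

      embed-cong-square : ∀ {x r s} → r ≈ s → x k.≈ embed r → (∃ λ y → y k.* y k.≈ x) → ∃ λ y → y k.* y k.≈ embed s
      embed-cong-square {x} {r} {s} r≈s (p , q) (y , yy≈) = y , k.trans {y k.* y} {x} {embed s} yy≈ (trans p r≈s , q)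

      -- With n + Y√δ = 4ε and m + b√δ = 4ε^(2j+1) or 4ε̄^(2j+1), the product γ(n,Y) γ(m,b) is a
      -- unit square times 4δu Y².
      lucas-square-class : ∀ j {N M b} → let u = U (suc (j ℕ.+ j)) ; v = V (suc (j ℕ.+ j)) in
        N ≈ T + T → M ≈ v + v → b ≈ u * Y ⊎ b ≈ - (u * Y) → ∀ z → z k.* z k.≈ γ N Y k.* γ M b →
        let r = fromℤ (+ 4) * (δ * (u * (Y * Y))) in
        (∃ λ a → a * a ≈ r) ⊎ (∃ λ a → δ * (a * a) ≈ r)
      lucas-square-class j {N} {M} {b} N≈ M≈ (inj₁ b≈) z zz≈ = in-base
        (embed-cong-square {k.fromℤ (+ 4) k.* ((0# , Y) k.* (0# , b))} (*-congˡ (*-congˡ Yb≈)) (√-product b)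
          (UnitSquare.same-unit {ε Y} {ε (- Y)} (ε-norm t²+4) {z} {γ N Y} {γ M b} {h * N , h * Y} {h * M , h * b}
            {0# , Y} {0# , b} (γ-factor N Y) (γ-factor M b) (w≈ N≈) zz≈ j
            (k.trans {h * M , h * b} {v , h * (u * Y)} (halve-double M≈ , *-congˡ b≈) (lucas-power t²+4 (suc (j ℕ.+ j))))))
        where
        u = U (suc (j ℕ.+ j))
        v = V (suc (j ℕ.+ j))
        Yb≈ : Y * b ≈ u * (Y * Y)
        Yb≈ = trans (*-congˡ b≈) (solve 2 (λ Y u → Y :* (u :* Y) := u :* (Y :* Y)) refl Y u)
      -- For b = -uY the second w is twice a power of the conjugate unit; the minus sign of
      -- `conjugate-unit` cancels the sign of b, so both cases end at the same r.
      lucas-square-class j {N} {M} {b} N≈ M≈ (inj₂ b≈) z zz≈ = in-base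
        (embed-cong-square {k.fromℤ (+ 4) k.* (k.- ((0# , Y) k.* (0# , b)))} (*-congˡ (*-congˡ Yb≈))
          (k.trans {k.fromℤ (+ 4) k.* (k.- ((0# , Y) k.* (0# , b)))} {k.fromℤ (+ 4) k.* ((0# , Y) k.* (0# , - b))}
            (k.*-congˡ {k.fromℤ (+ 4)} {k.- ((0# , Y) k.* (0# , b))} {(0# , Y) k.* (0# , - b)} negate) (√-product (- b)))
          (UnitSquare.conjugate-unit {ε Y} {ε (- Y)} (ε-norm t²+4) {z} {γ N Y} {γ M b} {h * N , h * Y} {h * M , h * b}
            {0# , Y} {0# , b} (γ-factor N Y) (γ-factor M b) (w≈ N≈) zz≈ j
            (k.trans {h * M , h * b} {v , h * (u * - Y)}
              (halve-double M≈ , *-congˡ (trans b≈ (solve 2 (λ u Y → :- (u :* Y) := u :* :- Y) refl u Y)))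
              (lucas-power t²+4′ (suc (j ℕ.+ j))))))
        where
        u = U (suc (j ℕ.+ j))
        v = V (suc (j ℕ.+ j))
        negate : k.- ((0# , Y) k.* (0# , b)) k.≈ (0# , Y) k.* (0# , - b)
        negate = solve 3 (λ δ Y b → :- (con (+ 0) :* con (+ 0) :+ δ :* (Y :* b)) := con (+ 0) :* con (+ 0) :+ δ :* (Y :* :- b)) refl δ Y b
               , solve 2 (λ Y b → :- (con (+ 0) :* b :+ Y :* con (+ 0)) := con (+ 0) :* :- b :+ Y :* con (+ 0)) refl Y b
        Yb≈ : Y * - b ≈ u * (Y * Y)
        Yb≈ = trans (*-congˡ (-‿cong b≈)) (solve 2 (λ Y u → Y :* :- (:- (u :* Y)) := u :* (Y :* Y)) refl Y u)

  -- From a field isomorphism to a square class.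

  module Isomorphism (ι : ℚ → Carrier) (ι-hom : IsHom ℚ-ring F ι) (n : ℕ) {Y : Carrier}
    (n²+16 : fromℤ (+ n) * fromℤ (+ n) + fromℤ (+ 16) ≈ δ * (Y * Y)) where
    private
      γₙ : k.Carrier
      γₙ = γ (fromℤ (+ n)) Y
      L : CommutativeRing c ℓ
      L = Quadratic.commutativeRing k γₙ
      module Lγ = QuadraticLemmas k γₙ

      square-root-cases : SquareRootDichotomy k L Lγ.embed γₙ
      square-root-cases {x} {r} = Lγ.SquareRoot.square-root-cases k-integral hk hk+hk≈1 {x} {r}

      module Ext = Extension n {Y} n²+16 L Lγ.embed Lγ.embed-hom square-root-cases

      ι-hom-L : IsHom ℚ-ring L (λ q → Lγ.embed (embed (ι q)))
      ι-hom-L = Composition.isRingHomomorphism (CommutativeRing.trans L)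
        (Composition.isRingHomomorphism k.trans ι-hom embed-hom) Lγ.embed-hom

    iso-square-class : ∀ m → ¬ (fromℤ (+ m) * fromℤ (+ m) + fromℤ (+ 16) ≈ 0#) →
      (∀ a → ¬ (a * a ≈ fromℤ (+ m) * fromℤ (+ m) + fromℤ (+ 16))) → FieldIso m n →
      ∃ λ b → fromℤ (+ m) * fromℤ (+ m) + fromℤ (+ 16) ≈ δ * (b * b) ×
        (∃ λ z → z k.* z k.≈ γₙ k.* γ (fromℤ (+ m)) b)
    iso-square-class m ≉0 nonsq = Ext.iso-square-class m ≉0 nonsq (k.0# , k.1#) Lγ.√δ*√δ
      (λ q → Lγ.embed (embed (ι q))) ι-hom-L

    -- The coefficient b comes out of the isomorphism, but the index j only from integrality and the
    -- fundamental unit. Hence the square-class statement is given for all j, to be applied once b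
    -- has been identified.
    iso-lucas : ∀ {T U V} → IsLucasPair T U V → fromℤ (+ n) ≈ T + T →
      ∀ m → ¬ (fromℤ (+ m) * fromℤ (+ m) + fromℤ (+ 16) ≈ 0#) →
      (∀ a → ¬ (a * a ≈ fromℤ (+ m) * fromℤ (+ m) + fromℤ (+ 16))) → FieldIso m n →
      ∃ λ b → fromℤ (+ m) * fromℤ (+ m) + fromℤ (+ 16) ≈ δ * (b * b) ×
        (∀ j → let u = U (suc (j ℕ.+ j)) ; v = V (suc (j ℕ.+ j)) ; r = fromℤ (+ 4) * (δ * (u * (Y * Y))) in
          fromℤ (+ m) ≈ v + v → b ≈ u * Y ⊎ b ≈ - (u * Y) → (∃ λ a → a * a ≈ r) ⊎ (∃ λ a → δ * (a * a) ≈ r))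
    iso-lucas {T} {U} {V} lucas N≈ m ≉0 nonsq iso = from-class (iso-square-class m ≉0 nonsq iso)
      where
      t²+4 : (T + T) * (T + T) + fromℤ (+ 16) ≈ δ * (Y * Y)
      t²+4 = trans (+-congʳ (sym (*-cong N≈ N≈))) n²+16
      from-class : (∃ λ b → fromℤ (+ m) * fromℤ (+ m) + fromℤ (+ 16) ≈ δ * (b * b) ×
          (∃ λ z → z k.* z k.≈ γₙ k.* γ (fromℤ (+ m)) b)) →
        ∃ λ b → fromℤ (+ m) * fromℤ (+ m) + fromℤ (+ 16) ≈ δ * (b * b) ×
        (∀ j → let u = U (suc (j ℕ.+ j)) ; v = V (suc (j ℕ.+ j)) ; r = fromℤ (+ 4) * (δ * (u * (Y * Y))) in
          fromℤ (+ m) ≈ v + v → b ≈ u * Y ⊎ b ≈ - (u * Y) → (∃ λ a → a * a ≈ r) ⊎ (∃ λ a → δ * (a * a) ≈ r))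
      from-class (b , r≈ , z , zz≈) = b , r≈ , λ j M≈ b≈ → LucasPowers.lucas-square-class T U V lucas t²+4 j N≈ M≈ b≈ z zz≈

open ≡ using (refl; sym; trans; cong; cong₂; subst; module ≡-Reasoning)

-- Rational solutions of c q² = N are integral for squarefree c.

toℚᵘ-ratℕ : ∀ n → ℚ.toℚᵘ (ratℕ n) ℚᵘ.≃ mkℚᵘ (+ n) 0
toℚᵘ-ratℕ n = ℚ.toℚᵘ-fromℚᵘ (mkℚᵘ (+ n) 0)

ratℕ-* : ∀ m n → ratℕ (m ℕ.* n) ≡ ratℕ m ℚ.* ratℕ n
ratℕ-* m n = ℚ.toℚᵘ-injective (begin
  ℚ.toℚᵘ (ratℕ (m ℕ.* n))                    ≈⟨ toℚᵘ-ratℕ (m ℕ.* n) ⟩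
  mkℚᵘ (+ (m ℕ.* n)) 0                       ≈⟨ *≡* (cong (ℤ._* + 1) (ℤ.pos-* m n)) ⟩
  mkℚᵘ (+ m) 0 ℚᵘ.* mkℚᵘ (+ n) 0             ≈⟨ ℚᵘ.*-cong (toℚᵘ-ratℕ m) (toℚᵘ-ratℕ n) ⟨
  ℚ.toℚᵘ (ratℕ m) ℚᵘ.* ℚ.toℚᵘ (ratℕ n)       ≈⟨ ℚ.toℚᵘ-homo-* (ratℕ m) (ratℕ n) ⟨
  ℚ.toℚᵘ (ratℕ m ℚ.* ratℕ n)                 ∎)
  where open import Relation.Binary.Reasoning.Setoid ℚᵘ.≃-setoid

ratℕ-injective : ∀ {m n} → ratℕ m ≡ ratℕ n → m ≡ n
ratℕ-injective {m} {n} p with ℚᵘ.≃-trans (ℚᵘ.≃-sym (toℚᵘ-ratℕ m)) (ℚᵘ.≃-trans (ℚ.toℚᵘ-cong p) (toℚᵘ-ratℕ n))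
... | *≡* q = ℤ.+-injective (ℤ.*-cancelʳ-≡ (+ m) (+ n) (+ 1) q)

ℚ-integral : RingLemmas.IsIntegral ℚ-ring
ℚ-integral {x} {y} xy≡0 with x ℚ.≟ 0ℚ
... | yes x≡0 = inj₁ x≡0
... | no x≢0 = inj₂ (trans (sym (ℚ.*-identityˡ y)) (trans (cong (ℚ._* y) (sym (ℚ.*-inverseˡ x)))
        (trans (ℚ.*-assoc (ℚ.1/ x) x y) (trans (cong (ℚ.1/ x ℚ.*_) xy≡0) (ℚ.*-zeroʳ (ℚ.1/ x))))))
  where instance _ = ℚ.≢-nonZero x≢0

integral-numerator : ∀ c N (q : ℚ) → ratℕ c ℚ.* (q ℚ.* q) ≡ ratℕ N →
  c ℕ.* (ℤ.∣ ℚ.↥ q ∣ ℕ.* ℤ.∣ ℚ.↥ q ∣) ≡ N ℕ.* (ℚ.↧ₙ q ℕ.* ℚ.↧ₙ q)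
integral-numerator c N q@(mkℚ a b-1 _) p with ℚᵘ.≃-trans
    (ℚᵘ.≃-sym (ℚᵘ.≃-trans (ℚ.toℚᵘ-homo-* (ratℕ c) (q ℚ.* q)) (ℚᵘ.*-cong (toℚᵘ-ratℕ c) (ℚ.toℚᵘ-homo-* q q))))
    (ℚᵘ.≃-trans (ℚ.toℚᵘ-cong p) (toℚᵘ-ratℕ N))
... | *≡* e = trans (sym (ℕ.*-identityʳ _)) (trans (cong (ℕ._* 1) (sym abs-left))
        (trans (sym (ℤ.abs-* (+ c ℤ.* (a ℤ.* a)) (+ 1))) (trans (cong ℤ.∣_∣ e) (trans (ℤ.abs-* (+ N) _) (cong (N ℕ.*_) (ℕ.+-identityʳ _))))))
  where
  abs-left : ℤ.∣ + c ℤ.* (a ℤ.* a) ∣ ≡ c ℕ.* (ℤ.∣ a ∣ ℕ.* ℤ.∣ a ∣)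
  abs-left = trans (ℤ.abs-* (+ c) (a ℤ.* a)) (cong (c ℕ.*_) (ℤ.abs-* a a))

coprime-cancel-square : ∀ {a b} → Coprimality.Coprime a b → ∀ c → b ∣ c ℕ.* (a ℕ.* a) → b ∣ c
coprime-cancel-square {a} {b} cop c p =
  coprime-divisor (Coprimality.sym cop) (coprime-divisor (Coprimality.sym cop) (subst (b ∣_) (rotate c a) p))
  where
  rotate : ∀ c a → c ℕ.* (a ℕ.* a) ≡ a ℕ.* (a ℕ.* c)
  rotate = ℕSolver.solve-∀

-- Coprimality strips a² twice: first b divides c, then b divides c/b. So b² divides the squarefree
-- c.
squarefree-denominator : ∀ {c N a b} .{{_ : ℕ.NonZero b}} → SquareFree c → Coprimality.Coprime a b →
  c ℕ.* (a ℕ.* a) ≡ N ℕ.* (b ℕ.* b) → b ≡ 1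
squarefree-denominator {c} {N} {a} {b} (_ , squarefree) cop eq
  with coprime-cancel-square cop c (divides (N ℕ.* b) (trans eq (sym (ℕ.*-assoc N b b))))
... | divides c′ c≡ with coprime-cancel-square cop c′ (divides N c′aa≡Nb)
  where
  swap-last : ∀ x y z → x ℕ.* y ℕ.* z ≡ x ℕ.* z ℕ.* y
  swap-last = ℕSolver.solve-∀
  c′aa≡Nb : c′ ℕ.* (a ℕ.* a) ≡ N ℕ.* b
  c′aa≡Nb = ℕ.*-cancelʳ-≡ _ _ b
    (trans (swap-last c′ (a ℕ.* a) b) (trans (cong (ℕ._* (a ℕ.* a)) (sym c≡)) (trans eq (sym (ℕ.*-assoc N b b)))))
... | divides c″ c′≡ = squarefree b (divides c″ (trans c≡ (trans (cong (ℕ._* b) c′≡) (ℕ.*-assoc c″ b b))))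

integer-form : ∀ a (q : ℚ) → a ℚ./ 1 ≡ q → q ≡ ratℕ ℤ.∣ a ∣ ⊎ q ≡ ℚ.- ratℕ ℤ.∣ a ∣
integer-form (+ n) _ p = inj₁ (sym p)
integer-form -[1+ n ] _ p = inj₂ (sym p)

integer-root : ∀ c N (q : ℚ) → SquareFree c → ratℕ c ℚ.* (q ℚ.* q) ≡ ratℕ N →
  ∃ λ e → (q ≡ ratℕ e ⊎ q ≡ ℚ.- ratℕ e) × c ℕ.* (e ℕ.* e) ≡ N
integer-root c N q squarefree p = ℤ.∣ ℚ.↥ q ∣ ,
    integer-form (ℚ.↥ q) q (trans (ℚ./-cong {ℚ.↥ q} {1} {ℚ.↥ q} {ℚ.↧ₙ q} refl (sym den≡1)) (ℚ.↥p/↧p≡p q)) ,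
    trans numerators (trans (cong (λ b → N ℕ.* (b ℕ.* b)) den≡1) (ℕ.*-identityʳ N))
  where
  numerators = integral-numerator c N q p
  den≡1 : ℚ.↧ₙ q ≡ 1
  den≡1 = squarefree-denominator {N = N} squarefree (coprime q) numerators
    where
    coprime : ∀ q → Coprimality.Coprime ℤ.∣ ℚ.↥ q ∣ (ℚ.↧ₙ q)
    coprime (mkℚ _ _ c) = Coprimality.recompute c

-- Parity, and product formulas for Lucas numbers.

even-or-odd : ∀ n → ∃ λ i → n ≡ i ℕ.+ i ⊎ n ≡ suc (i ℕ.+ i)
even-or-odd zero = 0 , inj₁ refl
even-or-odd (suc n) with even-or-odd n
... | i , inj₁ refl = i , inj₂ refl
... | i , inj₂ refl = suc i , inj₁ (cong suc (sym (ℕ.+-suc i i)))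

double%2 : ∀ a i → (a ℕ.+ (i ℕ.+ i)) % 2 ≡ a % 2
double%2 a i = trans (cong (_% 2) (twice a i)) ([m+kn]%n≡m%n a i 2)
  where
  twice : ∀ a i → a ℕ.+ (i ℕ.+ i) ≡ a ℕ.+ i ℕ.* 2
  twice = ℕSolver.solve-∀

odd-form : ∀ n → n % 2 ≡ 1 → ∃ λ i → n ≡ suc (i ℕ.+ i)
odd-form n p with even-or-odd n
... | i , inj₂ q = i , q
... | i , inj₁ refl with trans (sym (double%2 0 i)) p
... | ()

-- (-1)^k, the norm of ε^k.
sgn : ℕ → ℤ
sgn zero = + 1
sgn (suc k) = ℤ.- sgn k

sgn-even : ∀ i → sgn (i ℕ.+ i) ≡ + 1
sgn-even zero = refl
sgn-even (suc i) rewrite ℕ.+-suc i i = trans (ℤ.neg-involutive _) (sgn-even i)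

module Lucas (t : ℕ) where
  u v : ℕ → ℕ
  u = lucasU t
  v = lucasV t

  V U : ℕ → ℤ
  V k = + v k
  U k = + u k

  IsRecurrent : (ℕ → ℤ) → Set
  IsRecurrent W = ∀ j → W (suc (suc j)) ≡ + t ℤ.* W (suc j) ℤ.+ W j

  U-recurrent : IsRecurrent U
  U-recurrent j = cong (ℤ._+ U j) (ℤ.pos-* t (u (suc j)))

  V-recurrent : IsRecurrent V
  V-recurrent j = cong (ℤ._+ V j) (ℤ.pos-* t (v (suc j)))

  shift₁ : ∀ m k → suc m ℕ.+ (suc k ℕ.+ suc k) ≡ 3 ℕ.+ (m ℕ.+ (k ℕ.+ k))
  shift₁ = ℕSolver.solve-∀
  shift₂ : ∀ m k → m ℕ.+ (suc (suc k) ℕ.+ suc (suc k)) ≡ 4 ℕ.+ (m ℕ.+ (k ℕ.+ k))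
  shift₂ = ℕSolver.solve-∀
  shift₃ : ∀ m k → m ℕ.+ suc (suc k) ≡ 2 ℕ.+ (m ℕ.+ k)
  shift₃ = ℕSolver.solve-∀
  shift₄ : ∀ m k → suc m ℕ.+ suc k ≡ 2 ℕ.+ (m ℕ.+ k)
  shift₄ = ℕSolver.solve-∀

  -- Both product formulas follow from their instances at (k , m + 2) and (k + 1 , m + 1).
  recurrence-step : ∀ t s w₀ w₁ w₂ w₃ p₂ p₃ p₄ → w₂ ≡ t ℤ.* w₁ ℤ.+ w₀ → p₄ ≡ t ℤ.* p₃ ℤ.+ p₂ →
    ∀ x y → p₃ ℤ.+ (ℤ.- s) ℤ.* w₁ ≡ x → p₂ ℤ.+ s ℤ.* w₂ ≡ y → w₃ ≡ t ℤ.* x ℤ.+ y →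
    p₄ ℤ.+ (ℤ.- (ℤ.- s)) ℤ.* w₀ ≡ w₃
  recurrence-step t s w₀ w₁ _ _ p₂ p₃ _ refl refl _ _ refl refl refl =
    identity t s w₀ w₁ p₂ p₃
    where
    identity : ∀ t s w₀ w₁ p₂ p₃ → (t ℤ.* p₃ ℤ.+ p₂) ℤ.+ (ℤ.- (ℤ.- s)) ℤ.* w₀
      ≡ t ℤ.* (p₃ ℤ.+ (ℤ.- s) ℤ.* w₁) ℤ.+ (p₂ ℤ.+ s ℤ.* (t ℤ.* w₁ ℤ.+ w₀))
    identity = ℤSolver.solve-∀

  -- As ε has norm -1, multiplying by its k-th power plus the conjugate power shifts the index by k
  -- both ways, with the sign (-1)^k on the lower term. The lower index is taken as m, so no indices
  -- are subtracted.
  product-V : ∀ W → IsRecurrent W → ∀ k m → W (m ℕ.+ (k ℕ.+ k)) ℤ.+ sgn k ℤ.* W m ≡ W (m ℕ.+ k) ℤ.* V k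
  product-V W rec zero m rewrite ℕ.+-identityʳ m = identity (W m)
    where
    identity : ∀ w → w ℤ.+ + 1 ℤ.* w ≡ w ℤ.* + 2
    identity = ℤSolver.solve-∀
  product-V W rec (suc zero) m rewrite ℕ.+-comm m 2 | ℕ.+-comm m 1 | rec m = identity (+ t) (W (suc m)) (W m)
    where
    identity : ∀ t w₁ w → t ℤ.* w₁ ℤ.+ w ℤ.+ (ℤ.- + 1) ℤ.* w ≡ w₁ ℤ.* t
    identity = ℤSolver.solve-∀
  product-V W rec (suc (suc k)) m =
    subst (λ i → W i ℤ.+ sgn (suc (suc k)) ℤ.* W m ≡ W (m ℕ.+ suc (suc k)) ℤ.* V (suc (suc k))) (sym (shift₂ m k))
      (subst (λ i → W (4 ℕ.+ j) ℤ.+ sgn (suc (suc k)) ℤ.* W m ≡ W i ℤ.* V (suc (suc k))) (sym (shift₃ m k))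
        (recurrence-step (+ t) (sgn k) (W m) (W (suc m)) (W (suc (suc m))) _ (W (2 ℕ.+ j)) (W (3 ℕ.+ j)) (W (4 ℕ.+ j))
          (rec m) (rec (2 ℕ.+ j)) _ _ (reindex (product-V W rec (suc k) (suc m))) (product-V W rec k (suc (suc m)))
          (trans (cong (W (2 ℕ.+ (m ℕ.+ k)) ℤ.*_) (V-recurrent k)) (identity (W (2 ℕ.+ (m ℕ.+ k))) (+ t) (V (suc k)) (V k)))))
    where
    j = m ℕ.+ (k ℕ.+ k)
    reindex : W (suc m ℕ.+ (suc k ℕ.+ suc k)) ℤ.+ sgn (suc k) ℤ.* W (suc m) ≡ W (suc m ℕ.+ suc k) ℤ.* V (suc k) →
      W (3 ℕ.+ j) ℤ.+ sgn (suc k) ℤ.* W (suc m) ≡ W (2 ℕ.+ (m ℕ.+ k)) ℤ.* V (suc k)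
    reindex ih = subst (λ i → W i ℤ.+ sgn (suc k) ℤ.* W (suc m) ≡ W (2 ℕ.+ (m ℕ.+ k)) ℤ.* V (suc k)) (shift₁ m k)
      (subst (λ i → W (suc m ℕ.+ (suc k ℕ.+ suc k)) ℤ.+ sgn (suc k) ℤ.* W (suc m) ≡ W i ℤ.* V (suc k)) (shift₄ m k)
        ih)
    identity : ∀ q t v₁ v₀ → q ℤ.* (t ℤ.* v₁ ℤ.+ v₀) ≡ t ℤ.* (q ℤ.* v₁) ℤ.+ q ℤ.* v₀
    identity = ℤSolver.solve-∀

  v≡u+u : ∀ m → v (suc m) ≡ u (suc (suc m)) ℕ.+ u m
  v≡u+u zero = identity t
    where
    identity : ∀ t → t ≡ t ℕ.* 1 ℕ.+ 0 ℕ.+ 0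
    identity = ℕSolver.solve-∀
  v≡u+u (suc zero) = identity t
    where
    identity : ∀ t → t ℕ.* t ℕ.+ 2 ≡ t ℕ.* (t ℕ.* 1 ℕ.+ 0) ℕ.+ 1 ℕ.+ 1
    identity = ℕSolver.solve-∀
  v≡u+u (suc (suc m)) = trans (cong₂ (λ a b → t ℕ.* a ℕ.+ b) (v≡u+u (suc m)) (v≡u+u m)) (identity t (u (suc (suc m))) (u (suc m)) (u m))
    where
    identity : ∀ t a b c → t ℕ.* ((t ℕ.* a ℕ.+ b) ℕ.+ b) ℕ.+ (a ℕ.+ c) ≡ t ℕ.* (t ℕ.* a ℕ.+ b) ℕ.+ a ℕ.+ (t ℕ.* b ℕ.+ c)
    identity = ℕSolver.solve-∀

  product-U : ∀ k m → U (m ℕ.+ (k ℕ.+ k)) ℤ.+ (ℤ.- sgn k) ℤ.* U m ≡ V (m ℕ.+ k) ℤ.* U k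
  product-U zero m rewrite ℕ.+-identityʳ m = identity (U m) (V m)
    where
    identity : ∀ w v → w ℤ.+ (ℤ.- + 1) ℤ.* w ≡ v ℤ.* + 0
    identity = ℤSolver.solve-∀
  product-U (suc zero) m rewrite ℕ.+-comm m 2 | ℕ.+-comm m 1 | v≡u+u m = identity (U (suc (suc m))) (U m)
    where
    identity : ∀ a w → a ℤ.+ (ℤ.- (ℤ.- + 1)) ℤ.* w ≡ (a ℤ.+ w) ℤ.* + 1
    identity = ℤSolver.solve-∀
  product-U (suc (suc k)) m =
    subst (λ i → U i ℤ.+ (ℤ.- sgn (suc (suc k))) ℤ.* U m ≡ V (m ℕ.+ suc (suc k)) ℤ.* U (suc (suc k))) (sym (shift₂ m k))
      (subst (λ i → U (4 ℕ.+ j) ℤ.+ (ℤ.- sgn (suc (suc k))) ℤ.* U m ≡ V i ℤ.* U (suc (suc k))) (sym (shift₃ m k))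
        (recurrence-step (+ t) (ℤ.- sgn k) (U m) (U (suc m)) (U (suc (suc m))) _ (U (2 ℕ.+ j)) (U (3 ℕ.+ j)) (U (4 ℕ.+ j))
          (U-recurrent m) (U-recurrent (2 ℕ.+ j)) _ _ (reindex (product-U (suc k) (suc m))) (product-U k (suc (suc m)))
          (trans (cong (V (2 ℕ.+ (m ℕ.+ k)) ℤ.*_) (U-recurrent k)) (identity (V (2 ℕ.+ (m ℕ.+ k))) (+ t) (U (suc k)) (U k)))))
    where
    j = m ℕ.+ (k ℕ.+ k)
    reindex : U (suc m ℕ.+ (suc k ℕ.+ suc k)) ℤ.+ (ℤ.- sgn (suc k)) ℤ.* U (suc m) ≡ V (suc m ℕ.+ suc k) ℤ.* U (suc k) →
      U (3 ℕ.+ j) ℤ.+ (ℤ.- sgn (suc k)) ℤ.* U (suc m) ≡ V (2 ℕ.+ (m ℕ.+ k)) ℤ.* U (suc k)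
    reindex ih = subst (λ i → U i ℤ.+ (ℤ.- sgn (suc k)) ℤ.* U (suc m) ≡ V (2 ℕ.+ (m ℕ.+ k)) ℤ.* U (suc k)) (shift₁ m k)
      (subst (λ i → U (suc m ℕ.+ (suc k ℕ.+ suc k)) ℤ.+ (ℤ.- sgn (suc k)) ℤ.* U (suc m) ≡ V i ℤ.* U (suc k)) (shift₄ m k)
        ih)
    identity : ∀ q t v₁ v₀ → q ℤ.* (t ℤ.* v₁ ℤ.+ v₀) ≡ t ℤ.* (q ℤ.* v₁) ℤ.+ q ℤ.* v₀
    identity = ℤSolver.solve-∀

  sum-form : ∀ a b c d {s} → s ≡ + 1 → + a ℤ.+ s ℤ.* + b ≡ + c ℤ.* + d → a ℕ.+ b ≡ c ℕ.* d
  sum-form a b c d refl p = ℤ.+-injective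
    (trans (cong (ℤ._+_ (+ a)) (sym (ℤ.*-identityˡ (+ b)))) (trans p (sym (ℤ.pos-* c d))))

  difference-form : ∀ a b c d {s} → s ≡ + 1 → + a ℤ.+ (ℤ.- s) ℤ.* + b ≡ + c ℤ.* + d → a ≡ b ℕ.+ c ℕ.* d
  difference-form a b c d refl p = ℤ.+-injective
    (trans (identity (+ a) (+ b)) (cong (ℤ._+_ (+ b)) (trans p (sym (ℤ.pos-* c d)))))
    where
    identity : ∀ a b → a ≡ b ℤ.+ (a ℤ.+ (ℤ.- + 1) ℤ.* b)
    identity = ℤSolver.solve-∀

  u-even : ∀ i m → let k = i ℕ.+ i in u (m ℕ.+ (k ℕ.+ k)) ℕ.+ u m ≡ u (m ℕ.+ k) ℕ.* v k
  u-even i m = sum-form _ (u m) (u (m ℕ.+ (i ℕ.+ i))) (v (i ℕ.+ i)) (sgn-even i) (product-V U U-recurrent (i ℕ.+ i) m)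

  v-even : ∀ i m → let k = i ℕ.+ i in v (m ℕ.+ (k ℕ.+ k)) ℕ.+ v m ≡ v (m ℕ.+ k) ℕ.* v k
  v-even i m = sum-form _ (v m) (v (m ℕ.+ (i ℕ.+ i))) (v (i ℕ.+ i)) (sgn-even i) (product-V V V-recurrent (i ℕ.+ i) m)

  u-odd : ∀ i m → let k = suc (i ℕ.+ i) in u (m ℕ.+ (k ℕ.+ k)) ≡ u m ℕ.+ u (m ℕ.+ k) ℕ.* v k
  u-odd i m = difference-form _ (u m) (u (m ℕ.+ suc (i ℕ.+ i))) (v (suc (i ℕ.+ i))) (sgn-even i) (product-V U U-recurrent (suc (i ℕ.+ i)) m)

  u-odd′ : ∀ i m → let k = suc (i ℕ.+ i) in u (m ℕ.+ (k ℕ.+ k)) ℕ.+ u m ≡ v (m ℕ.+ k) ℕ.* u k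
  u-odd′ i m = sum-form _ (u m) (v (m ℕ.+ suc (i ℕ.+ i))) (u (suc (i ℕ.+ i))) (trans (ℤ.neg-involutive _) (sgn-even i)) (product-U (suc (i ℕ.+ i)) m)

  -- Cohn's congruence modulo v_e.

  cancel-∣ : ∀ {d a b c} → a ℕ.+ b ≡ c → d ∣ c → d ∣ b → d ∣ a
  cancel-∣ {d} {a} {b} refl d∣c d∣b = ∣m+n∣m⇒∣n (subst (d ∣_) (ℕ.+-comm a b) d∣c) d∣b

  -- For even e, u_(b+2e) ≡ -u_b modulo v_e; two such steps, a shift by 4e, restore the value. `sum`
  -- adds the two instances of `u-even`.
  u+1-shift : ∀ i b s → let e = i ℕ.+ i in v e ∣ u b ℕ.+ 1 → v e ∣ u (b ℕ.+ s ℕ.* ((e ℕ.+ e) ℕ.+ (e ℕ.+ e))) ℕ.+ 1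
  u+1-shift i b zero p rewrite ℕ.+-identityʳ b = p
  u+1-shift i b (suc s) p = subst (λ x → v e ∣ u x ℕ.+ 1) (index b s e)
      (cancel-∣ sum (∣m∣n⇒∣m+n (n∣m*n (u ((b′ ℕ.+ 2e) ℕ.+ e))) (u+1-shift i b s p)) (n∣m*n (u (b′ ℕ.+ e))))
    where
    e = i ℕ.+ i
    2e = e ℕ.+ e
    b′ = b ℕ.+ s ℕ.* (2e ℕ.+ 2e)
    index : ∀ b s e → ((b ℕ.+ s ℕ.* ((e ℕ.+ e) ℕ.+ (e ℕ.+ e))) ℕ.+ (e ℕ.+ e)) ℕ.+ (e ℕ.+ e) ≡ b ℕ.+ suc s ℕ.* ((e ℕ.+ e) ℕ.+ (e ℕ.+ e))
    index = ℕSolver.solve-∀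
    identity : ∀ a b c → a ℕ.+ 1 ℕ.+ (b ℕ.+ c) ≡ (a ℕ.+ b) ℕ.+ (c ℕ.+ 1)
    identity = ℕSolver.solve-∀
    sum : u ((b′ ℕ.+ 2e) ℕ.+ 2e) ℕ.+ 1 ℕ.+ u (b′ ℕ.+ e) ℕ.* v e ≡ u ((b′ ℕ.+ 2e) ℕ.+ e) ℕ.* v e ℕ.+ (u b′ ℕ.+ 1)
    sum = trans (cong (λ z → u ((b′ ℕ.+ 2e) ℕ.+ 2e) ℕ.+ 1 ℕ.+ z) (sym (u-even i b′)))
      (trans (identity (u ((b′ ℕ.+ 2e) ℕ.+ 2e)) (u (b′ ℕ.+ 2e)) (u b′)) (cong (ℕ._+ (u b′ ℕ.+ 1)) (u-even i (b′ ℕ.+ 2e))))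

  -- v_(2e) = v_e² - 2 for even e, and 3² - 2 ≡ 3 modulo 4.
  v-double-mod4 : ∀ i → v (i ℕ.+ i) % 4 ≡ 3 → v ((i ℕ.+ i) ℕ.+ (i ℕ.+ i)) % 4 ≡ 3
  v-double-mod4 i p = +2-cancel (v ((i ℕ.+ i) ℕ.+ (i ℕ.+ i))) (begin
    (v (e ℕ.+ e) ℕ.+ 2) % 4         ≡⟨ cong (_% 4) (v-even i 0) ⟩
    (v e ℕ.* v e) % 4               ≡⟨ %-distribˡ-* (v e) (v e) 4 ⟩
    (v e % 4 ℕ.* (v e % 4)) % 4     ≡⟨ cong (λ x → (x ℕ.* x) % 4) p ⟩
    1                               ∎)
    where
    open ≡-Reasoning
    e = i ℕ.+ i
    residue : ∀ r → r < 4 → (r ℕ.+ 2) % 4 ≡ 1 → r ≡ 3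
    residue 3 _ _ = refl
    residue (suc (suc (suc (suc _)))) (s≤s (s≤s (s≤s (s≤s ())))) _
    +2-cancel : ∀ x → (x ℕ.+ 2) % 4 ≡ 1 → x % 4 ≡ 3
    +2-cancel x q = residue (x % 4) (m%n<n x 4) (trans (sym (%-distribˡ-+ x 2 4)) q)

  -- Replaces being a power of two by the property of such i that matters, v_(2i) ≡ 3 modulo 4. The
  -- bound leaves room for the index 2i - 1.
  IsModulusIndex : ℕ → Set
  IsModulusIndex i = 1 ≤ i × v (i ℕ.+ i) % 4 ≡ 3

  module Odd (t-odd : t % 2 ≡ 1) where

    v₂-mod4 : v 2 % 4 ≡ 3
    v₂-mod4 with odd-form t t-odd
    ... | c , refl = trans (cong (_% 4) (identity c)) ([m+kn]%n≡m%n 3 (c ℕ.* c ℕ.+ c) 4)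
      where
      identity : ∀ c → suc (c ℕ.+ c) ℕ.* suc (c ℕ.+ c) ℕ.+ 2 ≡ 3 ℕ.+ (c ℕ.* c ℕ.+ c) ℕ.* 4
      identity = ℕSolver.solve-∀

    -- Halve l until it is odd; on the way back i doubles, and `v-double-mod4` carries the
    -- congruence along. It starts at i = 1 from v₂ = t² + 2 with t odd.
    two-adic : ∀ l → 1 ≤ l → ∃ λ i → ∃ λ s → IsModulusIndex i × l ≡ i ℕ.* suc (s ℕ.+ s)
    two-adic = <-rec _ descend
      where
      descend : ∀ l → (∀ {l′} → l′ < l → 1 ≤ l′ → ∃ λ i → ∃ λ s → IsModulusIndex i × l′ ≡ i ℕ.* suc (s ℕ.+ s)) →
        1 ≤ l → ∃ λ i → ∃ λ s → IsModulusIndex i × l ≡ i ℕ.* suc (s ℕ.+ s)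
      descend l rec 1≤l with even-or-odd l
      ... | s , inj₂ refl = 1 , s , (ℕ.≤-refl , v₂-mod4) , sym (ℕ.*-identityˡ _)
      ... | suc l′ , inj₁ refl with rec (s≤s (ℕ.m≤n+m (suc l′) l′)) (s≤s z≤n)
      ... | i , s , (1≤i , p) , q = i ℕ.+ i , s , (ℕ.≤-trans 1≤i (ℕ.m≤m+n i i) , v-double-mod4 i p) ,
              trans (cong₂ ℕ._+_ q q) (sym (ℕ.*-distribʳ-+ (suc (s ℕ.+ s)) i i))

    -- Cohn's congruence u_j ≡ -1 modulo some v_e ≡ 3 (mod 4), e a power of two with j = ±1 + 2e·odd.
    u+1-divisor : ∀ c → 1 ≤ c → ∃ λ N → N % 4 ≡ 3 × N ∣ u (suc (c ℕ.+ c)) ℕ.+ 1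
    u+1-divisor c 1≤c with even-or-odd c
    ... | l , inj₁ refl with two-adic l (positive l 1≤c)
      where
      positive : ∀ l → 1 ≤ l ℕ.+ l → 1 ≤ l
      positive (suc l) _ = s≤s z≤n
    -- The index is 4l + 1 = (1 + 2e) + 4es, and u_(1+2e) + u₁ is a multiple of v_e.
    ... | i , s , (_ , p) , refl = v e , p , subst (λ x → v e ∣ u x ℕ.+ 1) (index i s)
            (u+1-shift i (1 ℕ.+ (e ℕ.+ e)) s (subst (v e ∣_) (sym (u-even i 1)) (n∣m*n (u (1 ℕ.+ e)))))
      where
      e = i ℕ.+ i
      index : ∀ i s → let e = i ℕ.+ i ; l = i ℕ.* suc (s ℕ.+ s) in
        1 ℕ.+ (e ℕ.+ e) ℕ.+ s ℕ.* ((e ℕ.+ e) ℕ.+ (e ℕ.+ e)) ≡ suc ((l ℕ.+ l) ℕ.+ (l ℕ.+ l))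
      index = ℕSolver.solve-∀
    -- The index is now 4(l + 1) - 1 = (2e - 1) + 4es. The start 2e - 1 is written 1 + 2e′ with e′ =
    -- e - 1, and u_(2e-1) + u₁ = v_e u_(e-1).
    u+1-divisor c 1≤c | l , inj₂ refl with two-adic (suc l) (s≤s z≤n)
    ... | suc i , s , (_ , p) , q = v e , p , subst (λ x → v e ∣ u x ℕ.+ 1) index
            (u+1-shift (suc i) (1 ℕ.+ (e′ ℕ.+ e′)) s
              (subst (v e ∣_) (sym (u-odd′ i 1)) (subst (λ x → v x ∣ v (1 ℕ.+ e′) ℕ.* u e′) e≡ (m∣m*n (u e′)))))
      where
      e = suc i ℕ.+ suc i
      e′ = suc (i ℕ.+ i)
      e≡ : 1 ℕ.+ e′ ≡ e
      e≡ = cong suc (sym (ℕ.+-suc i i))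
      identity₁ : ∀ i s → let e = suc i ℕ.+ suc i ; e′ = suc (i ℕ.+ i) ; L = suc i ℕ.* suc (s ℕ.+ s) in
        suc (1 ℕ.+ (e′ ℕ.+ e′) ℕ.+ s ℕ.* ((e ℕ.+ e) ℕ.+ (e ℕ.+ e))) ≡ (L ℕ.+ L) ℕ.+ (L ℕ.+ L)
      identity₁ = ℕSolver.solve-∀
      identity₂ : ∀ l → let L = suc l ; c = suc (l ℕ.+ l) in (L ℕ.+ L) ℕ.+ (L ℕ.+ L) ≡ suc (suc (c ℕ.+ c))
      identity₂ = ℕSolver.solve-∀
      index : 1 ℕ.+ (e′ ℕ.+ e′) ℕ.+ s ℕ.* ((e ℕ.+ e) ℕ.+ (e ℕ.+ e)) ≡ suc (suc (l ℕ.+ l) ℕ.+ suc (l ℕ.+ l))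
      index = ℕ.suc-injective (trans (identity₁ i s) (trans (cong (λ L → (L ℕ.+ L) ℕ.+ (L ℕ.+ L)) (sym q)) (identity₂ l)))

-- Descent: f may be taken even with f < N, and then the cofactor of N in f² + 1 is
-- smaller than N and again 3 modulo 4.
no-root-of-minus-one : ∀ N → N % 4 ≡ 3 → ∀ f → ¬ (N ∣ f ℕ.* f ℕ.+ 1)
no-root-of-minus-one = <-rec _ descend
  where
  cofactor-residue : ∀ r → r < 4 → (3 ℕ.* r) % 4 ≡ 1 → r ≡ 3
  cofactor-residue 3 _ _ = refl
  cofactor-residue (suc (suc (suc (suc _)))) (s≤s (s≤s (s≤s (s≤s ())))) _

  descend : ∀ N → (∀ {N′} → N′ < N → N′ % 4 ≡ 3 → ∀ f → ¬ (N′ ∣ f ℕ.* f ℕ.+ 1)) →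
    N % 4 ≡ 3 → ∀ f → ¬ (N ∣ f ℕ.* f ℕ.+ 1)
  descend N@(suc N₀) rec N≡3 f N∣ = reduced (even-or-odd g)
    where
    even-case : ∀ i → i ℕ.+ i < N → ¬ (N ∣ (i ℕ.+ i) ℕ.* (i ℕ.+ i) ℕ.+ 1)
    even-case i x<N (divides q x²+1≡) = rec q<N q≡3 x (divides N (trans x²+1≡ (ℕ.*-comm q N)))
      where
      x = i ℕ.+ i
      identity : ∀ i → (i ℕ.+ i) ℕ.* (i ℕ.+ i) ℕ.+ 1 ≡ 1 ℕ.+ (i ℕ.* i) ℕ.* 4
      identity = ℕSolver.solve-∀
      q≡3 : q % 4 ≡ 3
      q≡3 = cofactor-residue (q % 4) (m%n<n q 4) (begin
        (3 ℕ.* (q % 4)) % 4               ≡⟨ cong (λ r → (r ℕ.* (q % 4)) % 4) (sym N≡3) ⟩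
        (N % 4 ℕ.* (q % 4)) % 4           ≡⟨ %-distribˡ-* N q 4 ⟨
        (N ℕ.* q) % 4                     ≡⟨ cong (_% 4) (trans (ℕ.*-comm N q) (sym x²+1≡)) ⟩
        (x ℕ.* x ℕ.+ 1) % 4               ≡⟨ cong (_% 4) (identity i) ⟩
        (1 ℕ.+ (i ℕ.* i) ℕ.* 4) % 4       ≡⟨ [m+kn]%n≡m%n 1 (i ℕ.* i) 4 ⟩
        1                                 ∎)
        where open ≡-Reasoning
      0<N₀ : 0 < N₀
      0<N₀ = positive N₀ N≡3
        where
        positive : ∀ N₀ → suc N₀ % 4 ≡ 3 → 0 < N₀
        positive (suc _) _ = s≤s z≤n
      q<N : q < N
      q<N = ℕ.*-cancelʳ-< N q N (begin-strict
        q ℕ.* N                     ≡⟨ x²+1≡ ⟨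
        x ℕ.* x ℕ.+ 1               ≤⟨ ℕ.+-monoˡ-≤ 1 (ℕ.*-mono-≤ (ℕ.≤-pred x<N) (ℕ.≤-pred x<N)) ⟩
        N₀ ℕ.* N₀ ℕ.+ 1             <⟨ ℕ.m<m+n (N₀ ℕ.* N₀ ℕ.+ 1) (ℕ.≤-trans 0<N₀ (ℕ.m≤m+n N₀ N₀)) ⟩
        N₀ ℕ.* N₀ ℕ.+ 1 ℕ.+ (N₀ ℕ.+ N₀)  ≡⟨ square N₀ ⟩
        N ℕ.* N                     ∎)
        where
        open ℕ.≤-Reasoning
        square : ∀ a → a ℕ.* a ℕ.+ 1 ℕ.+ (a ℕ.+ a) ≡ suc a ℕ.* suc a
        square = ℕSolver.solve-∀
    g = f % N
    N∣g²+1 : N ∣ g ℕ.* g ℕ.+ 1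
    N∣g²+1 = ∣m+n∣m⇒∣n (subst (N ∣_)
      (trans (cong (λ y → y ℕ.* y ℕ.+ 1) (m≡m%n+[m/n]*n f N)) (identity g (f / N) N)) N∣)
      (n∣m*n ((f / N) ℕ.* ((f / N) ℕ.* N) ℕ.+ (g ℕ.+ g) ℕ.* (f / N)))
      where
      identity : ∀ g q N → (g ℕ.+ q ℕ.* N) ℕ.* (g ℕ.+ q ℕ.* N) ℕ.+ 1 ≡ (q ℕ.* (q ℕ.* N) ℕ.+ (g ℕ.+ g) ℕ.* q) ℕ.* N ℕ.+ (g ℕ.* g ℕ.+ 1)
      identity = ℕSolver.solve-∀
    N-odd : N % 2 ≡ 1
    N-odd = trans (cong (_% 2) (m≡m%n+[m/n]*n N 4)) (trans (cong (λ r → (r ℕ.+ (N / 4) ℕ.* 4) % 2) N≡3)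
      (trans (cong (λ z → (3 ℕ.+ z) % 2) (sym (ℕ.*-assoc (N / 4) 2 2))) ([m+kn]%n≡m%n 3 ((N / 4) ℕ.* 2) 2)))
    reduced : (∃ λ i → g ≡ i ℕ.+ i ⊎ g ≡ suc (i ℕ.+ i)) → ⊥
    reduced (i , inj₁ g≡) = even-case i (subst (_< N) g≡ (m%n<n f N)) (subst (λ z → N ∣ z ℕ.* z ℕ.+ 1) g≡ N∣g²+1)
    -- For odd g, N - g = 2(c - i) is even, below N, and has the same square as g modulo N.
    reduced (i , inj₂ g≡) with odd-form N N-odd
    ... | c , N≡ with ℕ.m≤n⇒∃[o]m+o≡n i≤c
      where
      i≤c : i ≤ c
      i≤c = ℕ.≮⇒≥ λ c<i → ℕ.<-asym (ℕ.+-mono-< c<i c<i) (ℕ.≤-pred (ℕ.≤-trans (s≤s (ℕ.≤-reflexive (sym g≡))) (ℕ.≤-trans (m%n<n f N) (ℕ.≤-reflexive N≡))))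
    ... | k , refl = even-case k (subst (k ℕ.+ k <_) (sym N≡) (s≤s (ℕ.+-mono-≤ (ℕ.m≤n+m k i) (ℕ.m≤n+m k i))))
        (∣m+n∣m⇒∣n (subst (N ∣_) (trans (identity i k) (cong (λ z → (suc (i ℕ.+ i) ℕ.+ suc (i ℕ.+ i)) ℕ.* z ℕ.+ ((k ℕ.+ k) ℕ.* (k ℕ.+ k) ℕ.+ 1)) (sym N≡)))
            (∣m∣n⇒∣m+n (subst (λ z → N ∣ z ℕ.* z) N≡ (m∣m*n N)) (subst (λ z → N ∣ z ℕ.* z ℕ.+ 1) g≡ N∣g²+1)))
          (n∣m*n (suc (i ℕ.+ i) ℕ.+ suc (i ℕ.+ i))))
      where
      identity : ∀ i k → let N = suc ((i ℕ.+ k) ℕ.+ (i ℕ.+ k)) ; g = suc (i ℕ.+ i) in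
        N ℕ.* N ℕ.+ (g ℕ.* g ℕ.+ 1) ≡ (g ℕ.+ g) ℕ.* N ℕ.+ ((k ℕ.+ k) ℕ.* (k ℕ.+ k) ℕ.+ 1)
      identity = ℕSolver.solve-∀

-- Square values of u_k, and the odd indices k with d dividing u_k.

module LucasConsequences (t : ℕ) where
  open Lucas t

  square-odd-index : t % 2 ≡ 1 → ∀ k → k % 2 ≡ 1 → ∀ f → u k ≡ f ℕ.* f → k ≡ 1
  square-odd-index t-odd k k-odd f uk≡ with odd-form k k-odd
  ... | zero , k≡ = k≡
  ... | suc c , refl with Odd.u+1-divisor t-odd (suc c) (s≤s z≤n)
  ... | N , N≡3 , N∣ = ⊥-elim (no-root-of-minus-one N N≡3 f (subst (λ x → N ∣ x ℕ.+ 1) uk≡ N∣))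

  module Rank (d r : ℕ) (r-odd : r % 2 ≡ 1) (d∣ur : d ∣ u r)
    (minimal : ∀ s → s % 2 ≡ 1 → s < r → ¬ (d ∣ u s)) where

    -- Subtracting 2r from j, or reflecting j = r + i to r - i, keeps the index odd and preserves
    -- divisibility by d. Parity must be kept because r is minimal only among odd indices.
    odd-multiple : ∀ j → j % 2 ≡ 1 → d ∣ u j → ∃ λ q → j ≡ r ℕ.+ q ℕ.* (r ℕ.+ r)
    odd-multiple = <-rec _ descend
      where
      r′ : ∃ λ i → r ≡ suc (i ℕ.+ i)
      r′ = odd-form r r-odd
      difference-even : ∀ i → (r ℕ.+ i) % 2 ≡ 1 → ∃ λ l → i ≡ l ℕ.+ l
      difference-even i p with even-or-odd i
      ... | l , inj₁ q = l , q
      ... | l , inj₂ refl with trans (sym p) (trans (cong (_% 2) (ℕ.+-suc r (l ℕ.+ l)))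
              (trans (double%2 (suc r) l) (trans (%-distribˡ-+ 1 r 2) (cong (λ x → (1 ℕ.+ x) % 2) r-odd))))
      ... | ()
      descend : ∀ j → (∀ {j′} → j′ < j → j′ % 2 ≡ 1 → d ∣ u j′ → ∃ λ q → j′ ≡ r ℕ.+ q ℕ.* (r ℕ.+ r)) →
        j % 2 ≡ 1 → d ∣ u j → ∃ λ q → j ≡ r ℕ.+ q ℕ.* (r ℕ.+ r)
      descend j rec j-odd d∣uj with ℕ.<-cmp j r
      ... | tri< j<r _ _ = ⊥-elim (minimal j j-odd j<r d∣uj)
      ... | tri≈ _ refl _ = 0 , sym (ℕ.+-identityʳ r)
      ... | tri> _ _ r<j with ℕ.m≤n⇒∃[o]m+o≡n (ℕ.<⇒≤ r<j)
      ... | i , refl with ℕ.<-cmp i r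
      descend j rec j-odd d∣uj | tri> _ _ r<j | i , refl | tri≈ _ refl _ with trans (sym j-odd) (double%2 0 r)
      ... | ()
      -- Here x = r - i and i is even, so u_j + u_x = u_r v_i; the odd index x < r contradicts
      -- minimality.
      descend j rec j-odd d∣uj | tri> _ _ r<j | i , refl | tri< i<r _ _ with ℕ.m≤n⇒∃[o]m+o≡n (ℕ.<⇒≤ i<r)
      ... | x , i+x≡r = ⊥-elim (minimal x x-odd x<r d∣ux)
        where
        j≡ : r ℕ.+ i ≡ x ℕ.+ (i ℕ.+ i)
        j≡ = trans (cong (ℕ._+ i) (trans (sym i+x≡r) (ℕ.+-comm i x))) (ℕ.+-assoc x i i)
        x-odd : x % 2 ≡ 1
        x-odd = trans (sym (double%2 x i)) (trans (cong (_% 2) (sym j≡)) j-odd)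
        x<r : x < r
        x<r = subst (x <_) i+x≡r (ℕ.m<n+m x (ℕ.+-cancelˡ-< r 0 i (subst (_< r ℕ.+ i) (sym (ℕ.+-identityʳ r)) r<j)))
        d∣ux : d ∣ u x
        d∣ux with difference-even i j-odd
        ... | l , refl = cancel-∣ (trans (ℕ.+-comm (u x) _) (u-even l x))
                (∣m⇒∣m*n (v (l ℕ.+ l)) (subst (λ y → d ∣ u y) (trans (sym i+x≡r) (ℕ.+-comm _ x)) d∣ur))
                (subst (λ y → d ∣ u y) j≡ d∣uj)
      -- Here j = x + 2r with r odd, and u_j + u_x = v_(x+r) u_r.
      descend j rec j-odd d∣uj | tri> _ _ r<j | i , refl | tri> _ _ r<i with ℕ.m≤n⇒∃[o]m+o≡n (ℕ.<⇒≤ r<i)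
      ... | x , refl = suc (proj₁ ih) , trans (cong (λ y → r ℕ.+ (r ℕ.+ y)) (proj₂ ih)) (index r (proj₁ ih))
        where
        reorder : ∀ r x → r ℕ.+ (r ℕ.+ x) ≡ x ℕ.+ (r ℕ.+ r)
        reorder = ℕSolver.solve-∀
        index : ∀ r q → r ℕ.+ (r ℕ.+ (r ℕ.+ q ℕ.* (r ℕ.+ r))) ≡ r ℕ.+ suc q ℕ.* (r ℕ.+ r)
        index = ℕSolver.solve-∀
        x-odd : x % 2 ≡ 1
        x-odd = trans (sym (double%2 x r)) (trans (cong (_% 2) (sym (reorder r x))) j-odd)
        u-reflect : u (x ℕ.+ (r ℕ.+ r)) ℕ.+ u x ≡ v (x ℕ.+ r) ℕ.* u r
        u-reflect = subst (λ r → u (x ℕ.+ (r ℕ.+ r)) ℕ.+ u x ≡ v (x ℕ.+ r) ℕ.* u r) (sym (proj₂ r′)) (u-odd′ (proj₁ r′) x)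
        d∣ux : d ∣ u x
        d∣ux = cancel-∣ (trans (ℕ.+-comm (u x) _) u-reflect) (∣n⇒∣m*n (v (x ℕ.+ r)) d∣ur)
          (subst (λ y → d ∣ u y) (reorder r x) d∣uj)
        x<j : x < r ℕ.+ (r ℕ.+ x)
        x<j = ℕ.≤-trans (ℕ.m<n+m x (subst (0 <_) (sym (proj₂ r′)) (s≤s z≤n))) (ℕ.m≤n+m (r ℕ.+ x) r)
        ih = rec x<j x-odd d∣ux

    -- For odd r, passing from index m to m + 2r adds u_(m+r) v_r without a change of sign, so u is
    -- constant modulo v_r along the odd multiples of r.
    u-odd-multiple : ∀ q → ∃ λ c → u (r ℕ.+ q ℕ.* (r ℕ.+ r)) ≡ u r ℕ.+ c ℕ.* v r
    u-odd-multiple zero = 0 , trans (cong u (ℕ.+-identityʳ r)) (sym (ℕ.+-identityʳ (u r)))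
    u-odd-multiple (suc q) with odd-form r r-odd | u-odd-multiple q
    ... | i , refl | c , ih = c ℕ.+ u (m ℕ.+ r) , trans (cong u (index r q))
            (trans (u-odd i m) (trans (cong (ℕ._+ u (m ℕ.+ r) ℕ.* v r) ih) (collect (u r) c (u (m ℕ.+ r)) (v r))))
      where
      m = r ℕ.+ q ℕ.* (r ℕ.+ r)
      index : ∀ r q → r ℕ.+ suc q ℕ.* (r ℕ.+ r) ≡ (r ℕ.+ q ℕ.* (r ℕ.+ r)) ℕ.+ (r ℕ.+ r)
      index = ℕSolver.solve-∀
      collect : ∀ a c x v → a ℕ.+ c ℕ.* v ℕ.+ x ℕ.* v ≡ a ℕ.+ (c ℕ.+ x) ℕ.* v
      collect = ℕSolver.solve-∀

-- The numbers m² + 16: squares among them, and residues modulo 32.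

square+16-square : ∀ m e → 1 ≤ m → e ℕ.* e ≡ m ℕ.* m ℕ.+ 16 → m ≡ 3
square+16-square m e 1≤m ee≡ with ℕ.m≤n⇒∃[o]m+o≡n {m} {e} m≤e
  where
  m≤e : m ≤ e
  m≤e = ℕ.≮⇒≥ λ e<m → ℕ.<⇒≱ (ℕ.*-mono-< e<m e<m) (subst (m ℕ.* m ≤_) (sym ee≡) (ℕ.m≤m+n (m ℕ.* m) 16))
... | g , refl = difference m g 1≤m (ℕ.+-cancelˡ-≡ (m ℕ.* m) _ _ (trans (sym (expand m g)) ee≡))
  where
  expand : ∀ m g → (m ℕ.+ g) ℕ.* (m ℕ.+ g) ≡ m ℕ.* m ℕ.+ g ℕ.* (m ℕ.+ m ℕ.+ g)
  expand = ℕSolver.solve-∀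
  odd : ∀ x → 1 ℕ.+ x ℕ.* 2 ≡ 16 → ⊥
  odd x p with trans (sym ([m+kn]%n≡m%n 1 x 2)) (cong (_% 2) p)
  ... | ()
  -- With g = e - m: g = 1 and g = 3 make the product odd, g = 2 gives m = 3, and g ≥ 4 with m ≥ 1
  -- makes it at least 24.
  difference : ∀ m g → 1 ≤ m → g ℕ.* (m ℕ.+ m ℕ.+ g) ≡ 16 → m ≡ 3
  difference m 1 _ p = ⊥-elim (odd m (trans (identity m) p))
    where
    identity : ∀ m → 1 ℕ.+ m ℕ.* 2 ≡ 1 ℕ.* (m ℕ.+ m ℕ.+ 1)
    identity = ℕSolver.solve-∀
  difference m 2 _ p = ℕ.*-cancelˡ-≡ m 3 4 (ℕ.+-cancelʳ-≡ 4 (4 ℕ.* m) 12 (trans (identity m) p))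
    where
    identity : ∀ m → 4 ℕ.* m ℕ.+ 4 ≡ 2 ℕ.* (m ℕ.+ m ℕ.+ 2)
    identity = ℕSolver.solve-∀
  difference m 3 _ p = ⊥-elim (odd (3 ℕ.* m ℕ.+ 4) (trans (identity m) p))
    where
    identity : ∀ m → 1 ℕ.+ (3 ℕ.* m ℕ.+ 4) ℕ.* 2 ≡ 3 ℕ.* (m ℕ.+ m ℕ.+ 3)
    identity = ℕSolver.solve-∀
  difference (suc m) (suc (suc (suc (suc g)))) _ p = ⊥-elim (ℕ.<⇒≢ bound (sym p))
    where
    g′ = 4 ℕ.+ g
    bound : 16 < g′ ℕ.* (suc m ℕ.+ suc m ℕ.+ g′)
    bound = ℕ.≤-trans (ℕ.m≤m+n 17 7) (ℕ.*-mono-≤ {4} {g′} {6} (ℕ.m≤m+n 4 g)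
      (ℕ.+-mono-≤ {2} {suc m ℕ.+ suc m} {4} (ℕ.+-mono-≤ {1} {suc m} {1} (s≤s z≤n) (s≤s z≤n)) (ℕ.m≤m+n 4 g)))

residue-of-square+16 : ∀ n m → .{{_ : NonZero m}} → (n ℕ.* n ℕ.+ 16) % m ≡ ((n % m) ℕ.* (n % m) ℕ.+ 16) % m
residue-of-square+16 n m = begin
  (n ℕ.* n ℕ.+ 16) % m                              ≡⟨ %-distribˡ-+ (n ℕ.* n) 16 m ⟩
  ((n ℕ.* n) % m ℕ.+ 16 % m) % m                    ≡⟨ cong (λ x → (x ℕ.+ 16 % m) % m) (%-distribˡ-* n n m) ⟩
  ((n % m ℕ.* (n % m)) % m ℕ.+ 16 % m) % m          ≡⟨ %-distribˡ-+ (n % m ℕ.* (n % m)) 16 m ⟨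
  (n % m ℕ.* (n % m) ℕ.+ 16) % m                    ∎
  where open ≡-Reasoning

via-residues : ∀ {P : ℕ → Set} → (∀ (i : Fin 32) → P (toℕ i)) → ∀ n → P (n % 32)
via-residues {P} all n = subst P (toℕ-fromℕ< (m%n<n n 32)) (all (fromℕ< (m%n<n n 32)))

-- 20 = 4 · 5, and 5 is not a square modulo 8; the proof simply runs through all residues.
square-mod32 : ∀ x → (x ℕ.* x) % 32 ≢ 20
square-mod32 x p = via-residues {λ r → (r ℕ.* r) % 32 ≢ 20}
  (from-yes (all? {n = 32} λ i → ¬? ((toℕ i ℕ.* toℕ i) % 32 ℕ.≟ 20))) x (trans (sym (%-distribˡ-* x x 32)) p)

square+16-mod32 : ∀ n → n % 4 ≡ 2 → (n ℕ.* n ℕ.+ 16) % 32 ≡ 20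
square+16-mod32 n p = trans (residue-of-square+16 n 32)
  (via-residues {λ r → r % 4 ≡ 2 → (r ℕ.* r ℕ.+ 16) % 32 ≡ 20}
    (from-yes (all? {n = 32} λ i → (toℕ i % 4 ℕ.≟ 2) →-dec ((toℕ i ℕ.* toℕ i ℕ.+ 16) % 32 ℕ.≟ 20))) n
    (trans (m∣n⇒o%n%m≡o%m 4 32 n (divides 8 refl)) p))

-- m² ≡ 1 modulo 8 and 20 · 8 ≡ 0 modulo 32, so the product is 20 · 17 ≡ 20.
odd-square+16-mod32 : ∀ m → m % 2 ≡ 1 → (20 ℕ.* ((m ℕ.* m ℕ.+ 16) % 32)) % 32 ≡ 20
odd-square+16-mod32 m p = trans (cong (λ x → (20 ℕ.* x) % 32) (residue-of-square+16 m 32))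
  (via-residues {λ r → r % 2 ≡ 1 → (20 ℕ.* ((r ℕ.* r ℕ.+ 16) % 32)) % 32 ≡ 20}
    (from-yes (all? {n = 32} λ i → (toℕ i % 2 ℕ.≟ 1) →-dec ((20 ℕ.* ((toℕ i ℕ.* toℕ i ℕ.+ 16) % 32)) % 32 ℕ.≟ 20))) m
    (trans (m∣n⇒o%n%m≡o%m 2 32 m (divides 16 refl)) p))

-- (n² + 16)(m² + 16) = (d y e)² is a square, but it is 20 modulo 32 for odd m.
even-conductor : ∀ {n m y e d} → n % 4 ≡ 2 → n ℕ.* n ℕ.+ 16 ≡ y ℕ.* y ℕ.* d → d ℕ.* (e ℕ.* e) ≡ m ℕ.* m ℕ.+ 16 →
  ∃ λ a → m ≡ a ℕ.+ a
even-conductor {n} {m} {y} {e} {d} n≡2 n²≡ m²≡ with even-or-odd m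
... | a , inj₁ m≡ = a , m≡
... | a , inj₂ refl = ⊥-elim (square-mod32 (d ℕ.* y ℕ.* e) (begin
  (d ℕ.* y ℕ.* e ℕ.* (d ℕ.* y ℕ.* e)) % 32
    ≡⟨ cong (_% 32) (trans (identity d y e) (cong₂ ℕ._*_ (sym n²≡) m²≡)) ⟩
  ((n ℕ.* n ℕ.+ 16) ℕ.* (m ℕ.* m ℕ.+ 16)) % 32
    ≡⟨ %-distribˡ-* (n ℕ.* n ℕ.+ 16) (m ℕ.* m ℕ.+ 16) 32 ⟩
  ((n ℕ.* n ℕ.+ 16) % 32 ℕ.* ((m ℕ.* m ℕ.+ 16) % 32)) % 32
    ≡⟨ cong (λ x → (x ℕ.* ((m ℕ.* m ℕ.+ 16) % 32)) % 32) (square+16-mod32 n n≡2) ⟩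
  (20 ℕ.* ((m ℕ.* m ℕ.+ 16) % 32)) % 32
    ≡⟨ odd-square+16-mod32 m (double%2 1 a) ⟩
  20 ∎))
  where
  open ≡-Reasoning
  identity : ∀ d y e → d ℕ.* y ℕ.* e ℕ.* (d ℕ.* y ℕ.* e) ≡ y ℕ.* y ℕ.* d ℕ.* (d ℕ.* (e ℕ.* e))
  identity = ℕSolver.solve-∀

-- For odd e, e² ≡ 1 modulo 4, so 4 would divide the squarefree d.
even-cofactor : ∀ {d e x} → SquareFree d → d ℕ.* (e ℕ.* e) ≡ x ℕ.* 4 → ∃ λ b → e ≡ b ℕ.+ b
even-cofactor {d} {e} {x} (_ , squarefree) p with even-or-odd e
... | b , inj₁ e≡ = b , e≡
... | b , inj₂ refl with squarefree 2 (m%n≡0⇒n∣m d 4 (trans (sym residue) (trans (cong (_% 4) p) (m*n%n≡0 x 4))))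
  where
  expand : ∀ d b → d ℕ.* (suc (b ℕ.+ b) ℕ.* suc (b ℕ.+ b)) ≡ d ℕ.+ d ℕ.* (b ℕ.* b ℕ.+ b) ℕ.* 4
  expand = ℕSolver.solve-∀
  residue : (d ℕ.* (e ℕ.* e)) % 4 ≡ d % 4
  residue = trans (cong (_% 4) (expand d b)) ([m+kn]%n≡m%n d (d ℕ.* (b ℕ.* b ℕ.+ b)) 4)
... | ()

-- Units of norm -1 as odd powers of ε.

module LucasNorm (t : ℕ) where
  open Lucas t

  v≡tu+2u : ∀ k → v (suc k) ≡ t ℕ.* u (suc k) ℕ.+ (u k ℕ.+ u k)
  v≡tu+2u k = trans (v≡u+u k) (ℕ.+-assoc (t ℕ.* u (suc k)) (u k) (u k))

  2u≡v+tu : ∀ k → u (suc k) ℕ.+ u (suc k) ≡ v k ℕ.+ t ℕ.* u k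
  2u≡v+tu zero = cong (2 ℕ.+_) (sym (ℕ.*-zeroʳ t))
  2u≡v+tu (suc k) = trans (identity t (u (suc k)) (u k)) (cong (ℕ._+ t ℕ.* u (suc k)) (sym (v≡tu+2u k)))
    where
    identity : ∀ t a b → (t ℕ.* a ℕ.+ b) ℕ.+ (t ℕ.* a ℕ.+ b) ≡ (t ℕ.* a ℕ.+ (b ℕ.+ b)) ℕ.+ t ℕ.* a
    identity = ℕSolver.solve-∀

  cassini : ∀ k → U (suc k) ℤ.* U (suc k) ℤ.- + t ℤ.* U (suc k) ℤ.* U k ℤ.- U k ℤ.* U k ≡ sgn k
  cassini zero = identity (+ t)
    where
    identity : ∀ t → + 1 ℤ.* + 1 ℤ.- t ℤ.* + 1 ℤ.* + 0 ℤ.- + 0 ℤ.* + 0 ≡ + 1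
    identity = ℤSolver.solve-∀
  cassini (suc k) = trans (cong (λ x → x ℤ.* x ℤ.- + t ℤ.* x ℤ.* U (suc k) ℤ.- U (suc k) ℤ.* U (suc k)) (U-recurrent k))
    (trans (identity (+ t) (U (suc k)) (U k)) (cong ℤ.-_ (cassini k)))
    where
    identity : ∀ t a b → (t ℤ.* a ℤ.+ b) ℤ.* (t ℤ.* a ℤ.+ b) ℤ.- t ℤ.* (t ℤ.* a ℤ.+ b) ℤ.* a ℤ.- a ℤ.* a
      ≡ ℤ.- (a ℤ.* a ℤ.- t ℤ.* a ℤ.* b ℤ.- b ℤ.* b)
    identity = ℤSolver.solve-∀

  norm-even : ∀ i → let k = i ℕ.+ i in v k ℕ.* v k ≡ u k ℕ.* u k ℕ.* (t ℕ.* t ℕ.+ 4) ℕ.+ 4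
  norm-even zero = refl
  norm-even (suc i) = ℤ.+-injective (begin
    + (v (suc k) ℕ.* v (suc k))                          ≡⟨ ℤ.pos-* (v (suc k)) (v (suc k)) ⟩
    V (suc k) ℤ.* V (suc k)                              ≡⟨ cong (λ x → x ℤ.* x) V≡ ⟩
    (+ t ℤ.* a ℤ.+ (b ℤ.+ b)) ℤ.* (+ t ℤ.* a ℤ.+ (b ℤ.+ b))   ≡⟨ identity (+ t) a b ⟩
    a ℤ.* a ℤ.* (+ t ℤ.* + t ℤ.+ + 4) ℤ.- + 4 ℤ.* (a ℤ.* a ℤ.- + t ℤ.* a ℤ.* b ℤ.- b ℤ.* b)
      ≡⟨ cong (λ x → a ℤ.* a ℤ.* (+ t ℤ.* + t ℤ.+ + 4) ℤ.- + 4 ℤ.* x) (trans (cassini k) sgn≡) ⟩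
    a ℤ.* a ℤ.* (+ t ℤ.* + t ℤ.+ + 4) ℤ.+ + 4            ≡⟨ cong (ℤ._+ + 4) cast ⟩
    + (u (suc k) ℕ.* u (suc k) ℕ.* (t ℕ.* t ℕ.+ 4) ℕ.+ 4)  ∎)
    where
    open ≡-Reasoning
    k = i ℕ.+ suc i
    a = U (suc k)
    b = U k
    sgn≡ : sgn k ≡ ℤ.- + 1
    sgn≡ = trans (cong sgn (ℕ.+-suc i i)) (cong ℤ.-_ (sgn-even i))
    V≡ : V (suc k) ≡ + t ℤ.* a ℤ.+ (b ℤ.+ b)
    V≡ = trans (cong +_ (v≡tu+2u k)) (cong (ℤ._+ (b ℤ.+ b)) (ℤ.pos-* t (u (suc k))))
    cast : a ℤ.* a ℤ.* (+ t ℤ.* + t ℤ.+ + 4) ≡ + (u (suc k) ℕ.* u (suc k) ℕ.* (t ℕ.* t ℕ.+ 4))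
    cast = sym (trans (ℤ.pos-* (u (suc k) ℕ.* u (suc k)) (t ℕ.* t ℕ.+ 4))
      (cong₂ ℤ._*_ (ℤ.pos-* (u (suc k)) (u (suc k))) (cong (ℤ._+ + 4) (ℤ.pos-* t t))))
    identity : ∀ t a b → (t ℤ.* a ℤ.+ (b ℤ.+ b)) ℤ.* (t ℤ.* a ℤ.+ (b ℤ.+ b))
      ≡ a ℤ.* a ℤ.* (t ℤ.* t ℤ.+ + 4) ℤ.- + 4 ℤ.* (a ℤ.* a ℤ.- t ℤ.* a ℤ.* b ℤ.- b ℤ.* b)
    identity = ℤSolver.solve-∀

  -- For even k, `norm-even` gives the value +4 instead of -4, and the two equations differ by 8.
  norm-minus-four⇒odd : ∀ k → v k ℕ.* v k ℕ.+ 4 ≡ u k ℕ.* u k ℕ.* (t ℕ.* t ℕ.+ 4) → ∃ λ j → k ≡ suc (j ℕ.+ j)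
  norm-minus-four⇒odd k p with even-or-odd k
  ... | j , inj₂ q = j , q
  ... | j , inj₁ refl = ⊥-elim (ℕ.m≢1+m+n _ (trans (sym p) (trans (cong (ℕ._+ 4) (norm-even j)) (identity _))))
    where
    identity : ∀ x → x ℕ.+ 4 ℕ.+ 4 ≡ suc (x ℕ.+ 7)
    identity = ℕSolver.solve-∀

  module PowerCoefficients (y d : ℕ) (t²+4 : (t ℕ.+ t) ℕ.* (t ℕ.+ t) ℕ.+ 16 ≡ y ℕ.* y ℕ.* d) where
    n = t ℕ.+ t

    A B : ℕ → ℕ
    A zero = 1
    A (suc k) = n ℕ.* A k ℕ.+ d ℕ.* y ℕ.* B k
    B zero = 0
    B (suc k) = y ℕ.* A k ℕ.+ n ℕ.* B k

    powA≡ : ∀ k → powA n y d k ≡ + A k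
    powB≡ : ∀ k → powB n y d k ≡ + B k
    powA≡ zero = refl
    powA≡ (suc k) = trans (cong₂ (λ a b → + n ℤ.* a ℤ.+ + d ℤ.* + y ℤ.* b) (powA≡ k) (powB≡ k))
      (cong₂ ℤ._+_ (sym (ℤ.pos-* n (A k)))
        (trans (cong (ℤ._* + B k) (sym (ℤ.pos-* d y))) (sym (ℤ.pos-* (d ℕ.* y) (B k)))))
    powB≡ zero = refl
    powB≡ (suc k) = trans (cong₂ (λ a b → + y ℤ.* a ℤ.+ + n ℤ.* b) (powA≡ k) (powB≡ k))
      (cong₂ ℤ._+_ (sym (ℤ.pos-* y (A k))) (sym (ℤ.pos-* n (B k))))

    -- Compares ε^k = (A + B√d)/4^k with 2ε^k = v_k + u_k (y/2)√d. Each recursion step needs both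
    -- coordinate formulas, hence the mutual induction.
    2A≡4ᵏv : ∀ k → 2 ℕ.* A k ≡ 4 ℕ.^ k ℕ.* v k
    4B≡4ᵏuy : ∀ k → 4 ℕ.* B k ≡ 4 ℕ.^ k ℕ.* (u k ℕ.* y)
    2A≡4ᵏv zero = refl
    2A≡4ᵏv (suc k) = ℕ.*-cancelˡ-≡ _ _ 2 (begin
      2 ℕ.* (2 ℕ.* (n ℕ.* A k ℕ.+ d ℕ.* y ℕ.* B k))
        ≡⟨ identity₁ n d y (A k) (B k) ⟩
      2 ℕ.* (n ℕ.* (2 ℕ.* A k)) ℕ.+ d ℕ.* y ℕ.* (4 ℕ.* B k)
        ≡⟨ cong₂ (λ a b → 2 ℕ.* (n ℕ.* a) ℕ.+ d ℕ.* y ℕ.* b) (2A≡4ᵏv k) (4B≡4ᵏuy k) ⟩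
      2 ℕ.* (n ℕ.* (q ℕ.* v k)) ℕ.+ d ℕ.* y ℕ.* (q ℕ.* (u k ℕ.* y))
        ≡⟨ identity₂ n d y q (u k) (v k) ⟩
      q ℕ.* (2 ℕ.* (n ℕ.* v k) ℕ.+ u k ℕ.* (y ℕ.* y ℕ.* d))
        ≡⟨ cong (λ x → q ℕ.* (2 ℕ.* (n ℕ.* v k) ℕ.+ u k ℕ.* x)) (sym t²+4) ⟩
      q ℕ.* (2 ℕ.* (n ℕ.* v k) ℕ.+ u k ℕ.* (n ℕ.* n ℕ.+ 16))
        ≡⟨ identity₃ t q (u k) (v k) ⟩
      q ℕ.* (4 ℕ.* (t ℕ.* (v k ℕ.+ t ℕ.* u k) ℕ.+ 4 ℕ.* u k))
        ≡⟨ cong (λ x → q ℕ.* (4 ℕ.* (t ℕ.* x ℕ.+ 4 ℕ.* u k))) (sym (2u≡v+tu k)) ⟩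
      q ℕ.* (4 ℕ.* (t ℕ.* (u (suc k) ℕ.+ u (suc k)) ℕ.+ 4 ℕ.* u k))
        ≡⟨ identity₄ t q (u (suc k)) (u k) ⟩
      2 ℕ.* (4 ℕ.* q ℕ.* (t ℕ.* u (suc k) ℕ.+ (u k ℕ.+ u k)))
        ≡⟨ cong (λ x → 2 ℕ.* (4 ℕ.* q ℕ.* x)) (sym (v≡tu+2u k)) ⟩
      2 ℕ.* (4 ℕ.* q ℕ.* v (suc k)) ∎)
      where
      open ≡-Reasoning
      q = 4 ℕ.^ k
      identity₁ : ∀ n d y A B → 2 ℕ.* (2 ℕ.* (n ℕ.* A ℕ.+ d ℕ.* y ℕ.* B)) ≡ 2 ℕ.* (n ℕ.* (2 ℕ.* A)) ℕ.+ d ℕ.* y ℕ.* (4 ℕ.* B)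
      identity₁ = ℕSolver.solve-∀
      identity₂ : ∀ n d y q u v → 2 ℕ.* (n ℕ.* (q ℕ.* v)) ℕ.+ d ℕ.* y ℕ.* (q ℕ.* (u ℕ.* y))
        ≡ q ℕ.* (2 ℕ.* (n ℕ.* v) ℕ.+ u ℕ.* (y ℕ.* y ℕ.* d))
      identity₂ = ℕSolver.solve-∀
      identity₃ : ∀ t q u v → q ℕ.* (2 ℕ.* ((t ℕ.+ t) ℕ.* v) ℕ.+ u ℕ.* ((t ℕ.+ t) ℕ.* (t ℕ.+ t) ℕ.+ 16))
        ≡ q ℕ.* (4 ℕ.* (t ℕ.* (v ℕ.+ t ℕ.* u) ℕ.+ 4 ℕ.* u))
      identity₃ = ℕSolver.solve-∀
      identity₄ : ∀ t q a b → q ℕ.* (4 ℕ.* (t ℕ.* (a ℕ.+ a) ℕ.+ 4 ℕ.* b)) ≡ 2 ℕ.* (4 ℕ.* q ℕ.* (t ℕ.* a ℕ.+ (b ℕ.+ b)))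
      identity₄ = ℕSolver.solve-∀
    4B≡4ᵏuy zero = refl
    4B≡4ᵏuy (suc k) = begin
      4 ℕ.* (y ℕ.* A k ℕ.+ n ℕ.* B k)
        ≡⟨ identity₁ n y (A k) (B k) ⟩
      2 ℕ.* (y ℕ.* (2 ℕ.* A k)) ℕ.+ n ℕ.* (4 ℕ.* B k)
        ≡⟨ cong₂ (λ a b → 2 ℕ.* (y ℕ.* a) ℕ.+ n ℕ.* b) (2A≡4ᵏv k) (4B≡4ᵏuy k) ⟩
      2 ℕ.* (y ℕ.* (q ℕ.* v k)) ℕ.+ n ℕ.* (q ℕ.* (u k ℕ.* y))
        ≡⟨ identity₂ t y q (u k) (v k) ⟩
      2 ℕ.* (q ℕ.* ((v k ℕ.+ t ℕ.* u k) ℕ.* y))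
        ≡⟨ cong (λ x → 2 ℕ.* (q ℕ.* (x ℕ.* y))) (sym (2u≡v+tu k)) ⟩
      2 ℕ.* (q ℕ.* ((u (suc k) ℕ.+ u (suc k)) ℕ.* y))
        ≡⟨ identity₃ q (u (suc k)) y ⟩
      4 ℕ.* q ℕ.* (u (suc k) ℕ.* y) ∎
      where
      open ≡-Reasoning
      q = 4 ℕ.^ k
      identity₁ : ∀ n y A B → 4 ℕ.* (y ℕ.* A ℕ.+ n ℕ.* B) ≡ 2 ℕ.* (y ℕ.* (2 ℕ.* A)) ℕ.+ n ℕ.* (4 ℕ.* B)
      identity₁ = ℕSolver.solve-∀
      identity₂ : ∀ t y q u v → 2 ℕ.* (y ℕ.* (q ℕ.* v)) ℕ.+ (t ℕ.+ t) ℕ.* (q ℕ.* (u ℕ.* y)) ≡ 2 ℕ.* (q ℕ.* ((v ℕ.+ t ℕ.* u) ℕ.* y))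
      identity₂ = ℕSolver.solve-∀
      identity₃ : ∀ q u y → 2 ℕ.* (q ℕ.* ((u ℕ.+ u) ℕ.* y)) ≡ 4 ℕ.* q ℕ.* (u ℕ.* y)
      identity₃ = ℕSolver.solve-∀

    signed-coefficient : ∀ q x P → 0 < q ℕ.* x → + q ℤ.* + x ≡ ℤ.- (+ 2 ℤ.* + P) → ⊥
    signed-coefficient q x P 0<qx p with trans (ℤ.pos-* q x) (trans p (cong ℤ.-_ (sym (ℤ.pos-* 2 P))))
    ... | e = nonneg (q ℕ.* x) (2 ℕ.* P) 0<qx e
      where
      nonneg : ∀ a b → 0 < a → + a ≡ ℤ.- + b → ⊥
      nonneg (suc a) zero _ ()
      nonneg (suc a) (suc b) _ ()

    positive-coefficient : ∀ q x P → + q ℤ.* + x ≡ + 2 ℤ.* + P → q ℕ.* x ≡ 2 ℕ.* P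
    positive-coefficient q x P p = ℤ.+-injective (trans (ℤ.pos-* q x) (trans p (sym (ℤ.pos-* 2 P))))

    -- Positivity of a and b selects the sign +1 and a nonnegative exponent among the units ±ε^(±k);
    -- the coordinates are then compared after cancelling 4^k.
    unit-index : ∀ {a b} → IsFundamentalUnit n y d → 1 ≤ a → 1 ≤ b → d ℕ.* (b ℕ.* b) ≡ a ℕ.* a ℕ.+ 4 →
      ∃ λ k → a ≡ v k × b ℕ.+ b ≡ u k ℕ.* y
    unit-index {a} {b} fundamental 1≤a 1≤b dbb≡ with fundamental (+ a) (+ b) (inj₂ is-unit)
      where
      identity : ∀ x → x ℤ.- (x ℤ.+ + 4) ≡ ℤ.- + 4
      identity = ℤSolver.solve-∀
      is-unit : + a ℤ.* + a ℤ.- + d ℤ.* + b ℤ.* + b ≡ ℤ.- + 4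
      is-unit = trans (cong₂ ℤ._-_ (sym (ℤ.pos-* a a))
        (trans (ℤ.*-assoc (+ d) (+ b) (+ b)) (trans (cong (+ d ℤ.*_) (sym (ℤ.pos-* b b)))
          (trans (sym (ℤ.pos-* d (b ℕ.* b))) (cong +_ dbb≡))))) (identity (+ (a ℕ.* a)))
    ... | k , s , s≡ , a≡ , b≡ = result s≡ b≡
      where
      q = 4 ℕ.^ k
      instance q≢0 = ℕ.m^n≢0 4 k
      0<q : 0 < q
      0<q = ℕ.m^n>0 4 k
      a≡′ : + q ℤ.* + a ≡ + 2 ℤ.* s ℤ.* + A k
      a≡′ = trans a≡ (cong (+ 2 ℤ.* s ℤ.*_) (powA≡ k))
      flip-sign : ∀ x → + 2 ℤ.* (ℤ.- + 1) ℤ.* x ≡ ℤ.- (+ 2 ℤ.* x)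
      flip-sign = ℤSolver.solve-∀
      result : s ≡ + 1 ⊎ s ≡ ℤ.- + 1 → + q ℤ.* + b ≡ + 2 ℤ.* s ℤ.* powB n y d k ⊎ + q ℤ.* + b ≡ ℤ.- (+ 2 ℤ.* s ℤ.* powB n y d k) →
        ∃ λ k → a ≡ v k × b ℕ.+ b ≡ u k ℕ.* y
      result (inj₂ refl) _ = ⊥-elim (signed-coefficient q a (A k) (ℕ.*-mono-≤ 0<q 1≤a) (trans a≡′ (flip-sign (+ A k))))
      result (inj₁ refl) (inj₂ p) = ⊥-elim (signed-coefficient q b (B k) (ℕ.*-mono-≤ 0<q 1≤b)
        (trans p (cong (λ x → ℤ.- (+ 2 ℤ.* x)) (powB≡ k))))
      result (inj₁ refl) (inj₁ p) = k ,
        ℕ.*-cancelˡ-≡ a (v k) q (trans (positive-coefficient q a (A k) a≡′) (2A≡4ᵏv k)) ,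
        ℕ.*-cancelˡ-≡ (b ℕ.+ b) (u k ℕ.* y) q (trans (ℕ.*-distribˡ-+ q b b)
          (trans (cong (λ x → x ℕ.+ x) (positive-coefficient q b (B k) (trans p (cong (λ x → + 2 ℤ.* x) (powB≡ k)))))
            (trans (double (B k)) (4B≡4ᵏuy k))))
        where
        double : ∀ x → 2 ℕ.* x ℕ.+ 2 ℕ.* x ≡ 4 ℕ.* x
        double = ℕSolver.solve-∀

open import Data.Nat using (_*_; _+_)

-- The square class over ℚ, read off in natural numbers.

squarefree-1 : SquareFree 1
squarefree-1 = s≤s z≤n , λ q q²∣1 → ℕ.m*n≡1⇒m≡1 q q (∣1⇒≡1 q²∣1)

rational-square : ∀ N q → q ℚ.* q ≡ ratℕ N → ∃ λ e → e * e ≡ N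
rational-square N q p = from-root (integer-root 1 N q squarefree-1 (trans (ℚ.*-identityˡ (q ℚ.* q)) p))
  where
  from-root : (∃ λ e → (q ≡ ratℕ e ⊎ q ≡ ℚ.- ratℕ e) × 1 * (e * e) ≡ N) → ∃ λ e → e * e ≡ N
  from-root (e , _ , e≡) = e , trans (sym (ℕ.*-identityˡ (e * e))) e≡

ratℕ≢0 : ∀ {n} → 1 ≤ n → ratℕ n ≢ 0ℚ
ratℕ≢0 {n} 1≤n p = ℕ.<⇒≢ 1≤n (sym (ratℕ-injective {n} {0} p))

-- For nonzero b, a/b would be a rational and hence integral square root of d; its square divides
-- the squarefree d, so d = 1.
squarefree-nonsquare : ∀ {d} → SquareFree d → d ≢ 1 → ∀ {a b} → a ℚ.* a ≡ ratℕ d ℚ.* (b ℚ.* b) → b ≡ 0ℚ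
squarefree-nonsquare {d} (_ , squarefree) d≢1 {a} {b} p with b ℚ.≟ 0ℚ
... | yes b≡0 = b≡0
... | no b≢0 = ⊥-elim (d≢1 (d≡1 (rational-square d (a ℚ.* i) q²≡d)))
  where
  instance _ = ℚ.≢-nonZero b≢0
  i = ℚ.1/ b
  open IntegerSolver ℚ-ring
  regroup : ∀ a i → (a ℚ.* i) ℚ.* (a ℚ.* i) ≡ (a ℚ.* a) ℚ.* (i ℚ.* i)
  regroup a i = solve 2 (λ a i → (a :* i) :* (a :* i) := (a :* a) :* (i :* i)) refl a i
  regroup′ : ∀ δ b i → (δ ℚ.* (b ℚ.* b)) ℚ.* (i ℚ.* i) ≡ δ ℚ.* ((b ℚ.* i) ℚ.* (b ℚ.* i))
  regroup′ δ b i = solve 3 (λ δ b i → (δ :* (b :* b)) :* (i :* i) := δ :* ((b :* i) :* (b :* i))) refl δ b i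
  q²≡d : (a ℚ.* i) ℚ.* (a ℚ.* i) ≡ ratℕ d
  q²≡d = trans (regroup a i) (trans (cong (ℚ._* (i ℚ.* i)) p) (trans (regroup′ (ratℕ d) b i)
    (trans (cong (λ x → ratℕ d ℚ.* (x ℚ.* x)) (ℚ.*-inverseʳ b)) (ℚ.*-identityʳ (ratℕ d)))))
  d≡1 : (∃ λ e → e * e ≡ d) → d ≡ 1
  d≡1 (e , e²≡d) = trans (sym e²≡d) (cong (λ x → x * x) (squarefree e (subst (e * e ∣_) e²≡d (divides 1 (sym (ℕ.*-identityˡ _))))))

fromℤ-square+16 : ∀ n → ℚSolver.fromℤ (+ n) ℚ.* ℚSolver.fromℤ (+ n) ℚ.+ ℚSolver.fromℤ (+ 16) ≡ ratℕ (n * n + 16)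
fromℤ-square+16 n = sym (trans (ratℕ-+ (n * n) 16) (cong (ℚ._+ ratℕ 16)
  (trans (ratℕ-* n n) (cong₂ ℚ._*_ (ratℕ≡fromℤ n) (ratℕ≡fromℤ n)))))

module LucasOverℚ (t : ℕ) where
  open Lucas t using (u; v)
  open RingLemmas ℚ-ring using (IsLucasPair)

  Uℚ Vℚ : ℕ → ℚ
  Uℚ j = ratℕ (u j)
  Vℚ j = ratℕ (v j)

  ratℕ-recurrence : ∀ a b → ratℕ (t * a + b) ≡ ratℕ t ℚ.* ratℕ a ℚ.+ ratℕ b
  ratℕ-recurrence a b = trans (ratℕ-+ (t * a) b) (cong (ℚ._+ ratℕ b) (ratℕ-* t a))

  lucas-pair : IsLucasPair (ratℕ t) Uℚ Vℚ
  lucas-pair = record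
    { U₀ = refl ; U₁ = refl ; V₀ = refl ; V₁ = refl
    ; U-rec = λ j → ratℕ-recurrence (u (suc j)) (u j)
    ; V-rec = λ j → ratℕ-recurrence (v (suc j)) (v j) }

module _ {y d t : ℕ} (1≤y : 1 ≤ y) (squarefree : SquareFree d) where
  open Lucas t using (u; v)
  open LucasOverℚ t

  -- The cases swap: r = 4dxy² already contains one factor d, so r = a² gives x = d□ and r = d a²
  -- gives x = □.
  lucas-square-root : ∀ {x} → let r = ℚSolver.fromℤ (+ 4) ℚ.* (ratℕ d ℚ.* (ratℕ x ℚ.* (ratℕ y ℚ.* ratℕ y))) in
    (∃ λ a → a ℚ.* a ≡ r) ⊎ (∃ λ a → ratℕ d ℚ.* (a ℚ.* a) ≡ r) →
    (∃ λ f → x ≡ f * f) ⊎ (∃ λ f → x ≡ d * (f * f))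
  lucas-square-root {x} (inj₁ (a , aa≡)) = inj₂ (from-root (integer-root d x (a ℚ.* (½ ℚ.* (1/y ℚ.* 1/d))) squarefree
      (Rescale.rescale-square ℚ-ring {½} {1/y} {ratℕ y} {1/d} {ratℕ d} {ratℕ x} {a} refl
        (ℚ.*-inverseˡ (ratℕ y)) (ℚ.*-inverseˡ (ratℕ d)) aa≡)))
    where
    instance
      _ = ℚ.≢-nonZero (ratℕ≢0 1≤y)
      _ = ℚ.≢-nonZero (ratℕ≢0 (proj₁ squarefree))
    1/y = ℚ.1/ ratℕ y
    1/d = ℚ.1/ ratℕ d
    from-root : (∃ λ e → (a ℚ.* (½ ℚ.* (1/y ℚ.* 1/d)) ≡ ratℕ e ⊎ a ℚ.* (½ ℚ.* (1/y ℚ.* 1/d)) ≡ ℚ.- ratℕ e) × d * (e * e) ≡ x) → ∃ λ f → x ≡ d * (f * f)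
    from-root (e , _ , p) = e , sym p
  lucas-square-root {x} (inj₂ (a , δaa≡)) = inj₁ (from-root (rational-square x (a ℚ.* (½ ℚ.* 1/y))
      (Rescale.rescale-multiple ℚ-ring {½} {1/y} {ratℕ y} {1/d} {ratℕ d} {ratℕ x} {a} refl
        (ℚ.*-inverseˡ (ratℕ y)) (ℚ.*-inverseˡ (ratℕ d)) δaa≡)))
    where
    instance
      _ = ℚ.≢-nonZero (ratℕ≢0 1≤y)
      _ = ℚ.≢-nonZero (ratℕ≢0 (proj₁ squarefree))
    1/y = ℚ.1/ ratℕ y
    1/d = ℚ.1/ ratℕ d
    from-root : (∃ λ e → e * e ≡ x) → ∃ λ f → x ≡ f * f
    from-root (e , p) = e , sym p

  module _ (d≢1 : d ≢ 1) (n≡2 : (t + t) % 4 ≡ 2) (n²+16 : (t + t) * (t + t) + 16 ≡ y * y * d) where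

    -- Putting m = 2a and e = 2b turns the equation into d b² = a² + 4, so (a + b√d)/2 is a unit of
    -- norm -1 and the fundamental unit applies; the norm decides the parity of the index.
    unit-parameters : IsFundamentalUnit (t + t) y d → ∀ {m e} → 1 ≤ m → d * (e * e) ≡ m * m + 16 →
      ∃ λ j → m ≡ v (suc (j + j)) + v (suc (j + j)) × e ≡ u (suc (j + j)) * y
    unit-parameters fundamental {m} {e} 1≤m dee≡ = from-conductor (even-conductor {t + t} {m} {y} {e} n≡2 n²+16 dee≡)
      where
      open LucasNorm t
      open PowerCoefficients y d n²+16
      Conclusion : Set
      Conclusion = ∃ λ j → m ≡ v (suc (j + j)) + v (suc (j + j)) × e ≡ u (suc (j + j)) * y
      half-positive : ∀ a → 1 ≤ a + a → 1 ≤ a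
      half-positive (suc a) _ = s≤s z≤n
      b-positive : ∀ b → d * ((b + b) * (b + b)) ≡ m * m + 16 → 1 ≤ b
      b-positive zero p = ⊥-elim (ℕ.<⇒≢ (ℕ.≤-trans (s≤s z≤n) (ℕ.m≤n+m 16 (m * m))) (trans (sym (ℕ.*-zeroʳ d)) p))
      b-positive (suc b) _ = s≤s z≤n
      collect : ∀ d b → d * (b * b) * 4 ≡ d * ((b + b) * (b + b))
      collect = ℕSolver.solve-∀
      expand : ∀ a → (a + a) * (a + a) + 16 ≡ (a * a + 4) * 4
      expand = ℕSolver.solve-∀
      regroup : ∀ d u y → d * ((u * y) * (u * y)) ≡ u * u * (y * y * d)
      regroup = ℕSolver.solve-∀
      quarter : ∀ u t → u * u * ((t + t) * (t + t) + 16) ≡ u * u * (t * t + 4) * 4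
      quarter = ℕSolver.solve-∀

      from-conductor : (∃ λ a → m ≡ a + a) → Conclusion
      from-conductor (a , m≡) = from-cofactor (even-cofactor {d} {e} {a * a + 4} squarefree dee≡4x)
        where
        dee≡4x : d * (e * e) ≡ (a * a + 4) * 4
        dee≡4x = trans dee≡ (trans (cong (λ x → x * x + 16) m≡) (expand a))
        from-cofactor : (∃ λ b → e ≡ b + b) → Conclusion
        from-cofactor (b , e≡) = from-index (unit-index fundamental (half-positive a (subst (1 ≤_) m≡ 1≤m))
            (b-positive b (trans (cong (λ x → d * (x * x)) (sym e≡)) dee≡)) dbb≡)
          where
          dbb≡ : d * (b * b) ≡ a * a + 4
          dbb≡ = ℕ.*-cancelʳ-≡ _ _ 4 (trans (collect d b) (trans (cong (λ x → d * (x * x)) (sym e≡)) dee≡4x))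
          from-index : (∃ λ k → a ≡ v k × b + b ≡ u k * y) → Conclusion
          from-index (k , a≡ , b≡) = from-odd (norm-minus-four⇒odd k norm)
            where
            norm : v k * v k + 4 ≡ u k * u k * (t * t + 4)
            norm = ℕ.*-cancelʳ-≡ _ _ 4 (trans (cong (λ x → (x * x + 4) * 4) (sym a≡)) (trans (sym dee≡4x)
              (trans (cong (λ x → d * (x * x)) (trans e≡ b≡)) (trans (regroup d (u k) y)
                (trans (cong (u k * u k *_) (sym n²+16)) (quarter (u k) t))))))
            from-odd : (∃ λ j → k ≡ suc (j + j)) → Conclusion
            from-odd (j , k≡) = j , trans m≡ (trans (cong (λ x → x + x) a≡) (cong (λ k → v k + v k) k≡)) ,
              trans e≡ (trans b≡ (cong (λ k → u k * y) k≡))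

    private
      δ Y : ℚ
      δ = ratℕ d
      Y = ratℕ y

      nonsquare : RingLemmas.IsNonsquare ℚ-ring δ
      nonsquare {a} {b} = squarefree-nonsquare squarefree d≢1 {a} {b}

      N²+16 : ℚSolver.fromℤ (+ (t + t)) ℚ.* ℚSolver.fromℤ (+ (t + t)) ℚ.+ ℚSolver.fromℤ (+ 16) ≡ δ ℚ.* (Y ℚ.* Y)
      N²+16 = trans (fromℤ-square+16 (t + t)) (trans (cong ratℕ n²+16)
        (trans (ratℕ-* (y * y) d) (trans (ℚ.*-comm (ratℕ (y * y)) δ) (cong (δ ℚ.*_) (ratℕ-* y y)))))

      id-hom : IsHom ℚ-ring ℚ-ring (λ q → q)
      id-hom = Identity.isRingHomomorphism (CommutativeRing.rawRing ℚ-ring) refl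

    iso-lucas-square : IsFundamentalUnit (t + t) y d → ∀ m → 1 ≤ m → m ≢ 3 → FieldIso m (t + t) →
      ∃ λ j → let k = suc (j + j) in m ≡ v k + v k × ((∃ λ f → u k ≡ f * f) ⊎ (∃ λ f → u k ≡ d * (f * f)))
    iso-lucas-square fundamental m 1≤m m≢3 iso = from-class
      (Tower.Isomorphism.iso-lucas ℚ-ring ℚ-integral ½ refl δ (λ {a} {b} → nonsquare {a} {b}) (λ q → q) id-hom (t + t) {Y} N²+16
        lucas-pair (trans (sym (ratℕ≡fromℤ (t + t))) (ratℕ-+ t t)) m m²+16≢0 m²+16-nonsquare iso)
      where
      M : ℚ
      M = ℚSolver.fromℤ (+ m)
      m²+16≢0 : ¬ (M ℚ.* M ℚ.+ ℚSolver.fromℤ (+ 16) ≡ 0ℚ)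
      m²+16≢0 p = ratℕ≢0 (ℕ.≤-trans (s≤s z≤n) (ℕ.m≤n+m 16 (m * m))) (trans (sym (fromℤ-square+16 m)) p)
      -- m = 3 is the only positive value for which m² + 16 is a square, so excluding it makes √(m²
      -- + 16) irrational.
      m²+16-nonsquare : ∀ a → ¬ (a ℚ.* a ≡ M ℚ.* M ℚ.+ ℚSolver.fromℤ (+ 16))
      m²+16-nonsquare a p = m≢3 (from-root (rational-square (m * m + 16) a (trans p (fromℤ-square+16 m))))
        where
        from-root : (∃ λ e → e * e ≡ m * m + 16) → m ≡ 3
        from-root (e , p) = square+16-square m e 1≤m p
      Conclusion : Set
      Conclusion = ∃ λ j → let k = suc (j + j) in m ≡ v k + v k × ((∃ λ f → u k ≡ f * f) ⊎ (∃ λ f → u k ≡ d * (f * f)))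
      from-class : (∃ λ b → M ℚ.* M ℚ.+ ℚSolver.fromℤ (+ 16) ≡ δ ℚ.* (b ℚ.* b) ×
        (∀ j → let x = Uℚ (suc (j + j)) ; z = Vℚ (suc (j + j)) ; r = ℚSolver.fromℤ (+ 4) ℚ.* (δ ℚ.* (x ℚ.* (Y ℚ.* Y))) in
          M ≡ z ℚ.+ z → b ≡ x ℚ.* Y ⊎ b ≡ ℚ.- (x ℚ.* Y) → (∃ λ a → a ℚ.* a ≡ r) ⊎ (∃ λ a → δ ℚ.* (a ℚ.* a) ≡ r))) →
        Conclusion
      -- d b² is an integer and d is squarefree, so the rational b is an integer up to sign.
      from-class (b , m²+16≡ , square-class) = from-integer (integer-root d (m * m + 16) b squarefree
          (trans (sym m²+16≡) (fromℤ-square+16 m)))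
        where
        from-integer : (∃ λ e → (b ≡ ratℕ e ⊎ b ≡ ℚ.- ratℕ e) × d * (e * e) ≡ m * m + 16) → Conclusion
        from-integer (e , b≡ , dee≡) = from-parameters (unit-parameters fundamental 1≤m dee≡)
          where
          from-parameters : (∃ λ j → m ≡ v (suc (j + j)) + v (suc (j + j)) × e ≡ u (suc (j + j)) * y) → Conclusion
          from-parameters (j , m≡ , e≡) = j , m≡ , lucas-square-root (square-class j
              (trans (sym (ratℕ≡fromℤ m)) (trans (cong ratℕ m≡) (ratℕ-+ (v k) (v k)))) (signed b≡))
            where
            k = suc (j + j)
            e≡′ : ratℕ e ≡ ratℕ (u k) ℚ.* Y
            e≡′ = trans (cong ratℕ e≡) (ratℕ-* (u k) y)
            signed : b ≡ ratℕ e ⊎ b ≡ ℚ.- ratℕ e → b ≡ ratℕ (u k) ℚ.* Y ⊎ b ≡ ℚ.- (ratℕ (u k) ℚ.* Y)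
            signed (inj₁ p) = inj₁ (trans p e≡′)
            signed (inj₂ p) = inj₂ (trans p (cong ℚ.-_ e≡′))

-- Passage from n to t = n/2, and the conclusion.

half-of-2-mod-4 : ∀ n → n % 4 ≡ 2 → n ≡ n / 2 + n / 2 × (n / 2) % 2 ≡ 1
half-of-2-mod-4 n p = n≡t+t , t-odd (even-or-odd (n / 2))
  where
  n%2≡0 : n % 2 ≡ 0
  n%2≡0 = trans (sym (m∣n⇒o%n%m≡o%m 2 4 n (divides 2 refl))) (cong (_% 2) p)
  twice : ∀ t → 0 + t * 2 ≡ t + t
  twice = ℕSolver.solve-∀
  four : ∀ i → (i + i) + (i + i) ≡ i * 4
  four = ℕSolver.solve-∀
  n≡t+t : n ≡ n / 2 + n / 2
  n≡t+t = trans (m≡m%n+[m/n]*n n 2) (trans (cong (_+ n / 2 * 2) n%2≡0) (twice (n / 2)))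
  t-odd : (∃ λ i → n / 2 ≡ i + i ⊎ n / 2 ≡ suc (i + i)) → (n / 2) % 2 ≡ 1
  t-odd (i , inj₂ q) = trans (cong (_% 2) q) (double%2 1 i)
  t-odd (i , inj₁ q) = ⊥-elim (ℕ.0≢1+n (trans (sym (trans (cong (_% 4) (trans n≡t+t (trans (cong (λ x → x + x) q) (four i)))) (m*n%n≡0 i 4))) p))

-- Only n = 3 makes n² + 16 a square, and 3 is not 2 modulo 4. This is what gives d ≠ 1.
conductor-not-square : ∀ n y → n % 4 ≡ 2 → n * n + 16 ≢ y * y
conductor-not-square n y n≡2 p = contradiction-at-3 (square+16-square n y (positive n n≡2) (sym p)) n≡2
  where
  positive : ∀ n → n % 4 ≡ 2 → 1 ≤ n
  positive (suc n) _ = s≤s z≤n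
  contradiction-at-3 : ∀ {n} → n ≡ 3 → n % 4 ≢ 2
  contradiction-at-3 refl ()

-- The witness is x = df: from d f² = r + cv follows (df)² - dr = dcv, a multiple of p.
square-congruence : ∀ {d p r s v c f : ℕ} → s ≡ r + c * v → s ≡ d * (f * f) → p ∣ v →
  ∃ λ (x : ℤ) → (+ p) ∣ℤ (x ℤ.* x ℤ.- + (d * r))
square-congruence {d} {p} {r} {s} {v} {c} {f} s≡ s≡df² p∣v = + (d * f) ,
    subst ((+ p) ∣ℤ_) (sym difference) (∣n⇒∣m*n d (∣n⇒∣m*n c p∣v))
  where
  regroup : ∀ d f → d * f * (d * f) ≡ d * (d * (f * f))
  regroup = ℕSolver.solve-∀
  cancel : ∀ x z → (x ℤ.+ z) ℤ.- x ≡ z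
  cancel = ℤSolver.solve-∀
  difference : + (d * f) ℤ.* + (d * f) ℤ.- + (d * r) ≡ + (d * (c * v))
  difference = trans (cong (ℤ._- + (d * r)) (trans (sym (ℤ.pos-* (d * f) (d * f)))
      (cong +_ (trans (regroup d f) (trans (cong (d *_) (trans (sym s≡df²) s≡)) (ℕ.*-distribˡ-+ d r (c * v)))))))
    (cancel (+ (d * r)) (+ (d * (c * v))))

theorem4 : (n y d : ℕ) → n % 4 ≡ 2 →
    1 ≤ y → SquareFree d → n * n + 16 ≡ y * y * d →
    IsFundamentalUnit n y d →
    (r₀ : ℕ) → r₀ % 2 ≡ 1 → d ∣ lucasU (n / 2) r₀ →
    (∀ r → r % 2 ≡ 1 → r < r₀ → ¬ (d ∣ lucasU (n / 2) r)) →
    (p : ℕ) → Prime p → p % 4 ≡ 1 → p ∣ lucasV (n / 2) r₀ →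
    ¬ (∃ λ (x : ℤ) → (+ p) ∣ℤ (x ℤ.* x ℤ.- + (d * lucasU (n / 2) r₀))) →
    ∀ m → 1 ≤ m → m ≢ 3 → m ≢ n → ¬ SameField m n
theorem4 n y d n≡2 1≤y squarefree n²+16 fundamental r₀ r₀-odd d∣u minimal p _ _ p∣v nonresidue m 1≤m m≢3 m≢n iso =
  conclude (iso-lucas-square 1≤y squarefree d≢1 (subst (λ x → x % 4 ≡ 2) n≡t+t n≡2)
    (subst (λ x → x * x + 16 ≡ y * y * d) n≡t+t n²+16)
    (subst (λ x → IsFundamentalUnit x y d) n≡t+t fundamental) m 1≤m m≢3
    (subst (FieldIso m) n≡t+t iso))
  where
  t = n / 2
  n≡t+t = proj₁ (half-of-2-mod-4 n n≡2)
  open Lucas t using (u; v)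
  open LucasConsequences t
  open Rank d r₀ r₀-odd d∣u minimal
  d≢1 : d ≢ 1
  d≢1 d≡1 = conductor-not-square n y n≡2 (trans n²+16 (trans (cong (y * y *_) d≡1) (ℕ.*-identityʳ (y * y))))
  conclude : (∃ λ j → let k = suc (j + j) in m ≡ v k + v k × ((∃ λ f → u k ≡ f * f) ⊎ (∃ λ f → u k ≡ d * (f * f)))) → ⊥
  -- The index k = 1 gives m = 2v₁ = 2t = n.
  conclude (j , m≡ , inj₁ (f , u≡)) = m≢n (trans m≡ (trans (cong (λ k → v k + v k) k≡1) (sym n≡t+t)))
    where
    k≡1 : suc (j + j) ≡ 1
    k≡1 = square-odd-index (proj₂ (half-of-2-mod-4 n n≡2)) (suc (j + j)) (double%2 1 j) f u≡
  conclude (j , _ , inj₂ (f , u≡)) = from-rank (odd-multiple (suc (j + j)) (double%2 1 j)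
      (divides (f * f) (trans u≡ (ℕ.*-comm d (f * f)))))
    where
    from-rank : (∃ λ q → suc (j + j) ≡ r₀ + q * (r₀ + r₀)) → ⊥
    from-rank (q , k≡) = nonresidue (square-congruence {d} {p} {u r₀} {u (suc (j + j))} {v r₀} {proj₁ (u-odd-multiple q)} {f}
      (trans (cong u k≡) (proj₂ (u-odd-multiple q))) u≡ p∣v)
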